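{- For every constant $K>0$ there is a constant $C>0$ (depending only on $K$) such that the following holds for every finite field $\mathbb{F}_q$ with $q$ elements. If $E\subset\mathbb{F}_q^3$ is product-like with constant $K$ and $|E|\ge C q^{\frac{15}{8}}$, then $$\mathbb{F}_q^*\subset vol(E).$$
   Context: A set $E\subset\mathbb{F}_q^d$ is product-like (with constant $K$) if for every $n$ and every $n$-dimensional linear subspace $H_n\subset\mathbb{F}_q^d$ one has $|E\cap H_n|\le K|E|^{n/d}$ (the constant $K$ is the implicit constant in the usual formulation $|E\cap H_n|\lesssim|E|^{n/d}$, and does not depend on $q$); here $d=3$. For $x^1,x^2,x^3\in\mathbb{F}_q^3$, $vol(x^1,x^2,x^3)$ is the determinant of the $3\times3$ matrix with rows $x^1,x^2,x^3$, and $vol(E)=\{vol(x^1,x^2,x^3): x^1,x^2,x^3\in E\}$. $\mathbb{F}_q^*=\mathbb{F}_q\setminus\{0\}$. -}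

module Defs where

open import Algebra.Bundles using (CommutativeRing; Semiring)
import Algebra.Definitions.RawSemiring as RawSemiringOps
open import Data.Fin.Base using (Fin; zero; suc; toℕ; finToFun)
open import Data.Integer.Base using (+_)
open import Data.List.Base as List using (List; length; filter; allFin)
open import Data.Nat.Base as ℕ using (ℕ; zero; suc)
open import Data.Product.Base using (∃; ∃-syntax; _×_; _,_)
open import Data.Rational.Base using (ℚ; _/_; _≤_; _*_; +-*-rawSemiring)
open import Data.Vec.Functional using (Vector; _∷_; []; removeAt)
open import Data.Vec.Functional.Relation.Binary.Pointwise using (Pointwise)
open import Function.Bundles using (Inverse)
open import Level using (Level; _⊔_) renaming (suc to lsuc)
open import Relation.Binary.Core using (Rel)
open import Relation.Binary.Definitions using (_Respects_)
open import Relation.Binary.PropositionalEquality using (setoid)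
open import Relation.Nullary.Decidable using (_×-dec_)
open import Relation.Nullary.Negation using (¬_)
open import Relation.Unary using (Pred; Decidable; _∈_)

open RawSemiringOps +-*-rawSemiring public using (_^_)

private
  variable
    c ℓ e h : Level
    d n : ℕ

fromℕ : ℕ → ℚ
fromℕ m = + m / 1

record FiniteField c ℓ : Set (lsuc (c ⊔ ℓ)) where
  field
    commutativeRing : CommutativeRing c ℓ
  open CommutativeRing commutativeRing public
    renaming (_+_ to _+F_; _*_ to _*F_; -_ to -F_; setoid to ≈-setoid; zero to zeroF)
  field
    1≉0         : ¬ (1# ≈ 0#)
    inverse     : ∀ x → ¬ (x ≈ 0#) → ∃[ y ] (x *F y) ≈ 1#
    q           : ℕ
    enumeration : Inverse (setoid (Fin q)) ≈-setoid

  open RawSemiringOps (Semiring.rawSemiring semiring) public using (sum) renaming (_^_ to _^F_)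

module _ (F : FiniteField c ℓ) where
  open FiniteField F

  Point : ℕ → Set c
  Point d = Vector Carrier d

  infix 4 _≋_
  _≋_ : Rel (Point d) ℓ
  _≋_ = Pointwise _≈_

  -- Every point of F^d, listed exactly once up to _≋_.
  points : ∀ d → List (Point d)
  points d = List.map (λ i k → Inverse.to enumeration (finToFun {q} {d} i k)) (allFin (q ℕ.^ d))

  -- Subsets carry a membership decision so that they can be counted.
  record Subset (d : ℕ) (e : Level) : Set (c ⊔ ℓ ⊔ lsuc e) where
    field
      member  : Pred (Point d) e
      member? : Decidable member
      resp    : member Respects _≋_

  F* : Pred Carrier ℓ
  F* t = ¬ (t ≈ 0#)

  linComb : Vector Carrier n → Vector (Point d) n → Point d
  linComb a b k = sum (λ i → a i *F b i k)

  -- Laplace expansion along the first row; M i is the i-th row.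
  det : Vector (Point n) n → Carrier
  det {zero}  M = 1#
  det {suc n} M = sum λ j →
    ((-F 1#) ^F toℕ j) *F (M zero j *F det (λ i → removeAt (M (suc i)) j))

  vol : Point 3 → Point 3 → Point 3 → Carrier
  vol x¹ x² x³ = det (x¹ ∷ x² ∷ x³ ∷ [])

module _ {F : FiniteField c ℓ} where
  open FiniteField F
  open Subset

  infixr 7 _∩_
  _∩_ : Subset F d e → Subset F d h → Subset F d (e ⊔ h)
  (P ∩ Q) .member x  = x ∈ member P × x ∈ member Q
  (P ∩ Q) .member? x = member? P x ×-dec member? Q x
  (P ∩ Q) .resp x≋y (p , q) = resp P x≋y p , resp Q x≋y q

  card : Subset F d e → ℕ
  card {d = d} P = length (filter (member? P) (points F d))

  record IsSubspace (H : Subset F d h) : Set (c ⊔ ℓ ⊔ h) where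
    field
      0-closed : (λ _ → 0#) ∈ member H
      +-closed : ∀ {x y} → x ∈ member H → y ∈ member H → (λ k → x k +F y k) ∈ member H
      *-closed : ∀ s {x} → x ∈ member H → (λ k → s *F x k) ∈ member H

  LinearlyIndependent : Vector (Point F d) n → Set (c ⊔ ℓ)
  LinearlyIndependent {n = n} b =
    (a : Vector Carrier n) → _≋_ F (linComb F a b) (λ _ → 0#) → ∀ i → a i ≈ 0#

  record IsBasis (H : Subset F d h) (b : Vector (Point F d) n) : Set (c ⊔ ℓ ⊔ h) where
    field
      in-subspace : ∀ i → b i ∈ member H
      independent : LinearlyIndependent b
      spanning    : ∀ x → x ∈ member H → ∃[ a ] _≋_ F x (linComb F a b)

  HasDimension : Subset F d h → ℕ → Set (c ⊔ ℓ ⊔ h)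
  HasDimension {d = d} H n = ∃ λ (b : Vector (Point F d) n) → IsBasis H b

  -- |E ∩ H| ≤ K |E|^(n/d), with both (nonnegative) sides raised to the power
  -- d; intended for d ≥ 1 and K > 0.  A subspace with a basis always has
  -- decidable membership, since F is finite, and spans live at level c ⊔ ℓ, so
  -- H ranges over all n-dimensional subspaces.
  ProductLike : ℚ → Subset F d e → Set (lsuc (c ⊔ ℓ))
  ProductLike {d = d} K E =
    ∀ n (H : Subset F d (c ⊔ ℓ)) → IsSubspace H → HasDimension H n →
    fromℕ (card (E ∩ H)) ^ d ≤ K ^ d * fromℕ (card E) ^ n

  volSet : Subset F 3 e → Pred Carrier (c ⊔ ℓ ⊔ e)
  volSet E t = ∃[ x¹ ] ∃[ x² ] ∃[ x³ ]
    x¹ ∈ member E × x² ∈ member E × x³ ∈ member E × t ≈ vol F x¹ x² x³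

{-# OPTIONS --safe #-}

-- Discard the origin from E and let f(w) be the number of pairs (y, z) in E² with y × z = w;
-- the determinant of x, y, z is x · (y × z).  If t ≠ 0 is not attained, then f vanishes wherever
-- Q(w) = #{x ∈ E : x · w = t} does not, so Cauchy–Schwarz and Σ_w (|E| − q Q(w))² ≤ q⁴ |E| give
-- |E| (Σ f)² ≤ q⁴ Σ f², both sums over w ≠ 0.  To bound Σ f², apply Cauchy–Schwarz in each plane
-- w⊥ to the number of z ∈ E with y × z = w, centred at its mean |E ∩ w⊥| / q.  The squared
-- deviation is invariant under (y, w) ↦ (a y, a w), so its sum over y ∈ E is at most
-- max |E ∩ line| / (q − 1) times its sum over all y, and the latter is an explicit count.  Since
-- |E ∩ line| ≲ |E|^(1/3) and |E ∩ plane| ≲ |E|^(2/3), this gives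
-- Σ f² ≲ (|E|^(4/3) / q² + |E|^(1/3)) q |E|², which is impossible once |E| ≥ C q^(15/8).
module Submission where

open import Algebra.Bundles using (CommutativeRing; RawRing)
open import Algebra.Morphism.Structures using (IsRingMonomorphism)
import Algebra.Morphism.RingMonomorphism as RingMonomorphism
import Algebra.Properties.AbelianGroup as AbelianGroupProperties
import Algebra.Properties.Ring as RingProperties
import Algebra.Properties.Semiring.Mult as SemiringMult
import Algebra.Solver.Ring
open import Algebra.Solver.Ring.AlmostCommutativeRing using (_-Raw-AlmostCommutative⟶_; fromCommutativeRing)
import Algebra.Solver.Ring.NaturalCoefficients
open import Algebra.Structures using (IsCommutativeRing)
open import Data.Empty using (⊥; ⊥-elim)
open import Data.Fin.Base using (Fin; zero; suc; finToFun; funToFin)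
import Data.Fin.Properties as Fin
open import Data.Integer.Base as ℤ using (ℤ; 0ℤ; 1ℤ; +_; -[1+_]; +≤+)
import Data.Integer.Properties as ℤ
open import Data.Integer.Tactic.RingSolver using (solve-∀)
open import Data.List.Base as List using (List; []; _∷_; length; filter; allFin)
import Data.List.Properties as List
open import Data.Maybe.Base using (Maybe; just; nothing)
open import Data.Nat.Base as ℕ using (ℕ; zero; suc; z≤n; s≤s; NonZero; >-nonZero)
import Data.Nat.Coprimality as Coprimality
import Data.Nat.Properties as ℕ
open import Data.Product.Base using (Σ; ∃; _×_; _,_; proj₁; proj₂)
open import Data.Sum.Base using (_⊎_; inj₁; inj₂)
open import Data.Unit.Base using (⊤; tt)
import Data.Vec.Functional as VecF
open import Function.Bundles using (Inverse)
open import Level using (Level; 0ℓ; Lift; lift; lower; _⊔_)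
open import Relation.Binary.Definitions using (DecidableEquality)
open import Relation.Binary.PropositionalEquality as ≡ using (_≡_; _≢_)
open import Relation.Nullary.Decidable.Core using (Dec; yes; no; _×-dec_; ¬?; map′)
open import Relation.Nullary.Negation using (¬_; contradiction)
open import Relation.Unary using (Pred; Decidable; _⊆_; _∈_)

-- The obstacle is that E is controlled only on lines and planes through the origin, so the squared
-- deviations, summed over y ∈ E, cannot be counted directly. Scaling is what helps: after summation
-- over w the deviations form a function of y that is constant on each punctured line through the
-- origin, and E contains few of the q - 1 points of such a line. The condition t ≠ 0 is used in the
-- variance of Q: two distinct parallel vectors cannot both have product t with the same w, so
-- parallel pairs contribute nothing there. With N the number of nonzero points of E, the estimates
-- combine to N³ ≲ q³ N^(4/3) + q⁵ N^(1/3). The first term, from the means P²/q, is excluded above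
-- q^(9/5), the second, from the deviations, above q^(15/8); so the deviations set the exponent.
-- Denominators are cleared throughout: deviations carry a factor q, and the cube root of |E| is
-- replaced by an integer m with |E| ≤ m³ ≤ 8 |E|.

module FiniteSums where
  open import Data.Integer.Base using (_+_; _*_; _-_; -_; _≤_)
  open ≡ using (refl; sym; trans; cong; cong₂; subst; subst₂; module ≡-Reasoning)

  private
    variable
      p r : Level
      X Y : Set
      P : Set p
      R : Set r

  -- Integer-valued finite sums, indicators and double counting

  0≤a² : ∀ a → 0ℤ ≤ a * a
  0≤a² (+ n)    = subst (0ℤ ≤_) (ℤ.pos-* n n) (+≤+ z≤n)
  0≤a² -[1+ n ] = +≤+ z≤n

  0≤a*b : ∀ {a b} → 0ℤ ≤ a → 0ℤ ≤ b → 0ℤ ≤ a * b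
  0≤a*b {+ m} {+ n} _ _ = subst (0ℤ ≤_) (ℤ.pos-* m n) (+≤+ z≤n)

  *-monoˡ : ∀ {a b c} → 0ℤ ≤ c → a ≤ b → c * a ≤ c * b
  *-monoˡ {c = + n} _ = ℤ.*-monoˡ-≤-nonNeg (+ n)

  *-monoʳ : ∀ {a b c} → 0ℤ ≤ c → a ≤ b → a * c ≤ b * c
  *-monoʳ {c = + n} _ = ℤ.*-monoʳ-≤-nonNeg (+ n)

  *-mono : ∀ {a b c d} → 0ℤ ≤ a → 0ℤ ≤ d → a ≤ b → c ≤ d → a * c ≤ b * d
  *-mono 0≤a 0≤d a≤b c≤d = ℤ.≤-trans (*-monoˡ 0≤a c≤d) (*-monoʳ 0≤d a≤b)

  *-cancelˡ : ∀ {a b c} → 1ℤ ≤ c → c * a ≤ c * b → a ≤ b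
  *-cancelˡ {c = + ℕ.suc n} _ = ℤ.*-cancelˡ-≤-pos _ _ (+ ℕ.suc n)
  *-cancelˡ {c = + ℕ.zero} (+≤+ ())

  ∑ : List X → (X → ℤ) → ℤ
  ∑ []       f = 0ℤ
  ∑ (x ∷ xs) f = f x + ∑ xs f

  ∑-cong : ∀ (xs : List X) {f g : X → ℤ} → (∀ x → f x ≡ g x) → ∑ xs f ≡ ∑ xs g
  ∑-cong []       f≗g = refl
  ∑-cong (x ∷ xs) f≗g = cong₂ _+_ (f≗g x) (∑-cong xs f≗g)

  ∑-mono : ∀ (xs : List X) {f g : X → ℤ} → (∀ x → f x ≤ g x) → ∑ xs f ≤ ∑ xs g
  ∑-mono []       f≤g = ℤ.≤-refl
  ∑-mono (x ∷ xs) f≤g = ℤ.+-mono-≤ (f≤g x) (∑-mono xs f≤g)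

  ∑-zero : ∀ (xs : List X) → ∑ xs (λ _ → 0ℤ) ≡ 0ℤ
  ∑-zero []       = refl
  ∑-zero (x ∷ xs) = trans (ℤ.+-identityˡ _) (∑-zero xs)

  ∑-nonneg : ∀ (xs : List X) {f : X → ℤ} → (∀ x → 0ℤ ≤ f x) → 0ℤ ≤ ∑ xs f
  ∑-nonneg xs {f} 0≤f = subst (_≤ ∑ xs f) (∑-zero xs) (∑-mono xs 0≤f)

  ∑-+ : ∀ (xs : List X) (f g : X → ℤ) → ∑ xs (λ x → f x + g x) ≡ ∑ xs f + ∑ xs g
  ∑-+ []       f g = refl
  ∑-+ (x ∷ xs) f g = trans (cong (_+_ (f x + g x)) (∑-+ xs f g)) (interchange (f x) (g x) (∑ xs f) (∑ xs g))
    where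
    interchange : ∀ a b c d → a + b + (c + d) ≡ a + c + (b + d)
    interchange = solve-∀

  ∑-*ˡ : ∀ (xs : List X) c (f : X → ℤ) → ∑ xs (λ x → c * f x) ≡ c * ∑ xs f
  ∑-*ˡ []       c f = sym (ℤ.*-zeroʳ c)
  ∑-*ˡ (x ∷ xs) c f = trans (cong (_+_ (c * f x)) (∑-*ˡ xs c f)) (sym (ℤ.*-distribˡ-+ c (f x) (∑ xs f)))

  ∑-*ʳ : ∀ (xs : List X) (f : X → ℤ) c → ∑ xs (λ x → f x * c) ≡ ∑ xs f * c
  ∑-*ʳ xs f c = trans (∑-cong xs (λ x → ℤ.*-comm (f x) c)) (trans (∑-*ˡ xs c f) (ℤ.*-comm c _))

  ∑-const : ∀ (xs : List X) c → ∑ xs (λ _ → c) ≡ c * ∑ xs (λ _ → 1ℤ)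
  ∑-const xs c = trans (∑-cong xs (λ _ → sym (ℤ.*-identityʳ c))) (∑-*ˡ xs c _)

  ∑-swap : ∀ (xs : List X) (ys : List Y) (f : X → Y → ℤ) →
    ∑ xs (λ x → ∑ ys (λ y → f x y)) ≡ ∑ ys (λ y → ∑ xs (λ x → f x y))
  ∑-swap []       ys f = sym (∑-zero ys)
  ∑-swap (x ∷ xs) ys f = trans (cong (_+_ (∑ ys (f x))) (∑-swap xs ys f)) (sym (∑-+ ys (f x) _))

  ∑*∑ : ∀ (xs : List X) (ys : List Y) (f : X → ℤ) (g : Y → ℤ) →
    ∑ xs f * ∑ ys g ≡ ∑ xs (λ x → ∑ ys (λ y → f x * g y))
  ∑*∑ xs ys f g = trans (sym (∑-*ʳ xs f _)) (∑-cong xs (λ x → sym (∑-*ˡ ys (f x) g)))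

  -- Every variance below has this shape, with `a` and `b` independent of the summation variable,
  -- and so has the inner sum of the double sum in `cauchy-schwarz`.
  ∑-square : ∀ (xs : List X) a b (f g : X → ℤ) →
    ∑ xs (λ x → (a * f x - b * g x) * (a * f x - b * g x)) ≡
    a * a * ∑ xs (λ x → f x * f x) + - (+ 2 * a * b) * ∑ xs (λ x → f x * g x) + b * b * ∑ xs (λ x → g x * g x)
  ∑-square xs a b f g = begin
    ∑ xs (λ x → (a * f x - b * g x) * (a * f x - b * g x))
      ≡⟨ ∑-cong xs (λ x → expand a b (f x) (g x)) ⟩
    ∑ xs (λ x → a * a * (f x * f x) + - (+ 2 * a * b) * (f x * g x) + b * b * (g x * g x))
      ≡⟨ ∑-+ xs _ _ ⟩
    ∑ xs (λ x → a * a * (f x * f x) + - (+ 2 * a * b) * (f x * g x)) + ∑ xs (λ x → b * b * (g x * g x))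
      ≡⟨ cong₂ _+_ (trans (∑-+ xs _ _) (cong₂ _+_ (∑-*ˡ xs (a * a) (λ x → f x * f x)) (∑-*ˡ xs (- (+ 2 * a * b)) (λ x → f x * g x))))
                   (∑-*ˡ xs (b * b) (λ x → g x * g x)) ⟩
    a * a * ∑ xs (λ x → f x * f x) + - (+ 2 * a * b) * ∑ xs (λ x → f x * g x) + b * b * ∑ xs (λ x → g x * g x) ∎
    where
    open ≡-Reasoning
    expand : ∀ a b f g → (a * f - b * g) * (a * f - b * g) ≡ a * a * (f * f) + - (+ 2 * a * b) * (f * g) + b * b * (g * g)
    expand = solve-∀

  -- Lagrange's identity: the double sum of (f x g y − g x f y)² is twice the Gram determinant.
  cauchy-schwarz : ∀ (xs : List X) (f g : X → ℤ) →
    ∑ xs (λ x → f x * g x) * ∑ xs (λ x → f x * g x) ≤ ∑ xs (λ x → f x * f x) * ∑ xs (λ x → g x * g x)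
  cauchy-schwarz xs f g = ℤ.0≤i-j⇒j≤i (*-cancelˡ {0ℤ} {A * C - B * B} {+ 2} (+≤+ (s≤s z≤n)) (subst (0ℤ ≤_) lagrange
      (∑-nonneg xs (λ x → ∑-nonneg xs (λ y → 0≤a² (f x * g y - g x * f y))))))
    where
    open ≡-Reasoning
    A = ∑ xs (λ x → f x * f x)
    B = ∑ xs (λ x → f x * g x)
    C = ∑ xs (λ x → g x * g x)
    rearrange : ∀ f g A B C → f * f * C + - (+ 2 * f * g) * B + g * g * A ≡ f * f * C + (f * g * (- + 2 * B) + g * g * A)
    rearrange = solve-∀
    collect : ∀ A B C → A * C + (B * (- + 2 * B) + C * A) ≡ + 2 * (A * C - B * B)
    collect = solve-∀
    lagrange : ∑ xs (λ x → ∑ xs (λ y → (f x * g y - g x * f y) * (f x * g y - g x * f y))) ≡ + 2 * (A * C - B * B)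
    lagrange = begin
      ∑ xs (λ x → ∑ xs (λ y → (f x * g y - g x * f y) * (f x * g y - g x * f y)))
        ≡⟨ ∑-cong xs (λ x → ∑-square xs (f x) (g x) g f) ⟩
      ∑ xs (λ x → f x * f x * C + - (+ 2 * f x * g x) * ∑ xs (λ y → g y * f y) + g x * g x * A)
        ≡⟨ ∑-cong xs (λ x → trans (cong (λ b → f x * f x * C + - (+ 2 * f x * g x) * b + g x * g x * A) (∑-cong xs (λ y → ℤ.*-comm (g y) (f y))))
                                  (rearrange (f x) (g x) A B C)) ⟩
      ∑ xs (λ x → f x * f x * C + (f x * g x * (- + 2 * B) + g x * g x * A))
        ≡⟨ trans (∑-+ xs _ _) (cong₂ _+_ (∑-*ʳ xs _ C) (trans (∑-+ xs _ _) (cong₂ _+_ (∑-*ʳ xs _ _) (∑-*ʳ xs _ A)))) ⟩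
      A * C + (B * (- + 2 * B) + C * A)
        ≡⟨ collect A B C ⟩
      + 2 * (A * C - B * B) ∎

  ι : Dec P → ℤ
  ι (yes _) = 1ℤ
  ι (no  _) = 0ℤ

  ι-nonneg : (P? : Dec P) → 0ℤ ≤ ι P?
  ι-nonneg (yes _) = +≤+ z≤n
  ι-nonneg (no  _) = +≤+ z≤n

  ι≤1 : (P? : Dec P) → ι P? ≤ 1ℤ
  ι≤1 (yes _) = +≤+ (s≤s z≤n)
  ι≤1 (no  _) = +≤+ z≤n

  ι-idem : (P? : Dec P) → ι P? * ι P? ≡ ι P?
  ι-idem (yes _) = refl
  ι-idem (no  _) = refl

  ι-yes : (P? : Dec P) → P → ι P? ≡ 1ℤ
  ι-yes (yes _) _ = refl
  ι-yes (no ¬p) p = contradiction p ¬p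

  ι-no : (P? : Dec P) → ¬ P → ι P? ≡ 0ℤ
  ι-no (yes p) ¬p = contradiction p ¬p
  ι-no (no _)  _  = refl

  ι-mono : (P? : Dec P) (R? : Dec R) → (P → R) → ι P? ≤ ι R?
  ι-mono (yes p) R? P⇒R = ℤ.≤-reflexive (sym (ι-yes R? (P⇒R p)))
  ι-mono (no  _) R? P⇒R = ι-nonneg R?

  ι-cong : (P? : Dec P) (R? : Dec R) → (P → R) → (R → P) → ι P? ≡ ι R?
  ι-cong P? R? P⇒R R⇒P = ℤ.≤-antisym (ι-mono P? R? P⇒R) (ι-mono R? P? R⇒P)

  ι-× : (P? : Dec P) (R? : Dec R) → ι (P? ×-dec R?) ≡ ι P? * ι R?
  ι-× (yes _) (yes _) = refl
  ι-× (yes _) (no  _) = refl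
  ι-× (no  _) (yes _) = refl
  ι-× (no  _) (no  _) = refl

  -- A sum over a subset is written as a sum over everything with an indicator factor; this lemma
  -- and `ι*-mono` make membership available inside such a sum.
  ι*-cong : (P? : Dec P) {a b : ℤ} → (P → a ≡ b) → ι P? * a ≡ ι P? * b
  ι*-cong (yes p) a≡b = cong (1ℤ *_) (a≡b p)
  ι*-cong (no  _) a≡b = refl

  ι*-mono : (P? : Dec P) {a b : ℤ} → (P → a ≤ b) → ι P? * a ≤ ι P? * b
  ι*-mono (yes p) a≤b = *-monoˡ {c = 1ℤ} (+≤+ z≤n) (a≤b p)
  ι*-mono (no  _) a≤b = ℤ.≤-refl

  -- The negative outcome is phrased as a vanishing sum, so that `∑-unique` and `any?` can put it
  -- straight into an inequality between counts.
  ∑-witness : ∀ (xs : List X) {P : Pred X p} (P? : Decidable P) → ∃ P ⊎ ∑ xs (λ x → ι (P? x)) ≡ 0ℤ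
  ∑-witness []       P? = inj₂ refl
  ∑-witness (x ∷ xs) P? with P? x
  ... | yes Px = inj₁ (x , Px)
  ... | no  _  with ∑-witness xs P?
  ...   | inj₁ found = inj₁ found
  ...   | inj₂ none  = inj₂ (trans (ℤ.+-identityˡ _) none)

  -- Exhaustiveness and absence of repetition are one equation between sums. Evaluation at a point,
  -- change of variables and fibre counting then become rearrangements of sums, without list
  -- membership or permutations.
  record Finite (X : Set) : Set where
    infix 4 _≟_
    field
      _≟_      : DecidableEquality X
      elements : List X
      once     : ∀ y → ∑ elements (λ x → ι (x ≟ y)) ≡ 1ℤ

    ∑-delta : ∀ y (f : X → ℤ) → ∑ elements (λ x → ι (x ≟ y) * f x) ≡ f y
    ∑-delta y f = begin
      ∑ elements (λ x → ι (x ≟ y) * f x) ≡⟨ ∑-cong elements (λ x → ι*-cong (x ≟ y) (cong f)) ⟩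
      ∑ elements (λ x → ι (x ≟ y) * f y) ≡⟨ ∑-*ʳ elements _ (f y) ⟩
      ∑ elements (λ x → ι (x ≟ y)) * f y ≡⟨ cong (_* f y) (once y) ⟩
      1ℤ * f y                           ≡⟨ ℤ.*-identityˡ (f y) ⟩
      f y                                ∎
      where open ≡-Reasoning

    ∑-unique : {P : Pred X p} (P? : Decidable P) → (∀ {x y} → P x → P y → x ≡ y) → ∑ elements (λ x → ι (P? x)) ≤ 1ℤ
    ∑-unique P? unique with ∑-witness elements P?
    ... | inj₁ (y , Py) = subst (_ ≤_) (once y) (∑-mono elements (λ x → ι-mono (P? x) (x ≟ y) (λ Px → unique Px Py)))
    ... | inj₂ none     = subst (_≤ 1ℤ) (sym none) (+≤+ z≤n)

    any? : {P : Pred X p} → Decidable P → Dec (∃ P)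
    any? P? with ∑-witness elements P?
    ... | inj₁ found = yes found
    ... | inj₂ none  = no λ (y , Py) → ¬1≤0 (subst₂ _≤_ (once y) none (∑-mono elements (λ x → ι-mono (x ≟ y) (P? x) (λ { refl → Py }))))
      where
      ¬1≤0 : ¬ 1ℤ ≤ 0ℤ
      ¬1≤0 (+≤+ ())

  open Finite

  module _ (FX : Finite X) (FY : Finite Y) where

    private
      xs = elements FX
      ys = elements FY
      _≟X_ = _≟_ FX
      _≟Y_ = _≟_ FY

    -- Both sides count the graph of `σ` with weight f y: fibre by fibre over X it is y ≡ σ x, over
    -- Y it is x ≡ τ y.
    ∑-reindex : ∀ (σ : X → Y) (τ : Y → X) → (∀ x → τ (σ x) ≡ x) → (∀ y → σ (τ y) ≡ y) →
      ∀ (f : Y → ℤ) → ∑ xs (λ x → f (σ x)) ≡ ∑ ys f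
    ∑-reindex σ τ τσ στ f = begin
      ∑ xs (λ x → f (σ x))                                ≡⟨ ∑-cong xs (λ x → sym (∑-delta FY (σ x) f)) ⟩
      ∑ xs (λ x → ∑ ys (λ y → ι (y ≟Y σ x) * f y))        ≡⟨ ∑-swap xs ys _ ⟩
      ∑ ys (λ y → ∑ xs (λ x → ι (y ≟Y σ x) * f y))        ≡⟨ ∑-cong ys (λ y → ∑-cong xs (λ x → cong (_* f y)
                                                               (ι-cong (y ≟Y σ x) (x ≟X τ y)
                                                                 (λ y≡σx → trans (sym (τσ x)) (cong τ (sym y≡σx)))
                                                                 (λ x≡τy → trans (sym (στ y)) (cong σ (sym x≡τy)))))) ⟩
      ∑ ys (λ y → ∑ xs (λ x → ι (x ≟X τ y) * f y))        ≡⟨ ∑-cong ys (λ y → ∑-delta FX (τ y) (λ _ → f y)) ⟩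
      ∑ ys f                                              ∎
      where open ≡-Reasoning

    -- The points of `P` are distributed over the fibres of `g`. A fibre over a point of `R` holds
    -- at most one of them, any other fibre none.
    ∑-injective : {P : Pred X p} (P? : Decidable P) {R : Pred Y r} (R? : Decidable R) (g : X → Y) →
      (∀ {x} → P x → R (g x)) → (∀ {x y} → P x → P y → g x ≡ g y → x ≡ y) →
      ∑ xs (λ x → ι (P? x)) ≤ ∑ ys (λ y → ι (R? y))
    ∑-injective P? R? g P⇒R injective = begin
      ∑ xs (λ x → ι (P? x))                                  ≡⟨ ∑-cong xs (λ x → sym (∑-delta FY (g x) (λ _ → ι (P? x)))) ⟩
      ∑ xs (λ x → ∑ ys (λ y → ι (y ≟Y g x) * ι (P? x)))      ≡⟨ ∑-swap xs ys _ ⟩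
      ∑ ys (λ y → ∑ xs (λ x → ι (y ≟Y g x) * ι (P? x)))      ≡⟨ ∑-cong ys (λ y → ∑-cong xs (λ x → sym (ι-× (y ≟Y g x) (P? x)))) ⟩
      ∑ ys (λ y → ∑ xs (λ x → ι (fibre? y x)))               ≤⟨ ∑-mono ys fibre-bound ⟩
      ∑ ys (λ y → ι (R? y))                                  ∎
      where
      open ℤ.≤-Reasoning
      fibre? = λ y x → (y ≟Y g x) ×-dec P? x
      fibre-bound : ∀ y → ∑ xs (λ x → ι (fibre? y x)) ≤ ι (R? y)
      fibre-bound y with R? y
      ... | yes _  = ∑-unique FX (fibre? y) (λ (y≡gx , Px) (y≡gx′ , Px′) → injective Px Px′ (trans (sym y≡gx) y≡gx′))
      ... | no ¬Ry = ℤ.≤-reflexive (trans (∑-cong xs (λ x → ι-no (fibre? y x) (λ { (refl , Px) → ¬Ry (P⇒R Px) }))) (∑-zero xs))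

open FiniteSums

-- Solving ring identities that involve subtraction

-- A pair (m , n) stands for the coefficient m − n.
module DifferenceSolver {c ℓ} (R : CommutativeRing c ℓ) where
  open CommutativeRing R
  open RingProperties ring
  open AbelianGroupProperties +-abelianGroup using (⁻¹-∙-comm)
  open SemiringMult semiring renaming (_×_ to _·_)
  open import Relation.Binary.Reasoning.Setoid setoid

  coefficients : RawRing _ _
  coefficients = record
    { Carrier = ℕ × ℕ
    ; _≈_     = _≡_
    ; _+_     = λ (a , b) (m , n) → a ℕ.+ m , b ℕ.+ n
    ; _*_     = λ (a , b) (m , n) → a ℕ.* m ℕ.+ b ℕ.* n , a ℕ.* n ℕ.+ b ℕ.* m
    ; -_      = λ (a , b) → b , a
    ; 0#      = 0 , 0
    ; 1#      = 1 , 0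
    }

  value : ℕ × ℕ → Carrier
  value (m , n) = m · 1# - n · 1#

  private
    module N = Algebra.Solver.Ring.NaturalCoefficients commutativeSemiring (λ _ _ → nothing)

    negate : ∀ x y → - (x - y) ≈ y - x
    negate x y = begin
      - (x - y)    ≈⟨ ⁻¹-∙-comm x (- y) ⟨
      - x - - y    ≈⟨ +-congˡ (-‿involutive y) ⟩
      - x + y      ≈⟨ +-comm _ _ ⟩
      y - x        ∎

    cancel : ∀ x y z → (x + z) - (y + z) ≈ x - y
    cancel x y z = begin
      (x + z) - (y + z)     ≈⟨ +-congˡ (⁻¹-∙-comm y z) ⟨
      -- With - y and - z taken as independent variables, this is an identity of commutative
      -- semirings.
      (x + z) + (- y - z)   ≈⟨ N.solve 4 (λ x z y′ z′ → (x N.:+ z) N.:+ (y′ N.:+ z′) N.:= (x N.:+ y′) N.:+ (z N.:+ z′)) refl x z (- y) (- z) ⟩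
      (x - y) + (z - z)     ≈⟨ +-congˡ (-‿inverseʳ z) ⟩
      (x - y) + 0#          ≈⟨ +-identityʳ _ ⟩
      x - y                 ∎

    +-homo : ∀ p q → value (RawRing._+_ coefficients p q) ≈ value (p) + value (q)
    +-homo (a , b) (m , n) = begin
      (a ℕ.+ m) · 1# - (b ℕ.+ n) · 1#
        ≈⟨ +-cong (×-homo-+ 1# a m) (trans (-‿cong (×-homo-+ 1# b n)) (sym (⁻¹-∙-comm _ _))) ⟩
      (a · 1# + m · 1#) + (- (b · 1#) - n · 1#)
        ≈⟨ N.solve 4 (λ x y z w → (x N.:+ y) N.:+ (z N.:+ w) N.:= (x N.:+ z) N.:+ (y N.:+ w)) refl (a · 1#) (m · 1#) (- (b · 1#)) (- (n · 1#)) ⟩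
      (a · 1# - b · 1#) + (m · 1# - n · 1#) ∎

    *-homo : ∀ p q → value (RawRing._*_ coefficients p q) ≈ value (p) * value (q)
    *-homo (a , b) (m , n) = sym (begin
      (A - B) * (M - N)
        ≈⟨ N.solve 4 (λ a b′ m n′ → (a N.:+ b′) N.:* (m N.:+ n′) N.:= (a N.:* m N.:+ b′ N.:* n′) N.:+ (a N.:* n′ N.:+ b′ N.:* m)) refl A (- B) M (- N) ⟩
      (A * M + - B * - N) + (A * - N + - B * M)
        ≈⟨ +-cong (+-congˡ (trans (sym (-‿distribˡ-* B (- N))) (trans (-‿cong (sym (-‿distribʳ-* B N))) (-‿involutive _))))
                  (trans (+-cong (sym (-‿distribʳ-* A N)) (sym (-‿distribˡ-* B M))) (⁻¹-∙-comm _ _)) ⟩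
      (A * M + B * N) - (A * N + B * M)
        ≈⟨ +-cong (+-cong (×1-homo-* a m) (×1-homo-* b n)) (-‿cong (+-cong (×1-homo-* a n) (×1-homo-* b m))) ⟨
      ((a ℕ.* m) · 1# + (b ℕ.* n) · 1#) - ((a ℕ.* n) · 1# + (b ℕ.* m) · 1#)
        ≈⟨ +-cong (×-homo-+ 1# (a ℕ.* m) (b ℕ.* n)) (-‿cong (×-homo-+ 1# (a ℕ.* n) (b ℕ.* m))) ⟨
      (a ℕ.* m ℕ.+ b ℕ.* n) · 1# - (a ℕ.* n ℕ.+ b ℕ.* m) · 1# ∎)
      where
      A = a · 1#
      B = b · 1#
      M = m · 1#
      N = n · 1#

    homomorphism : coefficients -Raw-AlmostCommutative⟶ fromCommutativeRing R
    homomorphism = record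
      { ⟦_⟧    = value
      ; +-homo = +-homo
      ; *-homo = *-homo
      ; -‿homo = λ (a , b) → sym (negate (a · 1#) (b · 1#))
      ; 0-homo = -‿inverseʳ 0#
      ; 1-homo = trans (+-cong (+-identityʳ 1#) -0#≈0#) (+-identityʳ 1#)
      }

    -- The test a + n = m + b is sound in every commutative ring. In positive characteristic it may
    -- answer `nothing` for coefficients of equal value, which costs only completeness.
    _coeff≟_ : ∀ p q → Maybe (value (p) ≈ value (q))
    (a , b) coeff≟ (m , n) with a ℕ.+ n ℕ.≟ m ℕ.+ b
    ... | no  _  = nothing
    ... | yes eq = just (begin
      a · 1# - b · 1#                                   ≈⟨ cancel (a · 1#) (b · 1#) (n · 1#) ⟨
      (a · 1# + n · 1#) - (b · 1# + n · 1#)             ≈⟨ +-cong (×-homo-+ 1# a n) (-‿cong (+-comm _ _)) ⟨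
      (a ℕ.+ n) · 1# - (n · 1# + b · 1#)                ≈⟨ +-congʳ (reflexive (≡.cong (_· 1#) eq)) ⟩
      (m ℕ.+ b) · 1# - (n · 1# + b · 1#)                ≈⟨ +-congʳ (×-homo-+ 1# m b) ⟩
      (m · 1# + b · 1#) - (n · 1# + b · 1#)             ≈⟨ cancel (m · 1#) (n · 1#) (b · 1#) ⟩
      m · 1# - n · 1#                                   ∎)

  open Algebra.Solver.Ring coefficients (fromCommutativeRing R) homomorphism _coeff≟_ public

-- Dot and cross products over a finite field

module FiniteVectorSpaces where
  open ≡ using (refl; sym; trans; cong; cong₂; module ≡-Reasoning)

  record Triple (A : Set) : Set where
    constructor ⟨_,_,_⟩
    field
      x₁ x₂ x₃ : A

  open Triple

  triple-≡ : {A : Set} {u v : Triple A} → x₁ u ≡ x₁ v → x₂ u ≡ x₂ v → x₃ u ≡ x₃ v → u ≡ v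
  triple-≡ refl refl refl = refl

  -- Only raw operations are assumed, so that the same formulas serve for field elements and for the
  -- polynomials given to the solver.
  module Formulas {A : Set} (_+_ _*_ : A → A → A) (-_ : A → A) where
    infixl 9 _∙_ _⨯_ _⊙_
    infixl 6 _⊕_

    _∙_ : Triple A → Triple A → A
    u ∙ v = ((x₁ u * x₁ v) + (x₂ u * x₂ v)) + (x₃ u * x₃ v)

    _⨯_ : Triple A → Triple A → Triple A
    u ⨯ v = ⟨ (x₂ u * x₃ v) + (- (x₃ u * x₂ v))
            , (x₃ u * x₁ v) + (- (x₁ u * x₃ v))
            , (x₁ u * x₂ v) + (- (x₂ u * x₁ v)) ⟩

    _⊙_ : A → Triple A → Triple A
    c ⊙ v = ⟨ c * x₁ v , c * x₂ v , c * x₃ v ⟩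

    _⊕_ : Triple A → Triple A → Triple A
    u ⊕ v = ⟨ x₁ u + x₁ v , x₂ u + x₂ v , x₃ u + x₃ v ⟩

    ⊝_ : Triple A → Triple A
    ⊝ v = ⟨ - x₁ v , - x₂ v , - x₃ v ⟩

  -- Equality is propositional: a setoid field is transported to one carried by Fin q.
  record DiscreteFiniteField : Set₁ where
    infixl 7 _*_
    infixl 6 _+_
    infix  8 -_
    field
      Carrier           : Set
      _+_ _*_           : Carrier → Carrier → Carrier
      -_                : Carrier → Carrier
      0# 1#             : Carrier
      isCommutativeRing : IsCommutativeRing _≡_ _+_ _*_ -_ 0# 1#
      1≢0               : 1# ≢ 0#
      recip             : ∀ x → x ≢ 0# → ∃ λ y → x * y ≡ 1#
      q                 : ℤ
      finite            : Finite Carrier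
      finite³           : Finite (Triple Carrier)
      order             : ∑ (Finite.elements finite) (λ _ → 1ℤ) ≡ q
      order³            : ∑ (Finite.elements finite³) (λ _ → 1ℤ) ≡ q ℤ.* (q ℤ.* q)

  module VectorAlgebra (K : DiscreteFiniteField) where
    open DiscreteFiniteField K
    open IsCommutativeRing isCommutativeRing
      using (+-identityˡ; +-identityʳ; *-identityˡ; *-comm; *-assoc; zeroˡ; zeroʳ; -‿inverseʳ; +-assoc; -‿inverseˡ)
    open Formulas _+_ _*_ -_ public
    open Finite finite using () renaming (_≟_ to _≟A_; elements to scalars) public
    open Finite finite³ using () renaming (_≟_ to _≟V_; elements to vectors) public

    A = Carrier
    V = Triple A

    commutativeRing : CommutativeRing 0ℓ 0ℓ
    commutativeRing = record { isCommutativeRing = isCommutativeRing }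

    open DifferenceSolver commutativeRing using (Polynomial; solve; _:=_; _:+_; _:*_; :-_)

    private module P {n} = Formulas {Polynomial n} _:+_ _:*_ :-_

    𝟎 : V
    𝟎 = ⟨ 0# , 0# , 0# ⟩

    ∙-comm : ∀ u v → u ∙ v ≡ v ∙ u
    ∙-comm ⟨ a , b , c ⟩ ⟨ x , y , z ⟩ =
      solve 6 (λ a b c x y z → ⟨ a , b , c ⟩ P.∙ ⟨ x , y , z ⟩ := ⟨ x , y , z ⟩ P.∙ ⟨ a , b , c ⟩) refl a b c x y z

    ∙-zeroʳ : ∀ u → u ∙ 𝟎 ≡ 0#
    ∙-zeroʳ ⟨ a , b , c ⟩ = trans (cong₂ _+_ (cong₂ _+_ (zeroʳ a) (zeroʳ b)) (zeroʳ c)) (trans (+-identityʳ _) (+-identityʳ _))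

    ⨯-zeroʳ : ∀ u → u ⨯ 𝟎 ≡ 𝟎
    ⨯-zeroʳ ⟨ a , b , c ⟩ = triple-≡ (lemma b c) (lemma c a) (lemma a b)
      where
      lemma : ∀ a b → a * 0# + - (b * 0#) ≡ 0#
      lemma a b = trans (cong₂ (λ x y → x + - y) (zeroʳ a) (zeroʳ b)) (-‿inverseʳ 0#)

    ⊙-zeroˡ : ∀ v → 0# ⊙ v ≡ 𝟎
    ⊙-zeroˡ v = triple-≡ (zeroˡ _) (zeroˡ _) (zeroˡ _)

    ⊙-zeroʳ : ∀ c → c ⊙ 𝟎 ≡ 𝟎
    ⊙-zeroʳ c = triple-≡ (zeroʳ _) (zeroʳ _) (zeroʳ _)

    ⊙-identity : ∀ v → 1# ⊙ v ≡ v
    ⊙-identity v = triple-≡ (*-identityˡ _) (*-identityˡ _) (*-identityˡ _)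

    ⊙-assoc : ∀ a b v → (a * b) ⊙ v ≡ a ⊙ (b ⊙ v)
    ⊙-assoc a b v = triple-≡ (*-assoc a b _) (*-assoc a b _) (*-assoc a b _)

    ⊕-identityˡ : ∀ v → 𝟎 ⊕ v ≡ v
    ⊕-identityˡ v = triple-≡ (+-identityˡ _) (+-identityˡ _) (+-identityˡ _)

    ⊕-identityʳ : ∀ v → v ⊕ 𝟎 ≡ v
    ⊕-identityʳ v = triple-≡ (+-identityʳ _) (+-identityʳ _) (+-identityʳ _)

    ∙-⊙ : ∀ c u v → (c ⊙ u) ∙ v ≡ c * (u ∙ v)
    ∙-⊙ s ⟨ a , b , c ⟩ ⟨ x , y , z ⟩ =
      solve 7 (λ s a b c x y z → (s P.⊙ ⟨ a , b , c ⟩) P.∙ ⟨ x , y , z ⟩ := s :* (⟨ a , b , c ⟩ P.∙ ⟨ x , y , z ⟩)) refl s a b c x y z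

    ∙-⊕ : ∀ u v w → (u ⊕ v) ∙ w ≡ u ∙ w + v ∙ w
    ∙-⊕ ⟨ a , b , c ⟩ ⟨ x , y , z ⟩ ⟨ p , q , r ⟩ =
      solve 9 (λ a b c x y z p q r → (⟨ a , b , c ⟩ P.⊕ ⟨ x , y , z ⟩) P.∙ ⟨ p , q , r ⟩ :=
        ⟨ a , b , c ⟩ P.∙ ⟨ p , q , r ⟩ :+ ⟨ x , y , z ⟩ P.∙ ⟨ p , q , r ⟩) refl a b c x y z p q r

    ⊙-⨯ : ∀ c u v → (c ⊙ u) ⨯ v ≡ c ⊙ (u ⨯ v)
    ⊙-⨯ s ⟨ a , b , c ⟩ ⟨ x , y , z ⟩ = triple-≡ (lemma b z c y) (lemma c x a z) (lemma a y b x)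
      where
      lemma : ∀ a z b y → s * a * z + - (s * b * y) ≡ s * (a * z + - (b * y))
      lemma a z b y = solve 5 (λ s a z b y → s :* a :* z :+ :- (s :* b :* y) := s :* (a :* z :+ :- (b :* y))) refl s a z b y

    ⊕-⨯ : ∀ u v w → (u ⊕ v) ⨯ w ≡ (u ⨯ w) ⊕ (v ⨯ w)
    ⊕-⨯ ⟨ a , b , c ⟩ ⟨ x , y , z ⟩ ⟨ p , q , r ⟩ = triple-≡ (lemma b y r c z q) (lemma c z p a x r) (lemma a x q b y p)
      where
      lemma : ∀ a x r b y q → (a + x) * r + - ((b + y) * q) ≡ (a * r + - (b * q)) + (x * r + - (y * q))
      lemma = solve 6 (λ a x r b y q → (a :+ x) :* r :+ :- ((b :+ y) :* q) := (a :* r :+ :- (b :* q)) :+ (x :* r :+ :- (y :* q))) refl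

    ⨯-self : ∀ v → v ⨯ v ≡ 𝟎
    ⨯-self ⟨ a , b , c ⟩ = triple-≡ (lemma b c) (lemma c a) (lemma a b)
      where
      lemma : ∀ a b → a * b + - (b * a) ≡ 0#
      lemma a b = trans (cong (λ x → a * b + - x) (*-comm b a)) (-‿inverseʳ _)

    ⨯-anticomm : ∀ u v → u ⨯ v ≡ ⊝ (v ⨯ u)
    ⨯-anticomm ⟨ a , b , c ⟩ ⟨ x , y , z ⟩ = triple-≡ (lemma b z c y) (lemma c x a z) (lemma a y b x)
      where
      lemma : ∀ a z b y → a * z + - (b * y) ≡ - (y * b + - (z * a))
      lemma = solve 4 (λ a z b y → a :* z :+ :- (b :* y) := :- (y :* b :+ :- (z :* a))) refl

    ∙-cyclic : ∀ u v w → u ∙ (v ⨯ w) ≡ v ∙ (w ⨯ u)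
    ∙-cyclic ⟨ a , b , c ⟩ ⟨ x , y , z ⟩ ⟨ p , q , r ⟩ =
      solve 9 (λ a b c x y z p q r → ⟨ a , b , c ⟩ P.∙ (⟨ x , y , z ⟩ P.⨯ ⟨ p , q , r ⟩) :=
        ⟨ x , y , z ⟩ P.∙ (⟨ p , q , r ⟩ P.⨯ ⟨ a , b , c ⟩)) refl a b c x y z p q r

    -- The first coordinate is a polynomial identity in nine variables. The other two are its cyclic
    -- shifts, after which `rotate` restores the order of the terms in the dot products.
    bac-cab : ∀ u v w → u ⨯ (v ⨯ w) ≡ ((u ∙ w) ⊙ v) ⊕ (⊝ ((u ∙ v) ⊙ w))
    bac-cab ⟨ a , b , c ⟩ ⟨ x , y , z ⟩ ⟨ p , q , r ⟩ = triple-≡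
      (lemma a b c x y z p q r)
      (trans (lemma b c a y z x q r p) (rotate y q (b * q) (c * r) (a * p) (b * y) (c * z) (a * x)))
      (trans (lemma c a b z x y r p q) (sym (rotate z r (a * p) (b * q) (c * r) (a * x) (b * y) (c * z))))
      where
      lemma : ∀ a b c x y z p q r → b * (x * q + - (y * p)) + - (c * (z * p + - (x * r))) ≡
        (a * p + b * q + c * r) * x + - ((a * x + b * y + c * z) * p)
      lemma = solve 9 (λ a b c x y z p q r → b :* (x :* q :+ :- (y :* p)) :+ :- (c :* (z :* p :+ :- (x :* r))) :=
        (a :* p :+ b :* q :+ c :* r) :* x :+ :- ((a :* x :+ b :* y :+ c :* z) :* p)) refl
      rotate : ∀ y q k l m k′ l′ m′ → (k + l + m) * y + - ((k′ + l′ + m′) * q) ≡ (m + k + l) * y + - ((m′ + k′ + l′) * q)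
      rotate = solve 8 (λ y q k l m k′ l′ m′ → (k :+ l :+ m) :* y :+ :- ((k′ :+ l′ :+ m′) :* q) :=
        (m :+ k :+ l) :* y :+ :- ((m′ :+ k′ :+ l′) :* q)) refl

    ⊝𝟎 : ⊝ 𝟎 ≡ 𝟎
    ⊝𝟎 = triple-≡ lemma lemma lemma
      where
      lemma : - 0# ≡ 0#
      lemma = trans (sym (+-identityˡ _)) (-‿inverseʳ 0#)

    ⊕-⊝-cancel : ∀ u v → (u ⊕ (⊝ v)) ⊕ v ≡ u
    ⊕-⊝-cancel ⟨ a , b , c ⟩ ⟨ x , y , z ⟩ = triple-≡ (lemma a x) (lemma b y) (lemma c z)
      where
      lemma : ∀ a x → a + - x + x ≡ a
      lemma a x = trans (+-assoc a _ _) (trans (cong (_+_ a) (-‿inverseˡ x)) (+-identityʳ a))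

    ⊝-zero : ∀ u v → u ⊕ (⊝ v) ≡ 𝟎 → u ≡ v
    ⊝-zero u v eq = trans (sym (⊕-⊝-cancel u v)) (trans (cong (_⊕ v) eq) (⊕-identityˡ v))

    -- Rescale the coordinate functional of a nonzero coordinate. Such a u stands in for dividing by
    -- v: y ↦ u · y reads off the coefficient of v, and its kernel is a complement of the line
    -- through v.
    dual : ∀ v → v ≢ 𝟎 → ∃ λ u → u ∙ v ≡ 1#
    dual ⟨ a , b , c ⟩ v≢𝟎 with a ≟A 0# | b ≟A 0# | c ≟A 0#
    ... | no a≢0 | _ | _ = ⟨ proj₁ (recip a a≢0) , 0# , 0# ⟩ ,
      trans (cong₂ _+_ (cong₂ _+_ (trans (*-comm _ a) (proj₂ (recip a a≢0))) (zeroˡ b)) (zeroˡ c)) (trans (+-identityʳ _) (+-identityʳ _))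
    ... | yes _ | no b≢0 | _ = ⟨ 0# , proj₁ (recip b b≢0) , 0# ⟩ ,
      trans (cong₂ _+_ (cong₂ _+_ (zeroˡ a) (trans (*-comm _ b) (proj₂ (recip b b≢0)))) (zeroˡ c)) (trans (+-identityʳ _) (+-identityˡ _))
    ... | yes _ | yes _ | no c≢0 = ⟨ 0# , 0# , proj₁ (recip c c≢0) ⟩ ,
      trans (cong₂ _+_ (cong₂ _+_ (zeroˡ a) (zeroˡ b)) (trans (*-comm _ c) (proj₂ (recip c c≢0)))) (trans (cong (_+ _) (+-identityʳ _)) (+-identityˡ _))
    ... | yes refl | yes refl | yes refl = contradiction refl v≢𝟎

    -- By `bac-cab`, u × (y × z) = (u · z) y - (u · y) z. Hence y is recovered from y × z together
    -- with the single scalar u · y, which underlies all the counts of solutions below.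
    reconstruct : ∀ {u z} → u ∙ z ≡ 1# → ∀ y → y ≡ (u ⨯ (y ⨯ z)) ⊕ ((u ∙ y) ⊙ z)
    reconstruct {u} {z} u∙z≡1 y = sym (begin
      (u ⨯ (y ⨯ z)) ⊕ ((u ∙ y) ⊙ z)                                     ≡⟨ cong (_⊕ ((u ∙ y) ⊙ z)) (bac-cab u y z) ⟩
      (((u ∙ z) ⊙ y) ⊕ (⊝ ((u ∙ y) ⊙ z))) ⊕ ((u ∙ y) ⊙ z)               ≡⟨ ⊕-⊝-cancel _ _ ⟩
      (u ∙ z) ⊙ y                                                       ≡⟨ cong (_⊙ y) u∙z≡1 ⟩
      1# ⊙ y                                                            ≡⟨ ⊙-identity y ⟩
      y                                                                 ∎)
      where open ≡-Reasoning

    parallel : ∀ {u z} → u ∙ z ≡ 1# → ∀ {y} → y ⨯ z ≡ 𝟎 → y ≡ (u ∙ y) ⊙ z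
    parallel {u} {z} u∙z≡1 {y} y⨯z≡𝟎 = trans (reconstruct u∙z≡1 y)
      (trans (cong (_⊕ ((u ∙ y) ⊙ z)) (trans (cong (u ⨯_) y⨯z≡𝟎) (⨯-zeroʳ u))) (⊕-identityˡ _))

    ⨯-determined : ∀ {u z} → u ∙ z ≡ 1# → ∀ {y y′} → y ⨯ z ≡ y′ ⨯ z → u ∙ y ≡ u ∙ y′ → y ≡ y′
    ⨯-determined {u} {z} u∙z≡1 {y} {y′} eq eq′ =
      trans (reconstruct u∙z≡1 y) (trans (cong₂ (λ c s → (u ⨯ c) ⊕ (s ⊙ z)) eq eq′) (sym (reconstruct u∙z≡1 y′)))

    ∙-⨯ˡ : ∀ y z → y ∙ (y ⨯ z) ≡ 0#
    ∙-⨯ˡ y z = trans (∙-cyclic y y z) (trans (∙-cyclic y z y) (trans (cong (z ∙_) (⨯-self y)) (∙-zeroʳ z)))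

    ∙-⨯ʳ : ∀ y z → z ∙ (y ⨯ z) ≡ 0#
    ∙-⨯ʳ y z = trans (∙-cyclic z y z) (trans (cong (y ∙_) (⨯-self z)) (∙-zeroʳ y))

    integral : ∀ {a b} → a ≢ 0# → a * b ≡ 0# → b ≡ 0#
    integral {a} {b} a≢0 ab≡0 with recip a a≢0
    ... | a⁻¹ , a*a⁻¹≡1 = begin
      b              ≡⟨ *-identityˡ b ⟨
      1# * b         ≡⟨ cong (_* b) (trans (*-comm a⁻¹ a) a*a⁻¹≡1) ⟨
      a⁻¹ * a * b    ≡⟨ *-assoc a⁻¹ a b ⟩
      a⁻¹ * (a * b)  ≡⟨ cong (a⁻¹ *_) ab≡0 ⟩
      a⁻¹ * 0#       ≡⟨ zeroʳ a⁻¹ ⟩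
      0#             ∎
      where open ≡-Reasoning

    ⊙-cancel : ∀ {a u v} → a ≢ 0# → a ⊙ u ≡ a ⊙ v → u ≡ v
    ⊙-cancel {a} {u} {v} a≢0 eq with recip a a≢0
    ... | a⁻¹ , a*a⁻¹≡1 = begin
      u                ≡⟨ ⊙-identity u ⟨
      1# ⊙ u           ≡⟨ cong (_⊙ u) (trans (*-comm a⁻¹ a) a*a⁻¹≡1) ⟨
      (a⁻¹ * a) ⊙ u    ≡⟨ ⊙-assoc a⁻¹ a u ⟩
      a⁻¹ ⊙ (a ⊙ u)    ≡⟨ cong (a⁻¹ ⊙_) eq ⟩
      a⁻¹ ⊙ (a ⊙ v)    ≡⟨ ⊙-assoc a⁻¹ a v ⟨
      (a⁻¹ * a) ⊙ v    ≡⟨ cong (_⊙ v) (trans (*-comm a⁻¹ a) a*a⁻¹≡1) ⟩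
      1# ⊙ v           ≡⟨ ⊙-identity v ⟩
      v                ∎
      where open ≡-Reasoning

  -- Counting solutions of linear and cross product equations

  module SolutionCounts (K : DiscreteFiniteField) where
    open DiscreteFiniteField K
    open IsCommutativeRing isCommutativeRing
      using (+-identityˡ; +-identityʳ; *-identityˡ; *-identityʳ; *-comm; *-assoc; zeroˡ; zeroʳ; -‿inverseʳ; +-assoc; +-comm; -‿inverseˡ; distribˡ; distribʳ)
    open VectorAlgebra K

    2≤q : + 2 ℤ.≤ q
    2≤q = begin
      + 2                                                         ≡⟨ cong₂ ℤ._+_ (Finite.once finite 0#) (Finite.once finite 1#) ⟨
      ∑ scalars (λ x → ι (x ≟A 0#)) ℤ.+ ∑ scalars (λ x → ι (x ≟A 1#)) ≡⟨ ∑-+ scalars _ _ ⟨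
      ∑ scalars (λ x → ι (x ≟A 0#) ℤ.+ ι (x ≟A 1#))               ≤⟨ ∑-mono scalars disjoint ⟩
      ∑ scalars (λ _ → 1ℤ)                                        ≡⟨ order ⟩
      q                                                           ∎
      where
      open ℤ.≤-Reasoning
      disjoint : ∀ x → ι (x ≟A 0#) ℤ.+ ι (x ≟A 1#) ℤ.≤ 1ℤ
      disjoint x with x ≟A 0# | x ≟A 1#
      ... | yes x≡0 | yes x≡1 = contradiction (trans (sym x≡1) x≡0) 1≢0
      ... | yes _   | no  _   = +≤+ (s≤s z≤n)
      ... | no  _   | yes _   = +≤+ (s≤s z≤n)
      ... | no  _   | no  _   = +≤+ z≤n

    1≤q : 1ℤ ℤ.≤ q
    1≤q = ℤ.≤-trans (+≤+ (s≤s z≤n)) 2≤q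

    0≤q : 0ℤ ℤ.≤ q
    0≤q = ℤ.≤-trans (+≤+ z≤n) 2≤q

    q-cancelˡ : ∀ {a b} → q ℤ.* a ≡ q ℤ.* b → a ≡ b
    q-cancelˡ eq = ℤ.≤-antisym (*-cancelˡ 1≤q (ℤ.≤-reflexive eq)) (*-cancelˡ 1≤q (ℤ.≤-reflexive (sym eq)))

    -- Translation by (s - t) u, with u dual to x, carries the level set of t onto that of s. So the
    -- q level sets have equal size, and together they exhaust q³ vectors.
    plane-count : ∀ {x} → x ≢ 𝟎 → ∀ t → ∑ vectors (λ w → ι (w ∙ x ≟A t)) ≡ q ℤ.* q
    plane-count {x} x≢𝟎 t = q-cancelˡ (begin
      q ℤ.* count t                                           ≡⟨ ℤ.*-comm q (count t) ⟩
      count t ℤ.* q                                           ≡⟨ cong (count t ℤ.*_) order ⟨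
      count t ℤ.* ∑ scalars (λ _ → 1ℤ)                        ≡⟨ ∑-const scalars (count t) ⟨
      ∑ scalars (λ _ → count t)                               ≡⟨ ∑-cong scalars (shift t) ⟩
      ∑ scalars (λ s → ∑ vectors (λ w → ι (w ∙ x ≟A s)))      ≡⟨ ∑-swap scalars vectors _ ⟩
      ∑ vectors (λ w → ∑ scalars (λ s → ι (w ∙ x ≟A s)))      ≡⟨ ∑-cong vectors (λ w → trans (∑-cong scalars (λ s → ι-cong (w ∙ x ≟A s) (s ≟A w ∙ x) sym sym)) (Finite.once finite (w ∙ x))) ⟩
      ∑ vectors (λ w → 1ℤ)                                    ≡⟨ order³ ⟩
      q ℤ.* (q ℤ.* q)                                         ∎)
      where
      open ≡-Reasoning
      u = proj₁ (dual x x≢𝟎)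
      count : A → ℤ
      count s = ∑ vectors (λ w → ι (w ∙ x ≟A s))
      translate : A → V → V
      translate d w = w ⊕ d ⊙ u
      translate-∙ : ∀ d w → translate d w ∙ x ≡ w ∙ x + d
      translate-∙ d w = trans (∙-⊕ w (d ⊙ u) x) (cong (_+_ (w ∙ x))
        (trans (∙-⊙ d u x) (trans (cong (d *_) (proj₂ (dual x x≢𝟎))) (*-identityʳ d))))
      add-cancel : ∀ a {d d′} → d + d′ ≡ 0# → a + d + d′ ≡ a
      add-cancel a eq = trans (+-assoc a _ _) (trans (cong (_+_ a) eq) (+-identityʳ a))
      translate-inverse : ∀ {d d′} → d + d′ ≡ 0# → ∀ w → translate d′ (translate d w) ≡ w
      translate-inverse {d} {d′} eq w = triple-≡ (lemma _ _) (lemma _ _) (lemma _ _)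
        where
        lemma : ∀ a b → a + d * b + d′ * b ≡ a
        lemma a b = add-cancel a (trans (sym (distribʳ b d d′)) (trans (cong (_* b) eq) (zeroˡ b)))
      shift : ∀ t s → count t ≡ count s
      shift t s = begin
        ∑ vectors (λ w → ι (w ∙ x ≟A t))
          ≡⟨ ∑-cong vectors (λ w → ι-cong (w ∙ x ≟A t) (translate (s + - t) w ∙ x ≟A s)
               (λ w∙x≡t → trans (translate-∙ _ w) (trans (cong (_+ (s + - t)) w∙x≡t) (trans (+-comm t _) (add-cancel s (-‿inverseˡ t)))))
               (λ eq → trans (sym (add-cancel (w ∙ x) (trans (sym (+-assoc _ _ _)) (trans (cong (_+ - s) (add-cancel s (-‿inverseˡ t))) (-‿inverseʳ s)))))
                        (trans (cong (_+ (t + - s)) (trans (sym (translate-∙ _ w)) eq)) (trans (+-comm s _) (add-cancel t (-‿inverseˡ s)))))) ⟩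
        ∑ vectors (λ w → ι (translate (s + - t) w ∙ x ≟A s))
          ≡⟨ ∑-reindex finite³ finite³ (translate (s + - t)) (translate (t + - s))
               (translate-inverse (opposite s t)) (translate-inverse (opposite t s)) (λ w → ι (w ∙ x ≟A s)) ⟩
        ∑ vectors (λ w → ι (w ∙ x ≟A s)) ∎
        where
        opposite : ∀ s t → (s + - t) + (t + - s) ≡ 0#
        opposite s t = trans (sym (+-assoc _ _ _)) (trans (cong (_+ - s) (add-cancel s (-‿inverseˡ t))) (-‿inverseʳ s))

    -- By `bac-cab` the two products fix w × (x × x′), so a solution is determined by the scalar u ·
    -- w with u dual to x × x′.
    line-count : ∀ {x x′} → x ⨯ x′ ≢ 𝟎 → ∀ s s′ → ∑ vectors (λ w → ι ((w ∙ x ≟A s) ×-dec (w ∙ x′ ≟A s′))) ℤ.≤ q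
    line-count {x} {x′} p≢𝟎 s s′ = ℤ.≤-trans
      (∑-injective finite³ finite (λ w → (w ∙ x ≟A s) ×-dec (w ∙ x′ ≟A s′)) {R = λ _ → ⊤} (λ _ → yes tt) (u ∙_) _
        (λ {w} {w′} eqs eqs′ → ⨯-determined u∙p≡1 (trans (expand w eqs) (sym (expand w′ eqs′)))))
      (ℤ.≤-reflexive order)
      where
      u = proj₁ (dual (x ⨯ x′) p≢𝟎)
      u∙p≡1 = proj₂ (dual (x ⨯ x′) p≢𝟎)
      expand : ∀ w → w ∙ x ≡ s × w ∙ x′ ≡ s′ → w ⨯ (x ⨯ x′) ≡ (s′ ⊙ x) ⊕ (⊝ (s ⊙ x′))
      expand w (refl , refl) = bac-cab w x x′

    -- Expanding w × (x × x′) = 0 gives t x = t x′, and t can be cancelled. This is where a nonzero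
    -- volume differs from zero.
    parallel-level : ∀ {x x′ w t} → t ≢ 0# → x ⨯ x′ ≡ 𝟎 → w ∙ x ≡ t → w ∙ x′ ≡ t → x ≡ x′
    parallel-level {x} {x′} {w} t≢0 x⨯x′≡𝟎 refl w∙x′≡t = ⊙-cancel t≢0 (⊝-zero _ _ (begin
      (w ∙ x ⊙ x) ⊕ (⊝ (w ∙ x ⊙ x′))    ≡⟨ cong (λ s → (s ⊙ x) ⊕ (⊝ (w ∙ x ⊙ x′))) w∙x′≡t ⟨
      (w ∙ x′ ⊙ x) ⊕ (⊝ (w ∙ x ⊙ x′))   ≡⟨ bac-cab w x x′ ⟨
      w ⨯ (x ⨯ x′)                      ≡⟨ cong (w ⨯_) x⨯x′≡𝟎 ⟩
      w ⨯ 𝟎                             ≡⟨ ⨯-zeroʳ w ⟩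
      𝟎                                 ∎))
      where open ≡-Reasoning

    -- Since (u × w) × z = (z · u) w - (z · w) u = w, the vector u × w is one solution of y × z = w,
    -- and adding multiples of z gives a line of them.
    cross-solution : ∀ {u z w} → u ∙ z ≡ 1# → w ∙ z ≡ 0# → ∀ c → (u ⨯ w ⊕ c ⊙ z) ⨯ z ≡ w
    cross-solution {u} {z} {w} u∙z≡1 w∙z≡0 c = begin
      (u ⨯ w ⊕ c ⊙ z) ⨯ z                       ≡⟨ ⊕-⨯ (u ⨯ w) (c ⊙ z) z ⟩
      (u ⨯ w) ⨯ z ⊕ (c ⊙ z) ⨯ z                 ≡⟨ cong₂ _⊕_ (⨯-anticomm (u ⨯ w) z) (trans (⊙-⨯ c z z) (trans (cong (c ⊙_) (⨯-self z)) (⊙-zeroʳ c))) ⟩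
      (⊝ (z ⨯ (u ⨯ w))) ⊕ 𝟎                     ≡⟨ ⊕-identityʳ _ ⟩
      ⊝ (z ⨯ (u ⨯ w))                           ≡⟨ cong ⊝_ (bac-cab z u w) ⟩
      ⊝ ((z ∙ w ⊙ u) ⊕ (⊝ (z ∙ u ⊙ w)))         ≡⟨ ⊝-swap _ _ ⟩
      (z ∙ u ⊙ w) ⊕ (⊝ (z ∙ w ⊙ u))             ≡⟨ cong₂ (λ a b → (a ⊙ w) ⊕ (⊝ (b ⊙ u))) (trans (∙-comm z u) u∙z≡1) (trans (∙-comm z w) w∙z≡0) ⟩
      (1# ⊙ w) ⊕ (⊝ (0# ⊙ u))                   ≡⟨ cong₂ (λ a b → a ⊕ (⊝ b)) (⊙-identity w) (⊙-zeroˡ u) ⟩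
      w ⊕ (⊝ 𝟎)                                 ≡⟨ trans (cong (w ⊕_) ⊝𝟎) (⊕-identityʳ w) ⟩
      w                                         ∎
      where
      open ≡-Reasoning
      ⊝-swap : ∀ a b → ⊝ (a ⊕ (⊝ b)) ≡ b ⊕ (⊝ a)
      ⊝-swap a b = triple-≡ (lemma _ _) (lemma _ _) (lemma _ _)
        where
        open DifferenceSolver commutativeRing using (solve; _:=_; _:+_; :-_)
        lemma : ∀ a b → - (a + - b) ≡ b + - a
        lemma = solve 2 (λ a b → :- (a :+ :- b) := b :+ :- a) refl

    -- The solutions form a coset of the line through z, parametrised by y ↦ u · y with u dual to z;
    -- the two inequalities are the two directions of this bijection.
    cross-count : ∀ {z w} → z ≢ 𝟎 → w ∙ z ≡ 0# → ∑ vectors (λ y → ι (y ⨯ z ≟V w)) ≡ q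
    cross-count {z} {w} z≢𝟎 w∙z≡0 = trans (ℤ.≤-antisym
      (∑-injective finite³ finite (λ y → y ⨯ z ≟V w) {R = λ _ → ⊤} (λ _ → yes tt) (u ∙_) _
        (λ eq eq′ → ⨯-determined u∙z≡1 (trans eq (sym eq′))))
      (∑-injective finite finite³ {P = λ _ → ⊤} (λ _ → yes tt) (λ y → y ⨯ z ≟V w) solution
        (λ {c} _ → cross-solution u∙z≡1 w∙z≡0 c) (λ {c} {c′} _ _ eq → trans (sym (pairing c)) (trans (cong (u ∙_) eq) (pairing c′)))))
      order
      where
      open ≡-Reasoning
      u = proj₁ (dual z z≢𝟎)
      u∙z≡1 = proj₂ (dual z z≢𝟎)
      solution : A → V
      solution c = u ⨯ w ⊕ c ⊙ z
      pairing : ∀ c → u ∙ solution c ≡ c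
      pairing c = begin
        u ∙ (u ⨯ w ⊕ c ⊙ z)        ≡⟨ ∙-comm u _ ⟩
        (u ⨯ w ⊕ c ⊙ z) ∙ u        ≡⟨ ∙-⊕ (u ⨯ w) (c ⊙ z) u ⟩
        (u ⨯ w) ∙ u + (c ⊙ z) ∙ u  ≡⟨ cong₂ _+_ (trans (∙-comm (u ⨯ w) u) (∙-⨯ˡ u w))
                                        (trans (∙-⊙ c z u) (trans (cong (c *_) (trans (∙-comm z u) u∙z≡1)) (*-identityʳ c))) ⟩
        0# + c                     ≡⟨ +-identityˡ c ⟩
        c                          ∎

    ⊙-integral : ∀ {a v} → v ≢ 𝟎 → a ⊙ v ≡ 𝟎 → a ≡ 0#
    ⊙-integral {a} {v} v≢𝟎 av≡𝟎 = begin
      a              ≡⟨ *-identityʳ a ⟨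
      a * 1#         ≡⟨ cong (a *_) (trans (∙-comm v u) (proj₂ (dual v v≢𝟎))) ⟨
      a * (v ∙ u)    ≡⟨ ∙-⊙ a v u ⟨
      (a ⊙ v) ∙ u    ≡⟨ cong (_∙ u) av≡𝟎 ⟩
      𝟎 ∙ u          ≡⟨ trans (∙-comm 𝟎 u) (∙-zeroʳ u) ⟩
      0#             ∎
      where
      open ≡-Reasoning
      u = proj₁ (dual v v≢𝟎)

    perpendicular : ∀ w → ∃ λ z → z ≢ 𝟎 × w ∙ z ≡ 0#
    perpendicular ⟨ a , b , c ⟩ with a ≟A 0#
    ... | yes refl = ⟨ 1# , 0# , 0# ⟩ , (λ eq → 1≢0 (cong Triple.x₁ eq)) ,
      trans (cong₂ _+_ (cong₂ _+_ (zeroˡ 1#) (zeroʳ b)) (zeroʳ c)) (trans (+-identityʳ _) (+-identityʳ _))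
    ... | no a≢0   = ⟨ - b , a , 0# ⟩ , (λ eq → a≢0 (cong Triple.x₂ eq)) ,
      trans (cong (_+_ (a * - b + b * a)) (zeroʳ c)) (trans (+-identityʳ _) (lemma a b))
      where
      lemma : ∀ a b → a * - b + b * a ≡ 0#
      lemma a b = trans (cong (_+_ (a * - b)) (*-comm b a)) (trans (sym (distribˡ a (- b) b))
        (trans (cong (a *_) (-‿inverseˡ b)) (zeroʳ a)))

    -- Having w itself as the cross product of the pair makes orthogonality to w, independence and
    -- spanning of the plane w⊥ all follow from the one equation y × z = w.
    plane-frame : ∀ w → ∃ λ y → ∃ λ z → z ≢ 𝟎 × y ⨯ z ≡ w
    plane-frame w with perpendicular w
    ... | z , z≢𝟎 , w∙z≡0 with dual z z≢𝟎
    ...   | u , u∙z≡1 = _ , z , z≢𝟎 , cross-solution u∙z≡1 w∙z≡0 0#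

    -- For u dual to w, x = (u × x) × w, and w = y × z.
    plane-span : ∀ u y z x {w} → y ⨯ z ≡ w → u ∙ w ≡ 1# → x ∙ w ≡ 0# →
      x ≡ ((u ⨯ x) ∙ z) ⊙ y ⊕ (- ((u ⨯ x) ∙ y)) ⊙ z
    plane-span u y z x {w} y⨯z≡w u∙w≡1 x∙w≡0 = begin
      x                                                            ≡⟨ ⊙-identity x ⟨
      1# ⊙ x                                                       ≡⟨ ⊕-identityʳ _ ⟨
      (1# ⊙ x) ⊕ 𝟎                                                 ≡⟨ cong ((1# ⊙ x) ⊕_) (trans (cong ⊝_ (⊙-zeroˡ u)) ⊝𝟎) ⟨
      (1# ⊙ x) ⊕ (⊝ (0# ⊙ u))                                      ≡⟨ cong₂ (λ a b → (a ⊙ x) ⊕ (⊝ (b ⊙ u))) (trans (∙-comm w u) u∙w≡1) (trans (∙-comm w x) x∙w≡0) ⟨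
      (w ∙ u ⊙ x) ⊕ (⊝ (w ∙ x ⊙ u))                                ≡⟨ bac-cab w x u ⟨
      w ⨯ (x ⨯ u)                                                  ≡⟨ twist w x u ⟩
      (u ⨯ x) ⨯ w                                                  ≡⟨ cong ((u ⨯ x) ⨯_) y⨯z≡w ⟨
      (u ⨯ x) ⨯ (y ⨯ z)                                            ≡⟨ bac-cab (u ⨯ x) y z ⟩
      (((u ⨯ x) ∙ z) ⊙ y) ⊕ (⊝ (((u ⨯ x) ∙ y) ⊙ z))                ≡⟨ cong ((((u ⨯ x) ∙ z) ⊙ y) ⊕_) (triple-≡ (neg _ _) (neg _ _) (neg _ _)) ⟩
      ((u ⨯ x) ∙ z) ⊙ y ⊕ (- ((u ⨯ x) ∙ y)) ⊙ z                    ∎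
      where
      open ≡-Reasoning
      open DifferenceSolver commutativeRing using (solve; _:=_; _:+_; _:*_; :-_)
      neg : ∀ a b → - (a * b) ≡ - a * b
      neg = solve 2 (λ a b → :- (a :* b) := :- a :* b) refl
      ⊝-⨯ : ∀ u v → (⊝ u) ⨯ v ≡ ⊝ (u ⨯ v)
      ⊝-⨯ u v = triple-≡ (lemma _ _ _ _) (lemma _ _ _ _) (lemma _ _ _ _)
        where
        lemma : ∀ a b c d → - a * b + - (- c * d) ≡ - (a * b + - (c * d))
        lemma = solve 4 (λ a b c d → :- a :* b :+ :- (:- c :* d) := :- (a :* b :+ :- (c :* d))) refl
      twist : ∀ w x u → w ⨯ (x ⨯ u) ≡ (u ⨯ x) ⨯ w
      twist w x u = trans (⨯-anticomm w (x ⨯ u)) (trans (sym (⊝-⨯ (x ⨯ u) w)) (cong (_⨯ w) (sym (⨯-anticomm u x))))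

    -- Taking the cross product with z removes b z and leaves a (y × z) = 0.
    plane-independent : ∀ y z {a b} → y ⨯ z ≢ 𝟎 → z ≢ 𝟎 → a ⊙ y ⊕ b ⊙ z ≡ 𝟎 → a ≡ 0# × b ≡ 0#
    plane-independent y z {a} {b} y⨯z≢𝟎 z≢𝟎 eq = a≡0 , ⊙-integral z≢𝟎 (begin
        b ⊙ z             ≡⟨ ⊕-identityˡ _ ⟨
        𝟎 ⊕ b ⊙ z         ≡⟨ cong (_⊕ b ⊙ z) (trans (cong (_⊙ y) a≡0) (⊙-zeroˡ y)) ⟨
        a ⊙ y ⊕ b ⊙ z     ≡⟨ eq ⟩
        𝟎                 ∎)
      where
      open ≡-Reasoning
      a≡0 : a ≡ 0#
      a≡0 = ⊙-integral y⨯z≢𝟎 (begin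
        a ⊙ (y ⨯ z)                     ≡⟨ ⊕-identityʳ _ ⟨
        a ⊙ (y ⨯ z) ⊕ 𝟎                 ≡⟨ cong (a ⊙ (y ⨯ z) ⊕_) (trans (⊙-⨯ b z z) (trans (cong (b ⊙_) (⨯-self z)) (⊙-zeroʳ b))) ⟨
        a ⊙ (y ⨯ z) ⊕ (b ⊙ z) ⨯ z       ≡⟨ cong (_⊕ (b ⊙ z) ⨯ z) (⊙-⨯ a y z) ⟨
        (a ⊙ y) ⨯ z ⊕ (b ⊙ z) ⨯ z       ≡⟨ ⊕-⨯ (a ⊙ y) (b ⊙ z) z ⟨
        (a ⊙ y ⊕ b ⊙ z) ⨯ z             ≡⟨ cong (_⨯ z) eq ⟩
        𝟎 ⨯ z                           ≡⟨ trans (⨯-anticomm 𝟎 z) (trans (cong ⊝_ (⨯-zeroʳ z)) ⊝𝟎) ⟩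
        𝟎                               ∎)

    -- Subtracting the equations gives y × d = 0 for d = z - z′, so y = λ d with λ = u · y. Then λ
    -- (d × z) = w, and pairing with a vector dual to w leaves λ k = 1, which determines λ.
    cross-unique : ∀ {z z′ w} → w ≢ 𝟎 → z ≢ z′ →
      ∑ vectors (λ y → ι ((y ⨯ z ≟V w) ×-dec (y ⨯ z′ ≟V w))) ℤ.≤ 1ℤ
    cross-unique {z} {z′} {w} w≢𝟎 z≢z′ = Finite.∑-unique finite³ (λ y → (y ⨯ z ≟V w) ×-dec (y ⨯ z′ ≟V w)) unique
      where
      open ≡-Reasoning
      d = z ⊕ (⊝ z′)
      d≢𝟎 : d ≢ 𝟎
      d≢𝟎 eq = z≢z′ (⊝-zero z z′ eq)
      u = proj₁ (dual d d≢𝟎)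
      u∙d≡1 = proj₂ (dual d d≢𝟎)
      s = proj₁ (dual w w≢𝟎)
      s∙w≡1 = proj₂ (dual w w≢𝟎)
      sub-⨯ : ∀ y → y ⨯ d ≡ (y ⨯ z) ⊕ (⊝ (y ⨯ z′))
      sub-⨯ y = triple-≡ (lemma _ _ _ _ _ _) (lemma _ _ _ _ _ _) (lemma _ _ _ _ _ _)
        where
        open DifferenceSolver commutativeRing using (solve; _:=_; _:+_; _:*_; :-_)
        lemma : ∀ a b x y p q → a * (x + - p) + - (b * (y + - q)) ≡ (a * x + - (b * y)) + - (a * p + - (b * q))
        lemma = solve 6 (λ a b x y p q → a :* (x :+ :- p) :+ :- (b :* (y :+ :- q)) := (a :* x :+ :- (b :* y)) :+ :- (a :* p :+ :- (b :* q))) refl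
      multiple : ∀ {y} → y ⨯ z ≡ w × y ⨯ z′ ≡ w → y ≡ u ∙ y ⊙ d
      multiple {y} (eq , eq′) = parallel u∙d≡1 (trans (sub-⨯ y) (trans (cong₂ (λ a b → a ⊕ (⊝ b)) eq eq′)
        (triple-≡ (-‿inverseʳ _) (-‿inverseʳ _) (-‿inverseʳ _))))
      k = s ∙ (d ⨯ z)
      normalised : ∀ {y} → y ⨯ z ≡ w × y ⨯ z′ ≡ w → u ∙ y * k ≡ 1#
      normalised {y} eqs@(eq , _) = begin
        u ∙ y * (s ∙ (d ⨯ z))       ≡⟨ cong ((u ∙ y) *_) (∙-comm s (d ⨯ z)) ⟩
        u ∙ y * ((d ⨯ z) ∙ s)       ≡⟨ ∙-⊙ (u ∙ y) (d ⨯ z) s ⟨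
        (u ∙ y ⊙ (d ⨯ z)) ∙ s       ≡⟨ cong (_∙ s) (⊙-⨯ (u ∙ y) d z) ⟨
        ((u ∙ y ⊙ d) ⨯ z) ∙ s       ≡⟨ cong (λ v → (v ⨯ z) ∙ s) (multiple eqs) ⟨
        (y ⨯ z) ∙ s                 ≡⟨ cong (_∙ s) eq ⟩
        w ∙ s                       ≡⟨ trans (∙-comm w s) s∙w≡1 ⟩
        1#                          ∎
      same : ∀ {a b} → a * k ≡ 1# → b * k ≡ 1# → a ≡ b
      same {a} {b} ak≡1 bk≡1 = begin
        a              ≡⟨ *-identityʳ a ⟨
        a * 1#         ≡⟨ cong (a *_) (trans (*-comm k b) bk≡1) ⟨
        a * (k * b)    ≡⟨ *-assoc a k b ⟨
        a * k * b      ≡⟨ cong (_* b) ak≡1 ⟩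
        1# * b         ≡⟨ *-identityˡ b ⟩
        b              ∎
      unique : ∀ {y y′} → y ⨯ z ≡ w × y ⨯ z′ ≡ w → y′ ⨯ z ≡ w × y′ ⨯ z′ ≡ w → y ≡ y′
      unique eqs eqs′ = trans (multiple eqs) (trans (cong (_⊙ d) (same (normalised eqs) (normalised eqs′))) (sym (multiple eqs′)))

open FiniteVectorSpaces

-- First and second moments of incidence counts

module IncidenceMoments where
  open import Data.Integer.Base using (_+_; _*_; _-_; -_; _≤_)
  open ≡ using (refl; sym; trans; cong; cong₂; subst; module ≡-Reasoning)

  module WeightedSums {X : Set} (xs : List X) {p} {E : Pred X p} (E? : Decidable E) where

    e : X → ℤ
    e x = ι (E? x)

    S : {Y : Set} → (X → Y → ℤ) → Y → ℤ
    S φ y = ∑ xs (λ x → e x * φ x y)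

    #E : ℤ
    #E = ∑ xs e

    0≤e : ∀ x → 0ℤ ≤ e x
    0≤e x = ι-nonneg (E? x)

    0≤#E : 0ℤ ≤ #E
    0≤#E = ∑-nonneg xs 0≤e

    S-const : ∀ {f : X → ℤ} {c} → (∀ x → E x → f x ≡ c) → ∑ xs (λ x → e x * f x) ≡ #E * c
    S-const {f} {c} f≡c = trans (∑-cong xs (λ x → ι*-cong (E? x) (f≡c x))) (∑-*ʳ xs e c)

    S-bound : ∀ {f : X → ℤ} {c} → (∀ x → E x → f x ≤ c) → ∑ xs (λ x → e x * f x) ≤ #E * c
    S-bound {f} {c} f≤c = ℤ.≤-trans (∑-mono xs (λ x → ι*-mono (E? x) (f≤c x))) (ℤ.≤-reflexive (∑-*ʳ xs e c))

    first-moment : {Y : Set} (ys : List Y) (a : Y → ℤ) (φ : X → Y → ℤ) →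
      ∑ ys (λ y → a y * S φ y) ≡ ∑ xs (λ x → e x * ∑ ys (λ y → a y * φ x y))
    first-moment ys a φ = begin
      ∑ ys (λ y → a y * S φ y)                            ≡⟨ ∑-cong ys (λ y → sym (∑-*ˡ xs (a y) (λ x → e x * φ x y))) ⟩
      ∑ ys (λ y → ∑ xs (λ x → a y * (e x * φ x y)))       ≡⟨ ∑-swap ys xs _ ⟩
      ∑ xs (λ x → ∑ ys (λ y → a y * (e x * φ x y)))       ≡⟨ ∑-cong xs (λ x → ∑-cong ys (λ y → swap (a y) (e x) (φ x y))) ⟩
      ∑ xs (λ x → ∑ ys (λ y → e x * (a y * φ x y)))       ≡⟨ ∑-cong xs (λ x → ∑-*ˡ ys (e x) (λ y → a y * φ x y)) ⟩
      ∑ xs (λ x → e x * ∑ ys (λ y → a y * φ x y))         ∎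
      where
      open ≡-Reasoning
      swap : ∀ a b c → a * (b * c) ≡ b * (a * c)
      swap = solve-∀

    -- One factor `S φ y` is absorbed into the weight, so that `first-moment` applies twice. The
    -- result is a sum over pairs of points of E of their joint incidences.
    second-moment : {Y : Set} (ys : List Y) (a : Y → ℤ) (φ : X → Y → ℤ) →
      ∑ ys (λ y → a y * (S φ y * S φ y)) ≡
      ∑ xs (λ x → e x * ∑ xs (λ x′ → e x′ * ∑ ys (λ y → a y * (φ x y * φ x′ y))))
    second-moment ys a φ = begin
      ∑ ys (λ y → a y * (S φ y * S φ y))
        ≡⟨ ∑-cong ys (λ y → sym (ℤ.*-assoc (a y) (S φ y) (S φ y))) ⟩
      ∑ ys (λ y → (a y * S φ y) * S φ y)
        ≡⟨ first-moment ys (λ y → a y * S φ y) φ ⟩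
      ∑ xs (λ x → e x * ∑ ys (λ y → (a y * S φ y) * φ x y))
        ≡⟨ ∑-cong xs (λ x → cong (e x *_) (∑-cong ys (λ y → swap (a y) (S φ y) (φ x y)))) ⟩
      ∑ xs (λ x → e x * ∑ ys (λ y → (a y * φ x y) * S φ y))
        ≡⟨ ∑-cong xs (λ x → cong (e x *_) (first-moment ys (λ y → a y * φ x y) φ)) ⟩
      ∑ xs (λ x → e x * ∑ xs (λ x′ → e x′ * ∑ ys (λ y → (a y * φ x y) * φ x′ y)))
        ≡⟨ ∑-cong xs (λ x → cong (e x *_) (∑-cong xs (λ x′ → cong (e x′ *_) (∑-cong ys (λ y → ℤ.*-assoc (a y) (φ x y) (φ x′ y)))))) ⟩
      ∑ xs (λ x → e x * ∑ xs (λ x′ → e x′ * ∑ ys (λ y → a y * (φ x y * φ x′ y)))) ∎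
      where
      open ≡-Reasoning
      swap : ∀ a b c → a * b * c ≡ a * c * b
      swap = solve-∀

    -- Here α bounds the joint count of a generic pair, β is the excess allowed on the exceptional
    -- pairs marked by δ, and D bounds the exceptional partners of one point. In the applications
    -- the exceptional pairs are the equal or the parallel ones.
    pair-bound : ∀ (c δ : X → X → ℤ) α β D → 0ℤ ≤ β → (∀ x x′ → E x → E x′ → c x x′ ≤ α + β * δ x x′) →
      (∀ x → E x → ∑ xs (λ x′ → e x′ * δ x x′) ≤ D) →
      ∑ xs (λ x → e x * ∑ xs (λ x′ → e x′ * c x x′)) ≤ #E * (#E * α + β * D)
    pair-bound c δ α β D 0≤β c-bound δ-bound = S-bound λ x Ex → begin
      ∑ xs (λ x′ → e x′ * c x x′)                  ≤⟨ ∑-mono xs (λ x′ → ι*-mono (E? x′) (c-bound x x′ Ex)) ⟩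
      ∑ xs (λ x′ → e x′ * (α + β * δ x x′))        ≡⟨ ∑-cong xs (λ x′ → expand (e x′) α β (δ x x′)) ⟩
      ∑ xs (λ x′ → e x′ * α + β * (e x′ * δ x x′)) ≡⟨ ∑-+ xs _ _ ⟩
      ∑ xs (λ x′ → e x′ * α) + ∑ xs (λ x′ → β * (e x′ * δ x x′))
        ≡⟨ cong₂ _+_ (∑-*ʳ xs e α) (∑-*ˡ xs β (λ x′ → e x′ * δ x x′)) ⟩
      #E * α + β * ∑ xs (λ x′ → e x′ * δ x x′)     ≤⟨ ℤ.+-monoʳ-≤ (#E * α) (*-monoˡ 0≤β (δ-bound x Ex)) ⟩
      #E * α + β * D                               ∎
      where
      open ℤ.≤-Reasoning
      expand : ∀ e α β δ → e * (α + β * δ) ≡ e * α + β * (e * δ)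
      expand = solve-∀

  -- Pairs of points of E with a prescribed cross product

  module PlaneMoments (K : DiscreteFiniteField) {p} {E : Pred (Triple (DiscreteFiniteField.Carrier K)) p} (E? : Decidable E) where
    open DiscreteFiniteField K using (0#; q; finite; finite³; order; order³; recip)
    open VectorAlgebra K
    open SolutionCounts K
    open WeightedSums vectors E? renaming (#E to N; 0≤#E to 0≤N)
    module Plane w = WeightedSums vectors (λ y → E? y ×-dec (y ∙ w ≟A 0#))

    perp : V → V → ℤ
    perp y w = ι (y ∙ w ≟A 0#)

    nonzero : V → ℤ
    nonzero w = ι (¬? (w ≟V 𝟎))

    P : V → ℤ
    P = Plane.#E

    M : V → V → ℤ
    M y = S (λ z w → ι (y ⨯ z ≟V w))

    f : V → ℤ
    f w = ∑ vectors (λ y → e y * M y w)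

    Q : A → V → ℤ
    Q t = S (λ x w → ι (w ∙ x ≟A t))

    -- The vector w = 0 is left out: there f counts the parallel pairs, and w⊥ is the whole space
    -- rather than a plane.
    F G W : ℤ
    F = ∑ vectors (λ w → nonzero w * f w)
    G = ∑ vectors (λ w → nonzero w * (f w * f w))
    W = ∑ vectors (λ w → nonzero w * (P w * P w))

    -- q times the deviation of M y w from its average over the y in w⊥; it vanishes for all other y.
    D : V → V → ℤ
    D y w = q * M y w - P w * perp y w

    -- The sum is over y ∈ E only, whereas `deviation-bound` controls the sum over all y;
    -- `scaling-average` bridges the two.
    T : V → ℤ
    T w = ∑ vectors (λ y → e y * (D y w * D y w))

    0≤q² : 0ℤ ≤ q * q
    0≤q² = 0≤a² q

    diagonal : ∀ {r} {R : Pred V r} (R? : Decidable R) → ∀ x → ∑ vectors (λ x′ → ι (R? x′) * ι (x′ ≟V x)) ≤ 1ℤ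
    diagonal R? x = ℤ.≤-trans (ℤ.≤-reflexive (trans (∑-cong vectors (λ x′ → ℤ.*-comm (ι (R? x′)) _)) (Finite.∑-delta finite³ x (λ x′ → ι (R? x′))))) (ι≤1 (R? x))

    module _ (0∉E : ¬ E 𝟎) where

      E⇒≢𝟎 : ∀ {x} → E x → x ≢ 𝟎
      E⇒≢𝟎 Ex refl = 0∉E Ex

      -- The mean of Q is N / q. Two distinct points of E share at most q vectors w with product t,
      -- none if they are parallel, so the second moment is at most N (N q + q²). All terms in N²
      -- then cancel and only the diagonal survives.
      variance-Q : ∀ {t} → t ≢ 0# →
        ∑ vectors (λ w → (N * 1ℤ - q * Q t w) * (N * 1ℤ - q * Q t w)) ≤ q * q * (q * q) * N
      variance-Q {t} t≢0 = begin
        ∑ vectors (λ w → (N * 1ℤ - q * Q t w) * (N * 1ℤ - q * Q t w))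
          ≡⟨ ∑-square vectors N q (λ _ → 1ℤ) (Q t) ⟩
        N * N * ∑ vectors (λ _ → 1ℤ) + - (+ 2 * N * q) * ∑ vectors (λ w → 1ℤ * Q t w) + q * q * ∑ vectors (λ w → Q t w * Q t w)
          ≡⟨ cong₂ (λ a b → N * N * a + - (+ 2 * N * q) * b + q * q * ∑ vectors (λ w → Q t w * Q t w)) order³ mean ⟩
        N * N * (q * (q * q)) + - (+ 2 * N * q) * (N * (q * q)) + q * q * ∑ vectors (λ w → Q t w * Q t w)
          ≤⟨ ℤ.+-monoʳ-≤ (N * N * (q * (q * q)) + - (+ 2 * N * q) * (N * (q * q))) (*-monoˡ 0≤q² square) ⟩
        N * N * (q * (q * q)) + - (+ 2 * N * q) * (N * (q * q)) + q * q * (N * (N * q + q * q * 1ℤ))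
          ≡⟨ collect N q ⟩
        q * q * (q * q) * N ∎
        where
        open ℤ.≤-Reasoning
        φ : V → V → ℤ
        φ x w = ι (w ∙ x ≟A t)
        collect : ∀ N q → N * N * (q * (q * q)) + - (+ 2 * N * q) * (N * (q * q)) + q * q * (N * (N * q + q * q * 1ℤ)) ≡ q * q * (q * q) * N
        collect = solve-∀
        mean : ∑ vectors (λ w → 1ℤ * Q t w) ≡ N * (q * q)
        mean = trans (first-moment vectors (λ _ → 1ℤ) φ)
          (S-const λ x Ex → trans (∑-cong vectors (λ w → ℤ.*-identityˡ (φ x w))) (plane-count (E⇒≢𝟎 Ex) t))
        joint : ∀ x x′ → E x → E x′ → ∑ vectors (λ w → 1ℤ * (φ x w * φ x′ w)) ≤ q + q * q * ι (x′ ≟V x)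
        joint x x′ Ex Ex′ = ℤ.≤-trans (ℤ.≤-reflexive (∑-cong vectors (λ w → trans (ℤ.*-identityˡ (φ x w * φ x′ w)) (sym (ι-× (w ∙ x ≟A t) (w ∙ x′ ≟A t)))))) bound
          where
          bound : ∑ vectors (λ w → ι ((w ∙ x ≟A t) ×-dec (w ∙ x′ ≟A t))) ≤ q + q * q * ι (x′ ≟V x)
          bound with x′ ≟V x
          ... | yes refl = begin
            ∑ vectors (λ w → ι ((w ∙ x ≟A t) ×-dec (w ∙ x ≟A t))) ≤⟨ ∑-mono vectors (λ w → ι-mono ((w ∙ x ≟A t) ×-dec (w ∙ x ≟A t)) (w ∙ x ≟A t) proj₁) ⟩
            ∑ vectors (λ w → ι (w ∙ x ≟A t))                      ≡⟨ plane-count (E⇒≢𝟎 Ex) t ⟩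
            q * q                                                 ≡⟨ ℤ.*-identityʳ (q * q) ⟨
            q * q * 1ℤ                                            ≡⟨ ℤ.+-identityˡ _ ⟨
            -- On the diagonal q² would do; the extra q only fits the shape asked for by
            -- `pair-bound`, whose generic term is granted to every pair.
            0ℤ + q * q * 1ℤ                                       ≤⟨ ℤ.+-monoˡ-≤ (q * q * 1ℤ) 0≤q ⟩
            q + q * q * 1ℤ                                        ∎
          ... | no x′≢x with x ⨯ x′ ≟V 𝟎
          ...   | no x⨯x′≢𝟎 = ℤ.≤-trans (line-count x⨯x′≢𝟎 t t) (ℤ.≤-reflexive (sym (trans (cong (_+_ q) (ℤ.*-zeroʳ (q * q))) (ℤ.+-identityʳ q))))
          ...   | yes x⨯x′≡𝟎 = begin
            ∑ vectors (λ w → ι ((w ∙ x ≟A t) ×-dec (w ∙ x′ ≟A t)))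
              ≡⟨ ∑-cong vectors (λ w → ι-no ((w ∙ x ≟A t) ×-dec (w ∙ x′ ≟A t)) (λ (eq , eq′) → x′≢x (sym (parallel-level t≢0 x⨯x′≡𝟎 eq eq′)))) ⟩
            ∑ vectors (λ w → 0ℤ)     ≡⟨ ∑-zero vectors ⟩
            0ℤ                       ≤⟨ 0≤q ⟩
            q                        ≡⟨ trans (cong (_+_ q) (ℤ.*-zeroʳ (q * q))) (ℤ.+-identityʳ q) ⟨
            q + q * q * 0ℤ           ∎
        square : ∑ vectors (λ w → Q t w * Q t w) ≤ N * (N * q + q * q * 1ℤ)
        square = begin
          ∑ vectors (λ w → Q t w * Q t w)          ≡⟨ ∑-cong vectors (λ w → sym (ℤ.*-identityˡ (Q t w * Q t w))) ⟩
          ∑ vectors (λ w → 1ℤ * (Q t w * Q t w))   ≡⟨ second-moment vectors (λ _ → 1ℤ) φ ⟩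
          ∑ vectors (λ x → e x * ∑ vectors (λ x′ → e x′ * ∑ vectors (λ w → 1ℤ * (φ x w * φ x′ w))))
            ≤⟨ pair-bound _ (λ x x′ → ι (x′ ≟V x)) q (q * q) 1ℤ 0≤q² joint (λ x _ → diagonal E? x) ⟩
          N * (N * q + q * q * 1ℤ)                 ∎

      module _ {w} (w≢𝟎 : w ≢ 𝟎) where
        open Plane w using () renaming (e to ε; S to Sε; first-moment to first-momentε; second-moment to second-momentε; S-const to S-constε; pair-bound to pair-boundε; 0≤#E to 0≤P)

        private
          ψ : V → V → ℤ
          ψ z y = ι (y ⨯ z ≟V w)

        ε≡ : ∀ y → ε y ≡ e y * perp y w
        ε≡ y = ι-× (E? y) (y ∙ w ≟A 0#)

        -- As z is orthogonal to y × z, only points of E in the plane w⊥ contribute to M, so its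
        -- moments involve P w rather than N.
        ψ-perp : ∀ z y → e z * ψ z y ≡ ε z * ψ z y
        ψ-perp z y = trans (ℤ.*-comm (e z) (ψ z y)) (trans (ι*-cong (y ⨯ z ≟V w) agree) (ℤ.*-comm (ψ z y) (ε z)))
          where
          agree : y ⨯ z ≡ w → e z ≡ ε z
          agree refl = ι-cong (E? z) (E? z ×-dec (z ∙ (y ⨯ z) ≟A 0#)) (λ Ez → Ez , ∙-⨯ʳ y z) proj₁

        M≡ : ∀ y → M y w ≡ Sε ψ y
        M≡ y = ∑-cong vectors (λ z → ψ-perp z y)

        perp-M : ∀ y → M y w * perp y w ≡ M y w
        perp-M y = trans (sym (∑-*ʳ vectors (λ z → e z * ψ z y) (perp y w))) (∑-cong vectors (λ z →
          trans (ℤ.*-assoc (e z) (ψ z y) (perp y w)) (cong (e z *_) (absorb z))))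
          where
          absorb : ∀ z → ψ z y * perp y w ≡ ψ z y
          absorb z with y ⨯ z ≟V w
          ... | no  _    = refl
          ... | yes refl = trans (ℤ.*-identityˡ _) (ι-yes (y ∙ (y ⨯ z) ≟A 0#) (∙-⨯ˡ y z))

        -- Each of the P w points z in the plane is hit by exactly q vectors y, and two different z
        -- by at most one common y. Again the terms in (P w)² cancel, leaving the diagonal
        -- contribution q³ P w.
        deviation-bound : ∑ vectors (λ y → D y w * D y w) ≤ q * (q * q) * P w
        deviation-bound = begin
          ∑ vectors (λ y → D y w * D y w)
            ≡⟨ ∑-square vectors q (P w) (λ y → M y w) (λ y → perp y w) ⟩
          q * q * ∑ vectors (λ y → M y w * M y w) + - (+ 2 * q * P w) * ∑ vectors (λ y → M y w * perp y w) + P w * P w * ∑ vectors (λ y → perp y w * perp y w)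
            ≡⟨ cong₂ (λ a b → q * q * ∑ vectors (λ y → M y w * M y w) + - (+ 2 * q * P w) * a + P w * P w * b) mean plane ⟩
          q * q * ∑ vectors (λ y → M y w * M y w) + - (+ 2 * q * P w) * (P w * q) + P w * P w * (q * q)
            ≤⟨ ℤ.+-monoˡ-≤ (P w * P w * (q * q)) (ℤ.+-monoˡ-≤ (- (+ 2 * q * P w) * (P w * q)) (*-monoˡ 0≤q² square)) ⟩
          q * q * (P w * (P w * 1ℤ + q * 1ℤ)) + - (+ 2 * q * P w) * (P w * q) + P w * P w * (q * q)
            ≡⟨ collect (P w) q ⟩
          q * (q * q) * P w ∎
          where
          open ℤ.≤-Reasoning
          collect : ∀ P q → q * q * (P * (P * 1ℤ + q * 1ℤ)) + - (+ 2 * q * P) * (P * q) + P * P * (q * q) ≡ q * (q * q) * P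
          collect = solve-∀
          plane : ∑ vectors (λ y → perp y w * perp y w) ≡ q * q
          plane = trans (∑-cong vectors (λ y → ι-idem (y ∙ w ≟A 0#))) (plane-count w≢𝟎 0#)
          mean : ∑ vectors (λ y → M y w * perp y w) ≡ P w * q
          mean = trans (∑-cong vectors (λ y → trans (perp-M y) (trans (M≡ y) (sym (ℤ.*-identityˡ (Sε ψ y))))))
            (trans (first-momentε vectors (λ _ → 1ℤ) ψ)
              (S-constε λ z (Ez , z∙w≡0) → trans (∑-cong vectors (λ y → ℤ.*-identityˡ (ψ z y))) (cross-count (E⇒≢𝟎 Ez) (trans (∙-comm w z) z∙w≡0))))
          joint : ∀ z z′ → E z × z ∙ w ≡ 0# → E z′ × z′ ∙ w ≡ 0# → ∑ vectors (λ y → 1ℤ * (ψ z y * ψ z′ y)) ≤ 1ℤ + q * ι (z′ ≟V z)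
          joint z z′ (Ez , z∙w≡0) _ = ℤ.≤-trans (ℤ.≤-reflexive (∑-cong vectors (λ y → trans (ℤ.*-identityˡ (ψ z y * ψ z′ y)) (sym (ι-× (y ⨯ z ≟V w) (y ⨯ z′ ≟V w)))))) bound
            where
            bound : ∑ vectors (λ y → ι ((y ⨯ z ≟V w) ×-dec (y ⨯ z′ ≟V w))) ≤ 1ℤ + q * ι (z′ ≟V z)
            bound with z′ ≟V z
            ... | yes refl = begin
              ∑ vectors (λ y → ι ((y ⨯ z ≟V w) ×-dec (y ⨯ z ≟V w))) ≤⟨ ∑-mono vectors (λ y → ι-mono ((y ⨯ z ≟V w) ×-dec (y ⨯ z ≟V w)) (y ⨯ z ≟V w) proj₁) ⟩
              ∑ vectors (λ y → ψ z y)                               ≡⟨ cross-count (E⇒≢𝟎 Ez) (trans (∙-comm w z) z∙w≡0) ⟩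
              q                                                     ≡⟨ trans (ℤ.+-identityˡ (q * 1ℤ)) (ℤ.*-identityʳ q) ⟨
              0ℤ + q * 1ℤ                                           ≤⟨ ℤ.+-monoˡ-≤ (q * 1ℤ) (+≤+ z≤n) ⟩
              1ℤ + q * 1ℤ                                           ∎
            ... | no z′≢z = ℤ.≤-trans (cross-unique w≢𝟎 (λ z≡z′ → z′≢z (sym z≡z′)))
                              (ℤ.≤-reflexive (sym (trans (cong (_+_ 1ℤ) (ℤ.*-zeroʳ q)) (ℤ.+-identityʳ 1ℤ))))
          square : ∑ vectors (λ y → M y w * M y w) ≤ P w * (P w * 1ℤ + q * 1ℤ)
          square = begin
            ∑ vectors (λ y → M y w * M y w)          ≡⟨ ∑-cong vectors (λ y → trans (cong₂ _*_ (M≡ y) (M≡ y)) (sym (ℤ.*-identityˡ (Sε ψ y * Sε ψ y)))) ⟩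
            ∑ vectors (λ y → 1ℤ * (Sε ψ y * Sε ψ y)) ≡⟨ second-momentε vectors (λ _ → 1ℤ) ψ ⟩
            ∑ vectors (λ z → ε z * ∑ vectors (λ z′ → ε z′ * ∑ vectors (λ y → 1ℤ * (ψ z y * ψ z′ y))))
              ≤⟨ pair-boundε _ (λ z z′ → ι (z′ ≟V z)) 1ℤ q 1ℤ 0≤q joint (λ z _ → diagonal (λ y → E? y ×-dec (y ∙ w ≟A 0#)) z) ⟩
            P w * (P w * 1ℤ + q * 1ℤ)                ∎

        -- Both terms of D vanish off w⊥. Restricting to E ∩ w⊥ is what makes Cauchy-Schwarz in
        -- `f-deviation` cost a factor P w instead of N.
        eD≡εD : ∀ y → e y * D y w ≡ ε y * D y w
        eD≡εD y = begin
          e y * (q * M y w - P w * perp y w)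
            ≡⟨ cong₂ (λ m o → e y * (q * m - P w * o)) (sym (perp-M y)) (sym (ι-idem (y ∙ w ≟A 0#))) ⟩
          e y * (q * (M y w * perp y w) - P w * (perp y w * perp y w))
            ≡⟨ factor (e y) q (M y w) (P w) (perp y w) ⟩
          e y * perp y w * (q * M y w - P w * perp y w)
            ≡⟨ cong (_* D y w) (ε≡ y) ⟨
          ε y * D y w ∎
          where
          open ≡-Reasoning
          factor : ∀ e q m p o → e * (q * (m * o) - p * (o * o)) ≡ e * o * (q * m - p * o)
          factor = solve-∀

        -- So (P w)² / q is the value f w would take if M were equal to its mean at every y in E ∩
        -- w⊥.
        ∑εD : ∑ vectors (λ y → ε y * D y w) ≡ q * f w - P w * P w
        ∑εD = begin
          ∑ vectors (λ y → ε y * D y w)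
            ≡⟨ ∑-cong vectors (λ y → sym (eD≡εD y)) ⟩
          ∑ vectors (λ y → e y * (q * M y w - P w * perp y w))
            ≡⟨ ∑-cong vectors (λ y → expand (e y) q (M y w) (P w) (perp y w)) ⟩
          ∑ vectors (λ y → q * (e y * M y w) + - P w * (e y * perp y w))
            ≡⟨ ∑-+ vectors _ _ ⟩
          ∑ vectors (λ y → q * (e y * M y w)) + ∑ vectors (λ y → - P w * (e y * perp y w))
            ≡⟨ cong₂ _+_ (∑-*ˡ vectors q (λ y → e y * M y w)) (∑-*ˡ vectors (- P w) (λ y → e y * perp y w)) ⟩
          q * f w + - P w * ∑ vectors (λ y → e y * perp y w)
            ≡⟨ cong (λ p → q * f w + - P w * p) (∑-cong vectors (λ y → sym (ε≡ y))) ⟩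
          q * f w + - P w * P w
            ≡⟨ cong (_+_ (q * f w)) (sym (ℤ.neg-distribˡ-* (P w) (P w))) ⟩
          q * f w - P w * P w ∎
          where
          open ≡-Reasoning
          expand : ∀ e q m p o → e * (q * m - p * o) ≡ q * (e * m) + - p * (e * o)
          expand = solve-∀

        f-deviation : (q * f w - P w * P w) * (q * f w - P w * P w) ≤ P w * T w
        f-deviation = begin
          (q * f w - P w * P w) * (q * f w - P w * P w)                        ≡⟨ cong₂ _*_ (sym ∑εD) (sym ∑εD) ⟩
          -- Indicators are idempotent, so ε D = ε (ε D): one copy becomes the first factor, whose
          -- squares sum to P w, and the other keeps the second factor supported on E ∩ w⊥.
          ∑ vectors (λ y → ε y * D y w) * ∑ vectors (λ y → ε y * D y w)        ≡⟨ cong₂ _*_ square-free square-free ⟩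
          ∑ vectors (λ y → ε y * (ε y * D y w)) * ∑ vectors (λ y → ε y * (ε y * D y w))
            ≤⟨ cauchy-schwarz vectors ε (λ y → ε y * D y w) ⟩
          ∑ vectors (λ y → ε y * ε y) * ∑ vectors (λ y → ε y * D y w * (ε y * D y w))
            ≡⟨ cong₂ _*_ (∑-cong vectors ε-idem) (∑-cong vectors (λ y → trans (regroup (ε y) (D y w)) (trans (cong (λ a → a * D y w * D y w) (ε-idem y))
                 (trans (cong (_* D y w) (sym (eD≡εD y))) (ℤ.*-assoc (e y) (D y w) (D y w)))))) ⟩
          P w * T w ∎
          where
          open ℤ.≤-Reasoning
          ε-idem : ∀ y → ε y * ε y ≡ ε y
          ε-idem y = ι-idem (E? y ×-dec (y ∙ w ≟A 0#))
          regroup : ∀ a b → a * b * (a * b) ≡ a * a * b * b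
          regroup = solve-∀
          square-free : ∑ vectors (λ y → ε y * D y w) ≡ ∑ vectors (λ y → ε y * (ε y * D y w))
          square-free = ∑-cong vectors (λ y → trans (cong (_* D y w) (sym (ε-idem y))) (ℤ.*-assoc (ε y) (ε y) (D y w)))

        -- This is a² ≤ 2 b² + 2 (a - b)² with a = q f and b = P², a rearrangement of (a - 2b)² ≥ 0.
        -- It separates the mean from the deviation.
        f-square : q * q * (f w * f w) ≤ + 2 * (P w * P w * (P w * P w)) + + 2 * (P w * T w)
        f-square = begin
          q * q * (f w * f w)                        ≡⟨ regroup q (f w) ⟩
          a * a                                      ≤⟨ ℤ.0≤i-j⇒j≤i (subst (0ℤ ≤_) (complete a b) (0≤a² (a - + 2 * b))) ⟩
          + 2 * (b * b) + + 2 * ((a - b) * (a - b))  ≤⟨ ℤ.+-monoʳ-≤ (+ 2 * (b * b)) (*-monoˡ {c = + 2} (+≤+ z≤n) f-deviation) ⟩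
          + 2 * (b * b) + + 2 * (P w * T w)          ∎
          where
          open ℤ.≤-Reasoning
          a = q * f w
          b = P w * P w
          regroup : ∀ q f → q * q * (f * f) ≡ q * f * (q * f)
          regroup = solve-∀
          complete : ∀ a b → (a - + 2 * b) * (a - + 2 * b) ≡ + 2 * (b * b) + + 2 * ((a - b) * (a - b)) - a * a
          complete = solve-∀

      module _ {L : ℤ} (0≤L : 0ℤ ≤ L) (L-bound : ∀ y → y ≢ 𝟎 → ∑ vectors (λ z → e z * ι (y ⨯ z ≟V 𝟎)) ≤ L) where

        -- W counts triples (y, z, w) with y, z ∈ E both in w⊥. A pair that is not parallel allows
        -- at most q vectors w, a parallel pair at most q², and each y has at most L parallel
        -- partners.
        W-bound : W ≤ N * (N * q + q * q * L)
        W-bound = begin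
          ∑ vectors (λ w → nonzero w * (P w * P w))
            ≡⟨ ∑-cong vectors (λ w → cong (nonzero w *_) (cong₂ _*_ (P≡ w) (P≡ w))) ⟩
          ∑ vectors (λ w → nonzero w * (S perp w * S perp w))
            ≡⟨ second-moment vectors nonzero perp ⟩
          ∑ vectors (λ y → e y * ∑ vectors (λ z → e z * ∑ vectors (λ w → nonzero w * (perp y w * perp z w))))
            ≤⟨ pair-bound _ (λ y z → ι (y ⨯ z ≟V 𝟎)) q (q * q) L 0≤q² joint (λ y Ey → L-bound y (E⇒≢𝟎 Ey)) ⟩
          N * (N * q + q * q * L) ∎
          where
          open ℤ.≤-Reasoning
          P≡ : ∀ w → P w ≡ S perp w
          P≡ w = ∑-cong vectors (λ y → ι-× (E? y) (y ∙ w ≟A 0#))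
          drop : ∀ y z w → nonzero w * (perp y w * perp z w) ≤ ι ((w ∙ y ≟A 0#) ×-dec (w ∙ z ≟A 0#))
          drop y z w = begin
            nonzero w * (perp y w * perp z w)              ≤⟨ *-monoʳ (0≤a*b (ι-nonneg (y ∙ w ≟A 0#)) (ι-nonneg (z ∙ w ≟A 0#))) (ι≤1 (¬? (w ≟V 𝟎))) ⟩
            1ℤ * (perp y w * perp z w)                     ≡⟨ ℤ.*-identityˡ (perp y w * perp z w) ⟩
            perp y w * perp z w                            ≡⟨ ι-× (y ∙ w ≟A 0#) (z ∙ w ≟A 0#) ⟨
            ι ((y ∙ w ≟A 0#) ×-dec (z ∙ w ≟A 0#))          ≤⟨ ι-mono _ ((w ∙ y ≟A 0#) ×-dec (w ∙ z ≟A 0#)) (λ (eq , eq′) → trans (∙-comm w y) eq , trans (∙-comm w z) eq′) ⟩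
            ι ((w ∙ y ≟A 0#) ×-dec (w ∙ z ≟A 0#))          ∎
          joint : ∀ y z → E y → E z → ∑ vectors (λ w → nonzero w * (perp y w * perp z w)) ≤ q + q * q * ι (y ⨯ z ≟V 𝟎)
          joint y z Ey Ez = ℤ.≤-trans (∑-mono vectors (drop y z)) bound
            where
            bound : ∑ vectors (λ w → ι ((w ∙ y ≟A 0#) ×-dec (w ∙ z ≟A 0#))) ≤ q + q * q * ι (y ⨯ z ≟V 𝟎)
            bound with y ⨯ z ≟V 𝟎
            ... | no y⨯z≢𝟎 = ℤ.≤-trans (line-count y⨯z≢𝟎 0# 0#) (ℤ.≤-reflexive (sym (trans (cong (_+_ q) (ℤ.*-zeroʳ (q * q))) (ℤ.+-identityʳ q))))
            ... | yes _ = begin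
              ∑ vectors (λ w → ι ((w ∙ y ≟A 0#) ×-dec (w ∙ z ≟A 0#)))
                ≤⟨ ∑-mono vectors (λ w → ι-mono ((w ∙ y ≟A 0#) ×-dec (w ∙ z ≟A 0#)) (w ∙ y ≟A 0#) proj₁) ⟩
              ∑ vectors (λ w → ι (w ∙ y ≟A 0#))    ≡⟨ plane-count (E⇒≢𝟎 Ey) 0# ⟩
              q * q                                ≡⟨ trans (ℤ.+-identityˡ (q * q * 1ℤ)) (ℤ.*-identityʳ (q * q)) ⟨
              0ℤ + q * q * 1ℤ                      ≤⟨ ℤ.+-monoˡ-≤ (q * q * 1ℤ) 0≤q ⟩
              q + q * q * 1ℤ                       ∎

        -- Every pair in E has exactly one cross product, so f sums to N², and f 𝟎 counts the
        -- parallel pairs.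
        N²≤F+NL : N * N ≤ F + N * L
        N²≤F+NL = begin
          N * N                                                               ≡⟨ total ⟨
          ∑ vectors f                                                         ≡⟨ ∑-cong vectors split ⟩
          ∑ vectors (λ w → nonzero w * f w + ι (w ≟V 𝟎) * f w)                ≡⟨ ∑-+ vectors (λ w → nonzero w * f w) (λ w → ι (w ≟V 𝟎) * f w) ⟩
          F + ∑ vectors (λ w → ι (w ≟V 𝟎) * f w)                              ≡⟨ cong (_+_ F) (Finite.∑-delta finite³ 𝟎 f) ⟩
          F + f 𝟎                                                             ≤⟨ ℤ.+-monoʳ-≤ F (S-bound (λ y Ey → L-bound y (E⇒≢𝟎 Ey))) ⟩
          F + N * L                                                           ∎
          where
          open ℤ.≤-Reasoning
          split : ∀ w → f w ≡ nonzero w * f w + ι (w ≟V 𝟎) * f w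
          split w with w ≟V 𝟎
          ... | yes _ = sym (trans (ℤ.+-identityˡ (1ℤ * f w)) (ℤ.*-identityˡ (f w)))
          ... | no  _ = sym (trans (ℤ.+-identityʳ (1ℤ * f w)) (ℤ.*-identityˡ (f w)))
          M-total : ∀ y → ∑ vectors (λ w → M y w) ≡ N * 1ℤ
          M-total y = trans (∑-cong vectors (λ w → sym (ℤ.*-identityˡ (M y w))))
            (trans (first-moment vectors (λ _ → 1ℤ) (λ z w → ι (y ⨯ z ≟V w)))
              (S-const λ z _ → trans (∑-cong vectors (λ w → trans (ℤ.*-identityˡ (ι (y ⨯ z ≟V w))) (ι-cong (y ⨯ z ≟V w) (w ≟V y ⨯ z) sym sym)))
                (Finite.once finite³ (y ⨯ z))))
          total : ∑ vectors f ≡ N * N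
          total = trans (∑-swap vectors vectors _) (trans (∑-cong vectors (λ y → ∑-*ˡ vectors (e y) (M y)))
            (trans (S-const λ y _ → M-total y) (cong (N *_) (ℤ.*-identityʳ N))))

        nonzeroA : A → ℤ
        nonzeroA a = ι (¬? (a ≟A 0#))

        #nonzeroA : ∑ scalars nonzeroA ≡ q - 1ℤ
        #nonzeroA = begin
          ∑ scalars nonzeroA                                                      ≡⟨ add-sub _ _ ⟩
          ∑ scalars nonzeroA + ∑ scalars (λ a → ι (a ≟A 0#)) - ∑ scalars (λ a → ι (a ≟A 0#))
            ≡⟨ cong₂ _-_ (trans (sym (∑-+ scalars nonzeroA _)) (trans (∑-cong scalars split) order)) (Finite.once finite 0#) ⟩
          q - 1ℤ                                                                  ∎
          where
          open ≡-Reasoning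
          add-sub : ∀ a b → a ≡ a + b - b
          add-sub = solve-∀
          split : ∀ a → nonzeroA a + ι (a ≟A 0#) ≡ 1ℤ
          split a with a ≟A 0#
          ... | yes _ = refl
          ... | no  _ = refl

        -- The summand of `X` without its restriction to y ∈ E, so that it can be summed over all y.
        Φ : V → V → ℤ
        Φ y w = nonzero w * (P w * (D y w * D y w))

        0≤Φ : ∀ y w → 0ℤ ≤ Φ y w
        0≤Φ y w = 0≤a*b (ι-nonneg (¬? (w ≟V 𝟎))) (0≤a*b (Plane.0≤#E w) (0≤a² (D y w)))

        -- The factor `nonzero y` does not affect the sum over E, and it removes the origin, which
        -- is not on a unique line of multiples.
        H : V → ℤ
        H y = nonzero y * ∑ vectors (Φ y)

        0≤H : ∀ y → 0ℤ ≤ H y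
        0≤H y = 0≤a*b (ι-nonneg (¬? (y ≟V 𝟎))) (∑-nonneg vectors (0≤Φ y))

        X : ℤ
        X = ∑ vectors (λ w → nonzero w * (P w * T w))

        X≡ : X ≡ ∑ vectors (λ y → e y * H y)
        X≡ = begin
          ∑ vectors (λ w → nonzero w * (P w * T w))
            ≡⟨ ∑-cong vectors (λ w → trans (sym (ℤ.*-assoc (nonzero w) (P w) (T w))) (sym (∑-*ˡ vectors (nonzero w * P w) (λ y → e y * (D y w * D y w))))) ⟩
          ∑ vectors (λ w → ∑ vectors (λ y → nonzero w * P w * (e y * (D y w * D y w))))
            ≡⟨ ∑-swap vectors vectors _ ⟩
          ∑ vectors (λ y → ∑ vectors (λ w → nonzero w * P w * (e y * (D y w * D y w))))
            ≡⟨ ∑-cong vectors (λ y → ∑-cong vectors (λ w → regroup (nonzero w) (P w) (e y) (D y w * D y w))) ⟩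
          ∑ vectors (λ y → ∑ vectors (λ w → e y * Φ y w))
            ≡⟨ ∑-cong vectors (λ y → ∑-*ˡ vectors (e y) (Φ y)) ⟩
          ∑ vectors (λ y → e y * ∑ vectors (Φ y))
            ≡⟨ ∑-cong vectors (λ y → ι*-cong (E? y) (λ Ey → sym (trans (cong (_* ∑ vectors (Φ y)) (ι-yes (¬? (y ≟V 𝟎)) (E⇒≢𝟎 Ey))) (ℤ.*-identityˡ _)))) ⟩
          ∑ vectors (λ y → e y * H y) ∎
          where
          open ≡-Reasoning
          regroup : ∀ a b c d → a * b * (c * d) ≡ c * (a * (b * d))
          regroup = solve-∀

        module _ {a} (a≢0 : a ≢ 0#) where

          private
            a⁻¹ = proj₁ (recip a a≢0)
            aa⁻¹≡1 = proj₂ (recip a a≢0)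

          ⊙-≢𝟎 : ∀ {v} → v ≢ 𝟎 → a ⊙ v ≢ 𝟎
          ⊙-≢𝟎 v≢𝟎 eq = v≢𝟎 (⊙-cancel a≢0 (trans eq (sym (⊙-zeroʳ a))))

          nonzero-⊙ : ∀ v → nonzero (a ⊙ v) ≡ nonzero v
          nonzero-⊙ v = ι-cong (¬? (a ⊙ v ≟V 𝟎)) (¬? (v ≟V 𝟎)) (λ av≢𝟎 v≡𝟎 → av≢𝟎 (trans (cong (a ⊙_) v≡𝟎) (⊙-zeroʳ a))) ⊙-≢𝟎

          ∙-scaleʳ : ∀ y w → (y ∙ (a ⊙ w) ≡ 0# → y ∙ w ≡ 0#) × (y ∙ w ≡ 0# → y ∙ (a ⊙ w) ≡ 0#)
          ∙-scaleʳ y w = (λ eq → integral a≢0 (trans (sym scale) eq)) , (λ eq → trans scale (trans (cong (a *K_) eq) (zeroʳ a)))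
            where
            open DiscreteFiniteField K using () renaming (_*_ to _*K_; isCommutativeRing to isCR)
            open IsCommutativeRing isCR using (zeroʳ)
            scale : y ∙ (a ⊙ w) ≡ a *K (y ∙ w)
            scale = trans (∙-comm y (a ⊙ w)) (trans (∙-⊙ a w y) (cong (a *K_) (∙-comm w y)))

          ∙-scaleˡ : ∀ y w → (((a ⊙ y) ∙ w) ≡ 0# → y ∙ w ≡ 0#) × (y ∙ w ≡ 0# → ((a ⊙ y) ∙ w) ≡ 0#)
          ∙-scaleˡ y w = (λ eq → trans (∙-comm y w) (proj₁ (∙-scaleʳ w y) (trans (∙-comm w (a ⊙ y)) eq))) ,
                         (λ eq → trans (∙-comm (a ⊙ y) w) (proj₂ (∙-scaleʳ w y) (trans (∙-comm w y) eq)))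

          P-⊙ : ∀ w → P (a ⊙ w) ≡ P w
          P-⊙ w = ∑-cong vectors (λ y → ι-cong (E? y ×-dec (y ∙ (a ⊙ w) ≟A 0#)) (E? y ×-dec (y ∙ w ≟A 0#))
            (λ (Ey , eq) → Ey , proj₁ (∙-scaleʳ y w) eq) (λ (Ey , eq) → Ey , proj₂ (∙-scaleʳ y w) eq))

          perp-⊙ : ∀ y w → perp (a ⊙ y) (a ⊙ w) ≡ perp y w
          perp-⊙ y w = ι-cong (((a ⊙ y) ∙ (a ⊙ w)) ≟A 0#) (y ∙ w ≟A 0#)
            (λ eq → proj₁ (∙-scaleˡ y w) (proj₁ (∙-scaleʳ (a ⊙ y) w) eq))
            (λ eq → proj₂ (∙-scaleʳ (a ⊙ y) w) (proj₂ (∙-scaleˡ y w) eq))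

          M-⊙ : ∀ y w → M (a ⊙ y) (a ⊙ w) ≡ M y w
          M-⊙ y w = ∑-cong vectors (λ z → cong (e z *_) (ι-cong ((a ⊙ y) ⨯ z ≟V a ⊙ w) (y ⨯ z ≟V w)
            (λ eq → ⊙-cancel a≢0 (trans (sym (⊙-⨯ a y z)) eq))
            (λ eq → trans (⊙-⨯ a y z) (cong (a ⊙_) eq))))

          D-⊙ : ∀ y w → D (a ⊙ y) (a ⊙ w) ≡ D y w
          D-⊙ y w = cong₂ _-_ (cong (q *_) (M-⊙ y w)) (cong₂ _*_ (P-⊙ w) (perp-⊙ y w))

          Φ-⊙ : ∀ y w → Φ (a ⊙ y) (a ⊙ w) ≡ Φ y w
          Φ-⊙ y w = cong₂ _*_ (nonzero-⊙ w) (cong₂ _*_ (P-⊙ w) (cong₂ _*_ (D-⊙ y w) (D-⊙ y w)))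

          -- `Φ` is invariant only when y and w are scaled together. Summing over all w and
          -- substituting a w for w turns this into invariance in y alone.
          H-⊙ : ∀ y → H (a ⊙ y) ≡ H y
          H-⊙ y = cong₂ _*_ (nonzero-⊙ y) (trans (sym (∑-reindex finite³ finite³ (a ⊙_) (a⁻¹ ⊙_)
              (λ v → trans (sym (⊙-assoc a⁻¹ a v)) (trans (cong (_⊙ v) (trans (*K-comm a⁻¹ a) aa⁻¹≡1)) (⊙-identity v)))
              (λ v → trans (sym (⊙-assoc a a⁻¹ v)) (trans (cong (_⊙ v) aa⁻¹≡1) (⊙-identity v)))
              (Φ (a ⊙ y))))
            (∑-cong vectors (Φ-⊙ y)))
            where open IsCommutativeRing (DiscreteFiniteField.isCommutativeRing K) using () renaming (*-comm to *K-comm)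

        -- If v = a y then y lies on the line through v, and y determines a. So the sum counts
        -- points of E on one line.
        multiples-count : ∀ {v} → v ≢ 𝟎 → ∑ vectors (λ y → e y * ∑ scalars (λ a → ι (v ≟V a ⊙ y))) ≤ L
        multiples-count {v} v≢𝟎 = ℤ.≤-trans (∑-mono vectors (λ y → ι*-mono (E? y) (bound y))) (L-bound v v≢𝟎)
          where
          open ℤ.≤-Reasoning
          bound : ∀ y → E y → ∑ scalars (λ a → ι (v ≟V a ⊙ y)) ≤ ι (v ⨯ y ≟V 𝟎)
          bound y Ey with v ⨯ y ≟V 𝟎
          ... | yes _ = Finite.∑-unique finite (λ a → v ≟V a ⊙ y) (λ {a} {b} eq eq′ → trans (sym (coordinate a eq)) (coordinate b eq′))
            where
            open DiscreteFiniteField K using () renaming (_*_ to _*K_; isCommutativeRing to isCR)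
            open IsCommutativeRing isCR using (*-identityʳ)
            u = proj₁ (dual y (E⇒≢𝟎 Ey))
            coordinate : ∀ a → v ≡ a ⊙ y → v ∙ u ≡ a
            coordinate a refl = trans (∙-⊙ a y u) (trans (cong (a *K_) (trans (∙-comm y u) (proj₂ (dual y (E⇒≢𝟎 Ey))))) (*-identityʳ a))
          ... | no v⨯y≢𝟎 = ℤ.≤-reflexive (trans (∑-cong scalars (λ a → ι-no (v ≟V a ⊙ y)
              (λ { refl → v⨯y≢𝟎 (trans (⊙-⨯ a y y) (trans (cong (a ⊙_) (⨯-self y)) (⊙-zeroʳ a))) }))) (∑-zero scalars))

        -- Replacing each y ∈ E by its multiples a y covers every nonzero vector at most L times.
        scaling-average : (q - 1ℤ) * X ≤ L * (q * (q * q) * W)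
        scaling-average = begin
          (q - 1ℤ) * X
            ≡⟨ cong₂ _*_ (sym #nonzeroA) X≡ ⟩
          ∑ scalars nonzeroA * ∑ vectors (λ y → e y * H y)
            ≡⟨ ∑*∑ scalars vectors nonzeroA (λ y → e y * H y) ⟩
          ∑ scalars (λ a → ∑ vectors (λ y → nonzeroA a * (e y * H y)))
            ≤⟨ ∑-mono scalars (λ a → ∑-mono vectors (rescale a)) ⟩
          ∑ scalars (λ a → ∑ vectors (λ y → e y * H (a ⊙ y)))
            ≡⟨ ∑-swap scalars vectors _ ⟩
          ∑ vectors (λ y → ∑ scalars (λ a → e y * H (a ⊙ y)))
            ≡⟨ ∑-cong vectors (λ y → trans (∑-*ˡ scalars (e y) (λ a → H (a ⊙ y))) (cong (e y *_) (spread y))) ⟩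
          ∑ vectors (λ y → e y * ∑ vectors (λ v → H v * ∑ scalars (λ a → ι (v ≟V a ⊙ y))))
            ≡⟨ first-moment vectors H (λ y v → ∑ scalars (λ a → ι (v ≟V a ⊙ y))) ⟨
          ∑ vectors (λ v → H v * ∑ vectors (λ y → e y * ∑ scalars (λ a → ι (v ≟V a ⊙ y))))
            ≤⟨ ∑-mono vectors cover ⟩
          ∑ vectors (λ v → ∑ vectors (Φ v) * L)
            ≡⟨ ∑-*ʳ vectors (λ v → ∑ vectors (Φ v)) L ⟩
          ∑ vectors (λ v → ∑ vectors (Φ v)) * L
            ≤⟨ *-monoʳ 0≤L total ⟩
          q * (q * q) * W * L
            ≡⟨ ℤ.*-comm (q * (q * q) * W) L ⟩
          L * (q * (q * q) * W) ∎
          where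
          open ℤ.≤-Reasoning
          rescale : ∀ a y → nonzeroA a * (e y * H y) ≤ e y * H (a ⊙ y)
          rescale a y with a ≟A 0#
          ... | yes _  = 0≤a*b (0≤e y) (0≤H (a ⊙ y))
          ... | no a≢0 = ℤ.≤-reflexive (trans (ℤ.*-identityˡ (e y * H y)) (cong (e y *_) (sym (H-⊙ a≢0 y))))
          spread : ∀ y → ∑ scalars (λ a → H (a ⊙ y)) ≡ ∑ vectors (λ v → H v * ∑ scalars (λ a → ι (v ≟V a ⊙ y)))
          spread y = trans (∑-cong scalars (λ a → sym (Finite.∑-delta finite³ (a ⊙ y) H)))
            (trans (∑-swap scalars vectors _)
              (∑-cong vectors (λ v → trans (∑-*ʳ scalars (λ a → ι (v ≟V a ⊙ y)) (H v)) (ℤ.*-comm _ (H v)))))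
          cover : ∀ v → H v * ∑ vectors (λ y → e y * ∑ scalars (λ a → ι (v ≟V a ⊙ y))) ≤ ∑ vectors (Φ v) * L
          cover v with v ≟V 𝟎
          ... | yes _  = 0≤a*b (∑-nonneg vectors (0≤Φ v)) 0≤L
          ... | no v≢𝟎 = ℤ.≤-trans (ℤ.≤-reflexive (cong (_* ∑ vectors (λ y → e y * ∑ scalars (λ a → ι (v ≟V a ⊙ y)))) (ℤ.*-identityˡ (∑ vectors (Φ v)))))
                           (*-monoˡ (∑-nonneg vectors (0≤Φ v)) (multiples-count v≢𝟎))
          total : ∑ vectors (λ v → ∑ vectors (Φ v)) ≤ q * (q * q) * W
          total = begin
            ∑ vectors (λ v → ∑ vectors (λ w → Φ v w))
              ≡⟨ ∑-swap vectors vectors Φ ⟩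
            ∑ vectors (λ w → ∑ vectors (λ v → nonzero w * (P w * (D v w * D v w))))
              ≡⟨ ∑-cong vectors (λ w → trans (∑-*ˡ vectors (nonzero w) (λ v → P w * (D v w * D v w))) (cong (nonzero w *_) (∑-*ˡ vectors (P w) (λ v → D v w * D v w)))) ⟩
            ∑ vectors (λ w → nonzero w * (P w * ∑ vectors (λ v → D v w * D v w)))
              ≤⟨ ∑-mono vectors (λ w → ι*-mono (¬? (w ≟V 𝟎)) (λ w≢𝟎 → *-monoˡ (Plane.0≤#E w) (deviation-bound w≢𝟎))) ⟩
            ∑ vectors (λ w → nonzero w * (P w * (q * (q * q) * P w)))
              ≡⟨ ∑-cong vectors (λ w → regroup (nonzero w) (P w) (q * (q * q))) ⟩
            ∑ vectors (λ w → q * (q * q) * (nonzero w * (P w * P w)))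
              ≡⟨ ∑-*ˡ vectors (q * (q * q)) (λ w → nonzero w * (P w * P w)) ⟩
            q * (q * q) * W ∎
            where
            regroup : ∀ n p c → n * (p * (c * p)) ≡ c * (n * (p * p))
            regroup = solve-∀

        0≤X : 0ℤ ≤ X
        0≤X = ∑-nonneg vectors (λ w → 0≤a*b (ι-nonneg (¬? (w ≟V 𝟎))) (0≤a*b (Plane.0≤#E w) (∑-nonneg vectors (λ y → 0≤a*b (0≤e y) (0≤a² (D y w))))))

        -- Division of `scaling-average` by q - 1 is replaced by the inequality q ≤ 2 (q - 1), valid
        -- because a field has at least two elements.
        X-bound : X ≤ + 2 * (L * (q * q)) * W
        X-bound = *-cancelˡ 1≤q (begin
          q * X                                    ≤⟨ *-monoʳ {q} {+ 2 * (q - 1ℤ)} 0≤X (ℤ.0≤i-j⇒j≤i (subst (0ℤ ≤_) (double q) (ℤ.i≤j⇒0≤j-i 2≤q))) ⟩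
          + 2 * (q - 1ℤ) * X                       ≡⟨ ℤ.*-assoc (+ 2) (q - 1ℤ) X ⟩
          + 2 * ((q - 1ℤ) * X)                     ≤⟨ *-monoˡ {c = + 2} (+≤+ z≤n) scaling-average ⟩
          + 2 * (L * (q * (q * q) * W))            ≡⟨ regroup L q W ⟩
          q * (+ 2 * (L * (q * q)) * W)            ∎)
          where
          open ℤ.≤-Reasoning
          double : ∀ q → q - + 2 ≡ + 2 * (q - 1ℤ) - q
          double = solve-∀
          regroup : ∀ L q W → + 2 * (L * (q * (q * q) * W)) ≡ q * (+ 2 * (L * (q * q)) * W)
          regroup = solve-∀

        -- In the mean part only two of the four factors P are replaced by B; the other two are
        -- kept, so that both parts are multiples of W.
        G-bound : ∀ {B} → 0ℤ ≤ B → (∀ w → w ≢ 𝟎 → P w ≤ B) → q * q * G ≤ (+ 2 * (B * B) + + 4 * (L * (q * q))) * W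
        G-bound {B} 0≤B P≤B = begin
          q * q * G
            ≡⟨ ∑-*ˡ vectors (q * q) (λ w → nonzero w * (f w * f w)) ⟨
          ∑ vectors (λ w → q * q * (nonzero w * (f w * f w)))
            ≤⟨ ∑-mono vectors pointwise ⟩
          ∑ vectors (λ w → + 2 * (B * B) * (nonzero w * (P w * P w)) + + 2 * (nonzero w * (P w * T w)))
            ≡⟨ ∑-+ vectors _ _ ⟩
          ∑ vectors (λ w → + 2 * (B * B) * (nonzero w * (P w * P w))) + ∑ vectors (λ w → + 2 * (nonzero w * (P w * T w)))
            ≡⟨ cong₂ _+_ (∑-*ˡ vectors (+ 2 * (B * B)) (λ w → nonzero w * (P w * P w))) (∑-*ˡ vectors (+ 2) (λ w → nonzero w * (P w * T w))) ⟩
          + 2 * (B * B) * W + + 2 * X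
            ≤⟨ ℤ.+-monoʳ-≤ (+ 2 * (B * B) * W) (*-monoˡ {c = + 2} (+≤+ z≤n) X-bound) ⟩
          + 2 * (B * B) * W + + 2 * (+ 2 * (L * (q * q)) * W)
            ≡⟨ collect B L q W ⟩
          (+ 2 * (B * B) + + 4 * (L * (q * q))) * W ∎
          where
          open ℤ.≤-Reasoning
          collect : ∀ B L q W → + 2 * (B * B) * W + + 2 * (+ 2 * (L * (q * q)) * W) ≡ (+ 2 * (B * B) + + 4 * (L * (q * q))) * W
          collect = solve-∀
          expand : ∀ n b p t → n * (+ 2 * (b * b * (p * p)) + + 2 * (p * t)) ≡ + 2 * (b * b) * (n * (p * p)) + + 2 * (n * (p * t))
          expand = solve-∀
          regroup : ∀ c n f → c * (n * f) ≡ n * (c * f)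
          regroup = solve-∀
          bound : ∀ w → w ≢ 𝟎 → q * q * (f w * f w) ≤ + 2 * (B * B * (P w * P w)) + + 2 * (P w * T w)
          bound w w≢𝟎 = ℤ.≤-trans (f-square w≢𝟎) (ℤ.+-monoˡ-≤ (+ 2 * (P w * T w)) (*-monoˡ {c = + 2} (+≤+ z≤n)
            (*-monoʳ (0≤a² (P w)) (*-mono (Plane.0≤#E w) 0≤B (P≤B w w≢𝟎) (P≤B w w≢𝟎)))))
          pointwise : ∀ w → q * q * (nonzero w * (f w * f w)) ≤ + 2 * (B * B) * (nonzero w * (P w * P w)) + + 2 * (nonzero w * (P w * T w))
          pointwise w = begin
            q * q * (nonzero w * (f w * f w))                                       ≡⟨ regroup (q * q) (nonzero w) (f w * f w) ⟩
            nonzero w * (q * q * (f w * f w))                                       ≤⟨ ι*-mono (¬? (w ≟V 𝟎)) (bound w) ⟩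
            nonzero w * (+ 2 * (B * B * (P w * P w)) + + 2 * (P w * T w))           ≡⟨ expand (nonzero w) B (P w) (T w) ⟩
            + 2 * (B * B) * (nonzero w * (P w * P w)) + + 2 * (nonzero w * (P w * T w)) ∎

      -- Since f Q vanishes identically, the deviation N - q Q has its full size N wherever f is
      -- nonzero. Its correlation with f is thus exactly N F, which the variance of Q limits.
      missing-volume : ∀ {t} → t ≢ 0# → (∀ x y z → E x → E y → E z → x ∙ (y ⨯ z) ≢ t) →
        N * F * (N * F) ≤ G * (q * q * (q * q) * N)
      missing-volume {t} t≢0 missing = begin
        N * F * (N * F)
          ≡⟨ cong₂ _*_ correlation correlation ⟩
        ∑ vectors (λ w → g w * d w) * ∑ vectors (λ w → g w * d w)
          ≤⟨ cauchy-schwarz vectors g d ⟩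
        ∑ vectors (λ w → g w * g w) * ∑ vectors (λ w → d w * d w)
          ≡⟨ cong (_* ∑ vectors (λ w → d w * d w)) (∑-cong vectors (λ w → trans (regroup (nonzero w) (f w)) (cong (_* (f w * f w)) (ι-idem (¬? (w ≟V 𝟎)))))) ⟩
        G * ∑ vectors (λ w → d w * d w)
          ≤⟨ *-monoˡ 0≤G (variance-Q t≢0) ⟩
        G * (q * q * (q * q) * N) ∎
        where
        open ℤ.≤-Reasoning
        g d : V → ℤ
        g w = nonzero w * f w
        d w = N * 1ℤ - q * Q t w
        regroup : ∀ a b → a * b * (a * b) ≡ a * a * (b * b)
        regroup = solve-∀
        0≤G : 0ℤ ≤ G
        0≤G = ∑-nonneg vectors (λ w → 0≤a*b (ι-nonneg (¬? (w ≟V 𝟎))) (0≤a² (f w)))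
        Q-vanishes : ∀ y z → E y → E z → Q t (y ⨯ z) ≡ 0ℤ
        Q-vanishes y z Ey Ez = trans (S-const λ x Ex → ι-no (((y ⨯ z) ∙ x) ≟A t) (λ eq → missing x y z Ex Ey Ez (trans (∙-comm x (y ⨯ z)) eq))) (ℤ.*-zeroʳ N)
        M-orthogonal : ∀ y → E y → ∀ w → M y w * Q t w ≡ 0ℤ
        M-orthogonal y Ey w = trans (sym (∑-*ʳ vectors (λ z → e z * ι (y ⨯ z ≟V w)) (Q t w)))
          (trans (∑-cong vectors vanish) (∑-zero vectors))
          where
          vanish : ∀ z → e z * ι (y ⨯ z ≟V w) * Q t w ≡ 0ℤ
          vanish z with E? z | y ⨯ z ≟V w
          ... | no  _  | _        = refl
          ... | yes _  | no  _    = refl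
          ... | yes Ez | yes refl = trans (ℤ.*-identityˡ _) (Q-vanishes y z Ey Ez)
        f-orthogonal : ∀ w → f w * Q t w ≡ 0ℤ
        f-orthogonal w = trans (sym (∑-*ʳ vectors (λ y → e y * M y w) (Q t w)))
          (trans (∑-cong vectors (λ y → ℤ.*-assoc (e y) (M y w) (Q t w)))
            (trans (S-const (λ y Ey → M-orthogonal y Ey w)) (ℤ.*-zeroʳ N)))
        expand : ∀ n f N q Q → n * f * (N * 1ℤ - q * Q) ≡ N * (n * f) + - (q * n) * (f * Q)
        expand = solve-∀
        correlation : N * F ≡ ∑ vectors (λ w → g w * d w)
        correlation = trans (sym (∑-*ˡ vectors N g)) (∑-cong vectors (λ w → sym (trans (expand (nonzero w) (f w) N q (Q t w))
          (trans (cong (λ c → N * g w + - (q * nonzero w) * c) (f-orthogonal w))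
            (trans (cong (_+_ (N * g w)) (ℤ.*-zeroʳ (- (q * nonzero w)))) (ℤ.+-identityʳ (N * g w)))))))

open IncidenceMoments

-- Integer cube roots and the final numerical contradiction

module NaturalInequalities where
  open import Data.Nat.Base using (_+_; _*_; _^_; _≤_)
  open import Data.Nat.Properties
  open import Data.Nat.Solver using (module +-*-Solver)
  open +-*-Solver using (solve; _:=_; _:+_; _:*_; _:^_; con)
  open ≡ using (refl; sym; trans; cong; cong₂; subst)

  ^-cancelʳ-≤ : ∀ n .{{_ : NonZero n}} {a b} → a ^ n ≤ b ^ n → a ≤ b
  ^-cancelʳ-≤ n {a} {b} aⁿ≤bⁿ with a ≤? b
  ... | yes a≤b = a≤b
  ... | no  a≰b = contradiction aⁿ≤bⁿ (<⇒≱ (^-monoˡ-< n (≰⇒> a≰b)))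

  ^-distribʳ-* : ∀ n a b → (a * b) ^ n ≡ a ^ n * b ^ n
  ^-distribʳ-* zero    a b = refl
  ^-distribʳ-* (suc n) a b = trans (cong (a * b *_) (^-distribʳ-* n a b)) (interchange a b (a ^ n) (b ^ n))
    where
    interchange : ∀ a b c d → a * b * (c * d) ≡ a * c * (b * d)
    interchange = solve 4 (λ a b c d → a :* b :* (c :* d) := a :* c :* (b :* d)) refl

  -- An integer substitute for the cube root of |E|, exact up to a factor 2. In the induction m is
  -- kept as long as its cube suffices, and otherwise increased by one.
  cube-approximation : ∀ n → 1 ≤ n → ∃ λ m → 1 ≤ m × n ≤ m ^ 3 × m ^ 3 ≤ 8 * n
  cube-approximation (suc zero)    _ = 1 , s≤s z≤n , s≤s z≤n , s≤s z≤n
  cube-approximation (suc (suc n)) _ with cube-approximation (suc n) (s≤s z≤n)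
  ... | m , 1≤m , n≤m³ , m³≤8n with suc (suc n) ≤? m ^ 3
  ...   | yes n+1≤m³ = m , 1≤m , n+1≤m³ , ≤-trans m³≤8n (*-monoʳ-≤ 8 (n≤1+n (suc n)))
  ...   | no  n+1≰m³ = suc m , s≤s z≤n ,
            ≤-trans (s≤s n≤m³) (^-monoˡ-< 3 (n<1+n m)) ,
            (begin
              -- The factor 8 comes from m + 1 ≤ 2 m.
              suc m ^ 3      ≤⟨ ^-monoˡ-≤ 3 (+-monoˡ-≤ m 1≤m) ⟩
              (m + m) ^ 3    ≡⟨ double m ⟩
              8 * m ^ 3      ≤⟨ *-monoʳ-≤ 8 (≤-pred (≰⇒> n+1≰m³)) ⟩
              8 * suc n      ≤⟨ *-monoʳ-≤ 8 (n≤1+n (suc n)) ⟩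
              8 * suc (suc n) ∎)
    where
    open ≤-Reasoning
    double : ∀ m → (m + m) ^ 3 ≡ 8 * m ^ 3
    double = solve 1 (λ m → (m :+ m) :^ 3 := con 8 :* m :^ 3) refl

  1≤^ : ∀ {a} n → 1 ≤ a → 1 ≤ a ^ n
  1≤^ {a} n 1≤a = subst (_≤ a ^ n) (^-zeroˡ n) (^-monoˡ-≤ n 1≤a)

  -- Here m is |E|^(1/3) up to a constant, and k m and k m² bound E on lines and planes through the origin.
  module _ {c k m q N : ℕ} (1≤k : 1 ≤ k) (1≤q : 1 ≤ q) (1≤m : 1 ≤ m) (16k≡c : 16 * k ≡ c)
           (m³≤16N : m ^ 3 ≤ 16 * N) (c⁸q⁵≤m⁸ : c ^ 8 * q ^ 5 ≤ m ^ 8) where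
    open ≤-Reasoning

    private
      instance
        m≢0 : NonZero m
        m≢0 = >-nonZero 1≤m
        q≢0 : NonZero q
        q≢0 = >-nonZero 1≤q

    c≥16 : 16 ≤ c
    c≥16 = subst (16 ≤_) 16k≡c (*-monoʳ-≤ 16 1≤k)

    c²q≤m² : c ^ 2 * q ≤ m ^ 2
    c²q≤m² = ^-cancelʳ-≤ 4 (begin
      (c ^ 2 * q) ^ 4    ≡⟨ left c q ⟩
      c ^ 8 * q ^ 4      ≤⟨ *-monoʳ-≤ (c ^ 8) (^-monoʳ-≤ q {4} {5} (s≤s (s≤s (s≤s (s≤s z≤n))))) ⟩
      c ^ 8 * q ^ 5      ≤⟨ c⁸q⁵≤m⁸ ⟩
      m ^ 8              ≡⟨ right m ⟩
      (m ^ 2) ^ 4        ∎)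
      where
      left : ∀ c q → (c ^ 2 * q) ^ 4 ≡ c ^ 8 * q ^ 4
      left = solve 2 (λ c q → (c :^ 2 :* q) :^ 4 := c :^ 8 :* q :^ 4) refl
      right : ∀ m → m ^ 8 ≡ (m ^ 2) ^ 4
      right = solve 1 (λ m → m :^ 8 := (m :^ 2) :^ 4) refl

    -- Since m³ has the size of |E|, this is the threshold q^(9/5) of the mean part. It follows from
    -- the threshold q^(15/8) because 24 ≤ 25: take fifth powers, drop one q, take eighth roots.
    c⁵q³≤m⁵ : c ^ 5 * q ^ 3 ≤ m ^ 5
    c⁵q³≤m⁵ = ^-cancelʳ-≤ 8 (begin
      (c ^ 5 * q ^ 3) ^ 8          ≡⟨ trans (^-distribʳ-* 8 (c ^ 5) (q ^ 3)) (cong₂ _*_ (^-*-assoc c 5 8) (^-*-assoc q 3 8)) ⟩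
      c ^ 40 * q ^ 24              ≤⟨ *-monoʳ-≤ (c ^ 40) (^-monoʳ-≤ q (n≤1+n 24)) ⟩
      c ^ 40 * q ^ 25              ≡⟨ trans (^-distribʳ-* 5 (c ^ 8) (q ^ 5)) (cong₂ _*_ (^-*-assoc c 8 5) (^-*-assoc q 5 5)) ⟨
      (c ^ 8 * q ^ 5) ^ 5          ≤⟨ ^-monoˡ-≤ 5 c⁸q⁵≤m⁸ ⟩
      (m ^ 8) ^ 5                  ≡⟨ trans (^-*-assoc m 8 5) (sym (^-*-assoc m 5 8)) ⟩
      (m ^ 5) ^ 8                  ∎)

    qc≤m² : q * c ≤ m ^ 2
    qc≤m² = begin
      q * c          ≡⟨ *-comm q c ⟩
      c * q          ≤⟨ *-monoˡ-≤ q (m≤m*n c c {{>-nonZero (≤-trans (s≤s z≤n) c≥16)}}) ⟩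
      c * c * q      ≡⟨ cong (λ x → c * x * q) (*-identityʳ c) ⟨
      c ^ 2 * q      ≤⟨ c²q≤m² ⟩
      m ^ 2          ∎

    -- A line holds at most a fraction 1/q of E. This makes the parallel pairs harmless, both in W
    -- and in N² ≤ F + N L.
    qkm≤N : q * (k * m) ≤ N
    qkm≤N = *-cancelˡ-≤ 16 (begin
      16 * (q * (k * m))  ≡⟨ regroup q k m ⟩
      q * (16 * k) * m    ≡⟨ cong (λ x → q * x * m) 16k≡c ⟩
      q * c * m           ≤⟨ *-monoˡ-≤ m qc≤m² ⟩
      m ^ 2 * m           ≡⟨ cube m ⟩
      m ^ 3               ≤⟨ m³≤16N ⟩
      16 * N              ∎)
      where
      regroup : ∀ q k m → 16 * (q * (k * m)) ≡ q * (16 * k) * m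
      regroup = solve 3 (λ q k m → con 16 :* (q :* (k :* m)) := q :* (con 16 :* k) :* m) refl
      cube : ∀ m → m ^ 2 * m ≡ m ^ 3
      cube = solve 1 (λ m → m :^ 2 :* m := m :^ 3) refl

    2km≤N : 2 ≤ q → 2 * (k * m) ≤ N
    2km≤N 2≤q = ≤-trans (*-monoˡ-≤ (k * m) 2≤q) qkm≤N

    -- Eliminating F, G and W leaves N³ ≤ 8 q³ U with U = 2 k² m⁴ + 4 k m q². In terms of m this
    -- compares m⁹ with c² m⁴ q³ and c m q⁵. The hypothesis on q bounds each of these with powers of
    -- c to spare, and c ≥ 16 lets them absorb the numerical constants.
    numeric-contradiction : ∀ {F G W} → 2 ≤ q →
      N * F * (N * F) ≤ G * (q * q * (q * q) * N) →
      q * q * G ≤ (2 * (k * m ^ 2 * (k * m ^ 2)) + 4 * (k * m * (q * q))) * W →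
      W ≤ N * (N * q + q * q * (k * m)) →
      N * N ≤ F + N * (k * m) → ⊥
    numeric-contradiction {F} {G} {W} 2≤q correlation G-bound W-bound F-bound =
      <⇒≱ (*-monoˡ-< (m ^ 9) {{>-nonZero (1≤^ 9 1≤m)}} {2} {16} (s≤s (s≤s (s≤s z≤n)))) (begin
        16 * m ^ 9                                                      ≤⟨ *-monoʳ-≤ 16 m⁹-bound ⟩
        16 * (256 * (c ^ 2 * m ^ 4 * q ^ 3) + 8192 * (c * m * q ^ 5))   ≡⟨ distribute (c ^ 2 * m ^ 4 * q ^ 3) (c * m * q ^ 5) ⟩
        4096 * (c ^ 2 * m ^ 4 * q ^ 3) + 131072 * (c * m * q ^ 5)       ≤⟨ +-mono-≤ first second ⟩
        m ^ 9 + m ^ 9                                                   ≡⟨ cong (_+_ (m ^ 9)) (+-identityʳ (m ^ 9)) ⟨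
        2 * m ^ 9                                                       ∎)
      where
      instance
        N≢0 : NonZero N
        N≢0 = >-nonZero (≤-trans (s≤s z≤n) (≤-trans (*-mono-≤ {2} (≤-refl {2}) (*-mono-≤ 1≤k 1≤m)) (2km≤N 2≤q)))

      N²≤2F : N * N ≤ 2 * F
      N²≤2F = +-cancelʳ-≤ (N * N) (N * N) (2 * F) (begin
        N * N + N * N                ≡⟨ double (N * N) ⟩
        2 * (N * N)                  ≤⟨ *-monoʳ-≤ 2 F-bound ⟩
        2 * (F + N * (k * m))        ≡⟨ expand F N (k * m) ⟩
        2 * F + N * (2 * (k * m))    ≤⟨ +-monoʳ-≤ (2 * F) (*-monoʳ-≤ N (2km≤N 2≤q)) ⟩
        2 * F + N * N                ∎)
        where
        double : ∀ a → a + a ≡ 2 * a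
        double = solve 1 (λ a → a :+ a := con 2 :* a) refl
        expand : ∀ F N a → 2 * (F + N * a) ≡ 2 * F + N * (2 * a)
        expand = solve 3 (λ F N a → con 2 :* (F :+ N :* a) := con 2 :* F :+ N :* (con 2 :* a)) refl

      W≤2qN² : W ≤ 2 * q * (N * N)
      W≤2qN² = begin
        W                                 ≤⟨ W-bound ⟩
        N * (N * q + q * q * (k * m))     ≡⟨ cong (λ x → N * (N * q + x)) (*-assoc q q (k * m)) ⟩
        N * (N * q + q * (q * (k * m)))   ≤⟨ *-monoʳ-≤ N (+-monoʳ-≤ (N * q) (*-monoʳ-≤ q qkm≤N)) ⟩
        N * (N * q + q * N)               ≡⟨ collect N q ⟩
        2 * q * (N * N)                   ∎
        where
        collect : ∀ N q → N * (N * q + q * N) ≡ 2 * q * (N * N)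
        collect = solve 2 (λ N q → N :* (N :* q :+ q :* N) := con 2 :* q :* (N :* N)) refl

      U = 2 * (k * m ^ 2 * (k * m ^ 2)) + 4 * (k * m * (q * q))

      N³-bound : N ^ 3 ≤ 8 * q ^ 3 * U
      -- The multiplier q² N³ supplies the q² that `G-bound` carries and two factors N³, each turned
      -- into 2 N F to meet the left side of `correlation`.
      N³-bound = *-cancelˡ-≤ (q ^ 2 * N ^ 3) {{m*n≢0 (q ^ 2) (N ^ 3) {{m^n≢0 q 2}} {{m^n≢0 N 3}}}} (begin
        q ^ 2 * N ^ 3 * N ^ 3                           ≡⟨ regroup₁ q N ⟩
        q * q * (N * (N * N) * (N * (N * N)))           ≤⟨ *-monoʳ-≤ (q * q) (*-mono-≤ (*-monoʳ-≤ N N²≤2F) (*-monoʳ-≤ N N²≤2F)) ⟩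
        q * q * (N * (2 * F) * (N * (2 * F)))           ≡⟨ regroup₂ q N F ⟩
        4 * (q * q) * (N * F * (N * F))                 ≤⟨ *-monoʳ-≤ (4 * (q * q)) correlation ⟩
        4 * (q * q) * (G * (q * q * (q * q) * N))       ≡⟨ regroup₃ q G N ⟩
        4 * q ^ 4 * N * (q * q * G)                     ≤⟨ *-monoʳ-≤ (4 * q ^ 4 * N) (≤-trans G-bound (*-monoʳ-≤ U W≤2qN²)) ⟩
        4 * q ^ 4 * N * (U * (2 * q * (N * N)))         ≡⟨ regroup₄ q N U ⟩
        q ^ 2 * N ^ 3 * (8 * q ^ 3 * U)                 ∎)
        where
        regroup₁ : ∀ q N → q ^ 2 * N ^ 3 * N ^ 3 ≡ q * q * (N * (N * N) * (N * (N * N)))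
        regroup₁ = solve 2 (λ q N → q :^ 2 :* N :^ 3 :* N :^ 3 := q :* q :* (N :* (N :* N) :* (N :* (N :* N)))) refl
        regroup₂ : ∀ q N F → q * q * (N * (2 * F) * (N * (2 * F))) ≡ 4 * (q * q) * (N * F * (N * F))
        regroup₂ = solve 3 (λ q N F → q :* q :* (N :* (con 2 :* F) :* (N :* (con 2 :* F))) := con 4 :* (q :* q) :* (N :* F :* (N :* F))) refl
        regroup₃ : ∀ q G N → 4 * (q * q) * (G * (q * q * (q * q) * N)) ≡ 4 * q ^ 4 * N * (q * q * G)
        regroup₃ = solve 3 (λ q G N → con 4 :* (q :* q) :* (G :* (q :* q :* (q :* q) :* N)) := con 4 :* q :^ 4 :* N :* (q :* q :* G)) refl
        regroup₄ : ∀ q N U → 4 * q ^ 4 * N * (U * (2 * q * (N * N))) ≡ q ^ 2 * N ^ 3 * (8 * q ^ 3 * U)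
        regroup₄ = solve 3 (λ q N U → con 4 :* q :^ 4 :* N :* (U :* (con 2 :* q :* (N :* N))) := q :^ 2 :* N :^ 3 :* (con 8 :* q :^ 3 :* U)) refl

      m⁹-bound : m ^ 9 ≤ 256 * (c ^ 2 * m ^ 4 * q ^ 3) + 8192 * (c * m * q ^ 5)
      m⁹-bound = begin
        m ^ 9                          ≡⟨ ^-*-assoc m 3 3 ⟨
        (m ^ 3) ^ 3                    ≤⟨ ^-monoˡ-≤ 3 m³≤16N ⟩
        (16 * N) ^ 3                   ≡⟨ ^-distribʳ-* 3 16 N ⟩
        4096 * N ^ 3                   ≤⟨ *-monoʳ-≤ 4096 N³-bound ⟩
        -- The coefficients 65536 = 256 · 16² and 131072 = 8192 · 16 are split so that k occurs only
        -- as 16 k = c.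
        4096 * (8 * q ^ 3 * U)         ≡⟨ regroup k m q ⟩
        256 * ((16 * k) ^ 2 * m ^ 4 * q ^ 3) + 8192 * (16 * k * m * q ^ 5)  ≡⟨ cong (λ x → 256 * (x ^ 2 * m ^ 4 * q ^ 3) + 8192 * (x * m * q ^ 5)) 16k≡c ⟩
        256 * (c ^ 2 * m ^ 4 * q ^ 3) + 8192 * (c * m * q ^ 5) ∎
        where
        regroup : ∀ k m q → 4096 * (8 * q ^ 3 * (2 * (k * m ^ 2 * (k * m ^ 2)) + 4 * (k * m * (q * q)))) ≡
          256 * ((16 * k) ^ 2 * m ^ 4 * q ^ 3) + 8192 * (16 * k * m * q ^ 5)
        regroup = solve 3 (λ k m q → con 4096 :* (con 8 :* q :^ 3 :* (con 2 :* (k :* m :^ 2 :* (k :* m :^ 2)) :+ con 4 :* (k :* m :* (q :* q)))) := con 256 :* ((con 16 :* k) :^ 2 :* m :^ 4 :* q :^ 3) :+ con 8192 :* (con 16 :* k :* m :* q :^ 5)) refl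

      distribute : ∀ a b → 16 * (256 * a + 8192 * b) ≡ 4096 * a + 131072 * b
      distribute = solve 2 (λ a b → con 16 :* (con 256 :* a :+ con 8192 :* b) := con 4096 :* a :+ con 131072 :* b) refl

      first : 4096 * (c ^ 2 * m ^ 4 * q ^ 3) ≤ m ^ 9
      first = begin
        -- 4096 = 16³ ≤ c³ completes c² to the c⁵ of `c⁵q³≤m⁵`.
        4096 * (c ^ 2 * m ^ 4 * q ^ 3)     ≤⟨ *-monoˡ-≤ (c ^ 2 * m ^ 4 * q ^ 3) (^-monoˡ-≤ 3 c≥16) ⟩
        c ^ 3 * (c ^ 2 * m ^ 4 * q ^ 3)    ≡⟨ regroup c m q ⟩
        m ^ 4 * (c ^ 5 * q ^ 3)            ≤⟨ *-monoʳ-≤ (m ^ 4) c⁵q³≤m⁵ ⟩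
        m ^ 4 * m ^ 5                      ≡⟨ ^-distribˡ-+-* m 4 5 ⟨
        m ^ 9                              ∎
        where
        regroup : ∀ c m q → c ^ 3 * (c ^ 2 * m ^ 4 * q ^ 3) ≡ m ^ 4 * (c ^ 5 * q ^ 3)
        regroup = solve 3 (λ c m q → c :^ 3 :* (c :^ 2 :* m :^ 4 :* q :^ 3) := m :^ 4 :* (c :^ 5 :* q :^ 3)) refl

      second : 131072 * (c * m * q ^ 5) ≤ m ^ 9
      second = begin
        -- 131072 = 2¹⁷ lies below 16⁷ = 2²⁸, and c⁷ completes c to the c⁸ of the hypothesis.
        131072 * (c * m * q ^ 5)           ≤⟨ *-monoˡ-≤ (c * m * q ^ 5) (≤-trans (≤ᵇ⇒≤ 131072 (16 ^ 7) _) (^-monoˡ-≤ 7 c≥16)) ⟩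
        c ^ 7 * (c * m * q ^ 5)            ≡⟨ regroup c m q ⟩
        m * (c ^ 8 * q ^ 5)                ≤⟨ *-monoʳ-≤ m c⁸q⁵≤m⁸ ⟩
        m ^ 9                              ∎
        where
        regroup : ∀ c m q → c ^ 7 * (c * m * q ^ 5) ≡ m * (c ^ 8 * q ^ 5)
        regroup = solve 3 (λ c m q → c :^ 7 :* (c :* m :* q :^ 5) := m :* (c :^ 8 :* q :^ 5)) refl

open NaturalInequalities

open import Defs
open import Data.Rational.Base using (ℚ; 0ℚ; mkℚ; _<_; _≤_; _*_; _/_; *≤*; *<*; NonNegative; nonNegative)
import Data.Rational.Properties as ℚ

-- From rational to natural number inequalities

module RationalCasts where
  open ≡ using (refl; sym; trans; cong; cong₂; subst; subst₂)

  -- `fromℕ` divides by 1 and normalises through a gcd; the explicit reduced fraction lets the order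
  -- be read off from the numerators.
  fromℕ-mkℚ : ∀ n → fromℕ n ≡ mkℚ (+ n) 0 (Coprimality.sym (Coprimality.1-coprimeTo n))
  fromℕ-mkℚ n = ℚ.normalize-coprime (Coprimality.sym (Coprimality.1-coprimeTo n))

  fromℕ-* : ∀ m n → fromℕ m * fromℕ n ≡ fromℕ (m ℕ.* n)
  fromℕ-* m n = trans (cong₂ _*_ (fromℕ-mkℚ m) (fromℕ-mkℚ n)) (cong (_/ 1) (sym (ℤ.pos-* m n)))

  fromℕ-^ : ∀ m n → fromℕ m ^ n ≡ fromℕ (m ℕ.^ n)
  fromℕ-^ m zero    = refl
  fromℕ-^ m (suc n) = trans (cong (fromℕ m *_) (fromℕ-^ m n)) (fromℕ-* m (m ℕ.^ n))

  fromℕ-cancel-≤ : ∀ {m n} → fromℕ m ≤ fromℕ n → m ℕ.≤ n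
  fromℕ-cancel-≤ {m} {n} m≤n with subst₂ _≤_ (fromℕ-mkℚ m) (fromℕ-mkℚ n) m≤n
  ... | *≤* le = ℤ.drop‿+≤+ (subst₂ ℤ._≤_ (ℤ.*-identityʳ (+ m)) (ℤ.*-identityʳ (+ n)) le)

  fromℕ-nonNegative : ∀ n → NonNegative (fromℕ n)
  fromℕ-nonNegative n = subst NonNegative (sym (fromℕ-mkℚ n)) _

  0<fromℕ : ∀ {n} → 1 ℕ.≤ n → 0ℚ < fromℕ n
  0<fromℕ {suc n} _ = subst (0ℚ <_) (sym (fromℕ-mkℚ (suc n))) (*<* (ℤ.+<+ (s≤s z≤n)))

  ≤-fromℕ : ∀ p → 0ℚ < p → ∃ λ k → 1 ℕ.≤ k × p ≤ fromℕ k
  ≤-fromℕ p@(mkℚ (+ zero)   d c) (*<* (ℤ.+<+ ()))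
  ≤-fromℕ p@(mkℚ ℤ.-[1+ n ] d c) (*<* ())
  -- The numerator is an upper bound, because the denominator is at least 1.
  ≤-fromℕ p@(mkℚ (+ suc n)  d c) _ = suc n , s≤s z≤n ,
    subst (p ≤_) (sym (fromℕ-mkℚ (suc n))) (*≤* (+≤+ (ℕ.*-monoʳ-≤ (suc n) (s≤s z≤n))))

  -- Nonnegativity of the power is carried through the induction because monotonicity of
  -- multiplication asks for it.
  ^-mono-≤ : ∀ {p r} → 0ℚ ≤ p → p ≤ r → ∀ n → 0ℚ ≤ p ^ n × p ^ n ≤ r ^ n
  ^-mono-≤ {p} {r} 0≤p p≤r zero    = *≤* (+≤+ z≤n) , ℚ.≤-refl
  ^-mono-≤ {p} {r} 0≤p p≤r (suc n) with ^-mono-≤ 0≤p p≤r n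
  ... | 0≤pⁿ , pⁿ≤rⁿ =
    subst (_≤ p * p ^ n) (ℚ.*-zeroʳ p) (ℚ.*-monoˡ-≤-nonNeg p {{p≥0}} 0≤pⁿ) ,
    ℚ.≤-trans (ℚ.*-monoˡ-≤-nonNeg p {{p≥0}} pⁿ≤rⁿ) (ℚ.*-monoʳ-≤-nonNeg (r ^ n) {{rⁿ≥0}} p≤r)
    where
    p≥0 = nonNegative 0≤p
    rⁿ≥0 = nonNegative (ℚ.≤-trans 0≤pⁿ pⁿ≤rⁿ)

  cube-bound : ∀ {K k} → 0ℚ ≤ K → K ≤ fromℕ k → ∀ a b n → fromℕ a ^ 3 ≤ K ^ 3 * fromℕ b ^ n → a ℕ.^ 3 ℕ.≤ k ℕ.^ 3 ℕ.* b ℕ.^ n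
  cube-bound {K} {k} 0≤K K≤k a b n a³≤ = fromℕ-cancel-≤ (subst₂ _≤_ (fromℕ-^ a 3)
    (trans (cong₂ _*_ (fromℕ-^ k 3) (fromℕ-^ b n)) (fromℕ-* (k ℕ.^ 3) (b ℕ.^ n)))
    (ℚ.≤-trans a³≤ (ℚ.*-monoʳ-≤-nonNeg (fromℕ b ^ n) {{bⁿ≥0}} (proj₂ (^-mono-≤ 0≤K K≤k 3)))))
    where
    bⁿ≥0 = subst NonNegative (sym (fromℕ-^ b n)) (fromℕ-nonNegative (b ℕ.^ n))

open RationalCasts

-- Enumerating indices and triples of indices

private
  variable
    X Y : Set

+length-filter-map : ∀ {a} {Z : Set a} (g : X → Z) (xs : List X) {p} {P : Pred Z p} (P? : Decidable P) →
  + length (filter P? (List.map g xs)) ≡ ∑ xs (λ x → ι (P? (g x)))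
+length-filter-map g []       P? = ≡.refl
+length-filter-map g (x ∷ xs) P? with P? (g x)
... | yes _ = ≡.cong (ℤ._+_ 1ℤ) (+length-filter-map g xs P?)
... | no  _ = ≡.trans (+length-filter-map g xs P?) (≡.sym (ℤ.+-identityˡ _))

∑-mapped : (g : X → Y) (xs : List X) (f : Y → ℤ) → ∑ (List.map g xs) f ≡ ∑ xs (λ x → f (g x))
∑-mapped g []       f = ≡.refl
∑-mapped g (x ∷ xs) f = ≡.cong (ℤ._+_ (f (g x))) (∑-mapped g xs f)

∑-length : (xs : List X) → ∑ xs (λ _ → 1ℤ) ≡ + length xs
∑-length []       = ≡.refl
∑-length (x ∷ xs) = ≡.cong (ℤ._+_ 1ℤ) (∑-length xs)

∑-allFin : ∀ n → ∑ (allFin n) (λ _ → 1ℤ) ≡ + n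
∑-allFin n = ≡.trans (∑-length (allFin n)) (≡.cong +_ (List.length-tabulate {n = n} (λ i → i)))

Fin-once : ∀ {n} (j : Fin n) → ∑ (allFin n) (λ i → ι (i Fin.≟ j)) ≡ 1ℤ
Fin-once {ℕ.suc n} j = ≡.trans (≡.cong (ℤ._+_ (ι (zero Fin.≟ j))) (≡.trans (≡.cong (λ is → ∑ is (λ i → ι (i Fin.≟ j))) (≡.sym (List.map-tabulate (λ i → i) suc)))
    (∑-mapped suc (allFin n) (λ i → ι (i Fin.≟ j))))) (split j)
  where
  split : ∀ j → ι (zero Fin.≟ j) ℤ.+ ∑ (allFin n) (λ i → ι (suc i Fin.≟ j)) ≡ 1ℤ
  split zero    = ≡.trans (≡.cong (ℤ._+_ 1ℤ) (≡.trans (∑-cong (allFin n) (λ i → ι-no (suc i Fin.≟ zero) (λ ()))) (∑-zero (allFin n)))) ≡.refl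
  split (suc j) = ≡.trans (ℤ.+-identityˡ _) (≡.trans (∑-cong (allFin n) (λ i → ι-cong (suc i Fin.≟ suc j) (i Fin.≟ j) Fin.suc-injective (≡.cong suc))) (Fin-once j))

Fin-finite : ∀ n → Finite (Fin n)
Fin-finite n = record { _≟_ = Fin._≟_ ; elements = allFin n ; once = Fin-once }

triple-≟ : DecidableEquality X → DecidableEquality (Triple X)
triple-≟ _≟_ ⟨ a , b , c ⟩ ⟨ x , y , z ⟩ =
  map′ (λ { (≡.refl , ≡.refl , ≡.refl) → ≡.refl }) (λ { ≡.refl → ≡.refl , ≡.refl , ≡.refl }) (a ≟ x ×-dec b ≟ y ×-dec c ≟ z)

-- The same `finToFun` as in `points`, so that sums over triples and cardinalities of subsets run
-- through the vectors in the same order.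
decode : ∀ n → Fin (n ℕ.^ 3) → Triple (Fin n)
decode n i = ⟨ finToFun {n} {3} i zero , finToFun {n} {3} i (suc zero) , finToFun {n} {3} i (suc (suc zero)) ⟩

encode : ∀ n → Triple (Fin n) → Fin (n ℕ.^ 3)
encode n ⟨ a , b , c ⟩ = funToFin {3} {n} (a VecF.∷ b VecF.∷ c VecF.∷ VecF.[])

decode-encode : ∀ n (t : Triple (Fin n)) → decode n (encode n t) ≡ t
decode-encode n ⟨ a , b , c ⟩ = triple-≡ (inverse zero) (inverse (suc zero)) (inverse (suc (suc zero)))
  where
  inverse = Fin.finToFun-funToFin {3} {n} (a VecF.∷ b VecF.∷ c VecF.∷ VecF.[])

encode-decode : ∀ n (i : Fin (n ℕ.^ 3)) → encode n (decode n i) ≡ i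
encode-decode n i = Fin.funToFin-finToFin {3} {n} i

Triple-finite : ∀ n → Finite (Triple (Fin n))
Triple-finite n = record
  { _≟_      = triple-≟ Fin._≟_
  ; elements = List.map (decode n) (allFin (n ℕ.^ 3))
  ; once     = λ t → ≡.trans (∑-mapped (decode n) (allFin (n ℕ.^ 3)) (λ x → ι (triple-≟ Fin._≟_ x t)))
      (≡.trans (∑-cong (allFin (n ℕ.^ 3)) (λ i → ι-cong (triple-≟ Fin._≟_ (decode n i) t) (i Fin.≟ encode n t)
          (λ eq → ≡.trans (≡.sym (encode-decode n i)) (≡.cong (encode n) eq))
          (λ eq → ≡.trans (≡.cong (decode n) eq) (decode-encode n t))))
        (Fin-once (encode n t)))
  }

-- The field transported to its indices, with its lines and planes

module Discrete {c ℓ} (F : FiniteField c ℓ) where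
  open FiniteField F
  open Inverse enumeration using (to; from; from-cong; strictlyInverseˡ; strictlyInverseʳ)

  private
    indexRing : RawRing _ _
    indexRing = record
      { Carrier = Fin q
      ; _≈_     = _≡_
      ; _+_     = λ i j → from (to i +F to j)
      ; _*_     = λ i j → from (to i *F to j)
      ; -_      = λ i → from (-F to i)
      ; 0#      = from 0#
      ; 1#      = from 1#
      }

  to-injective : ∀ {i j} → to i ≈ to j → i ≡ j
  to-injective {i} {j} eq = ≡.trans (≡.sym (strictlyInverseʳ i)) (≡.trans (from-cong eq) (strictlyInverseʳ j))

  -- The index operations are conjugates by the enumeration, so each homomorphism law says that `to`
  -- undoes `from`. Injectivity then pulls the ring axioms back to propositional equality.
  to-isRingMonomorphism : IsRingMonomorphism indexRing (CommutativeRing.rawRing commutativeRing) to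
  to-isRingMonomorphism = record
    { isRingHomomorphism = record
      { isSemiringHomomorphism = record
        { isNearSemiringHomomorphism = record
          { +-isMonoidHomomorphism = record
            { isMagmaHomomorphism = record
              { isRelHomomorphism = record { cong = Inverse.to-cong enumeration }
              ; homo = λ _ _ → strictlyInverseˡ _
              }
            ; ε-homo = strictlyInverseˡ _
            }
          ; *-homo = λ _ _ → strictlyInverseˡ _
          }
        ; 1#-homo = strictlyInverseˡ _
        }
      ; -‿homo = λ _ → strictlyInverseˡ _
      }
    ; injective = to-injective
    }

  to-nonzero : ∀ {i} → i ≢ from 0# → ¬ (to i ≈ 0#)
  to-nonzero {i} i≢0 eq = i≢0 (≡.trans (≡.sym (strictlyInverseʳ i)) (from-cong eq))

  K : DiscreteFiniteField
  K = record
    { Carrier           = Fin q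
    ; _+_               = RawRing._+_ indexRing
    ; _*_               = RawRing._*_ indexRing
    ; -_                = RawRing.-_ indexRing
    ; 0#                = from 0#
    ; 1#                = from 1#
    ; isCommutativeRing = RingMonomorphism.isCommutativeRing to-isRingMonomorphism (CommutativeRing.isCommutativeRing commutativeRing)
    ; 1≢0               = λ eq → 1≉0 (trans (sym (strictlyInverseˡ 1#)) (trans (Inverse.to-cong enumeration eq) (strictlyInverseˡ 0#)))
    ; recip             = λ i i≢0 → let y , iy≈1 = inverse (to i) (to-nonzero i≢0) in
                            from y , from-cong (trans (*-cong refl (strictlyInverseˡ y)) iy≈1)
    ; q                 = + q
    ; finite            = Fin-finite q
    ; finite³           = Triple-finite q
    ; order             = ∑-allFin q
    ; order³            = ≡.trans (∑-mapped (decode q) (allFin (q ℕ.^ 3)) (λ _ → 1ℤ)) (≡.trans (∑-allFin (q ℕ.^ 3))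
                            (≡.trans (ℤ.pos-* q (q ℕ.^ 2)) (≡.cong (ℤ._*_ (+ q)) (≡.trans (ℤ.pos-* q (q ℕ.* 1)) (≡.cong (λ n → + q ℤ.* + n) (ℕ.*-identityʳ q))))))
    }

  open VectorAlgebra K using (V; 𝟎; _∙_; _⨯_; _⊙_; _⊕_; ∙-⊙; ∙-⊕; ∙-comm; ∙-zeroʳ; ⊙-⨯; ⊕-⨯; ⨯-anticomm; ⨯-zeroʳ; ⊙-zeroʳ; ⊕-identityʳ; ⨯-self; ∙-⨯ˡ; ∙-⨯ʳ;
    dual; parallel; vectors; _≟A_; _≟V_)
  open SolutionCounts K using (⊙-integral; plane-frame; plane-span; plane-independent)
  open DiscreteFiniteField K using () renaming (_+_ to _+K_; _*_ to _*K_; -_ to -K_; isCommutativeRing to K-isCommutativeRing)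

  from-+ : ∀ x y → from (x +F y) ≡ from x +K from y
  from-+ x y = from-cong (sym (+-cong (strictlyInverseˡ x) (strictlyInverseˡ y)))

  from-* : ∀ x y → from (x *F y) ≡ from x *K from y
  from-* x y = from-cong (sym (*-cong (strictlyInverseˡ x) (strictlyInverseˡ y)))

  from-reflects : ∀ {x y} → from x ≡ from y → x ≈ y
  from-reflects {x} {y} eq = trans (sym (strictlyInverseˡ x)) (trans (Inverse.to-cong enumeration eq) (strictlyInverseˡ y))

  point : V → Point F 3
  point ⟨ a , b , c ⟩ = to a VecF.∷ to b VecF.∷ to c VecF.∷ VecF.[]

  coords : Point F 3 → V
  coords x = ⟨ from (x zero) , from (x (suc zero)) , from (x (suc (suc zero))) ⟩

  coords-point : ∀ v → coords (point v) ≡ v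
  coords-point v = triple-≡ (strictlyInverseʳ _) (strictlyInverseʳ _) (strictlyInverseʳ _)

  coords-cong : ∀ {x y} → _≋_ F x y → coords x ≡ coords y
  coords-cong x≋y = triple-≡ (from-cong (x≋y zero)) (from-cong (x≋y (suc zero))) (from-cong (x≋y (suc (suc zero))))

  coords-reflects : ∀ {x y} → coords x ≡ coords y → _≋_ F x y
  coords-reflects eq zero             = from-reflects (≡.cong Triple.x₁ eq)
  coords-reflects eq (suc zero)       = from-reflects (≡.cong Triple.x₂ eq)
  coords-reflects eq (suc (suc zero)) = from-reflects (≡.cong Triple.x₃ eq)

  coords-+ : ∀ x y → coords (λ k → x k +F y k) ≡ coords x ⊕ coords y
  coords-+ x y = triple-≡ (from-+ _ _) (from-+ _ _) (from-+ _ _)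

  coords-* : ∀ s x → coords (λ k → s *F x k) ≡ from s ⊙ coords x
  coords-* s x = triple-≡ (from-* _ _) (from-* _ _) (from-* _ _)

  coords-linComb₁ : ∀ a (b : Fin 1 → Point F 3) → coords (linComb F a b) ≡ from (a zero) ⊙ coords (b zero)
  coords-linComb₁ a b = ≡.trans (coords-cong (λ k → +-identityʳ (a zero *F b zero k))) (coords-* (a zero) (b zero))

  coords-linComb₂ : ∀ a (b : Fin 2 → Point F 3) →
    coords (linComb F a b) ≡ (from (a zero) ⊙ coords (b zero)) ⊕ (from (a (suc zero)) ⊙ coords (b (suc zero)))
  coords-linComb₂ a b = ≡.trans (coords-+ (λ k → a zero *F b zero k) (linComb F (λ i → a (suc i)) (λ i → b (suc i))))
    (≡.cong₂ _⊕_ (coords-* (a zero) (b zero)) (coords-linComb₁ (λ i → a (suc i)) (λ i → b (suc i))))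

  -- The `Lift` reaches the level at which `ProductLike` quantifies over subspaces.
  preimage : ∀ {P : Pred V 0ℓ} → Decidable P → Subset F 3 (c ⊔ ℓ)
  preimage {P} P? = record
    { member  = λ x → Lift (c ⊔ ℓ) (P (coords x))
    ; member? = λ x → map′ lift lower (P? (coords x))
    ; resp    = λ x≋y Px → lift (≡.subst P (coords-cong x≋y) (lower Px))
    }

  -- Lines and planes are given by equations rather than as spans: membership is then decidable at
  -- once, the subspace laws are linearity, and these are the conditions that the moment estimates
  -- count.
  line : V → Subset F 3 (c ⊔ ℓ)
  line v = preimage (λ x → x ⨯ v ≟V 𝟎)

  plane : V → Subset F 3 (c ⊔ ℓ)
  plane w = preimage (λ x → (x ∙ w) ≟A from 0#)

  line-isSubspace : ∀ v → IsSubspace (line v)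
  line-isSubspace v = record
    { 0-closed = lift (≡.trans (⨯-anticomm 𝟎 v) (≡.trans (≡.cong ⊝_ (⨯-zeroʳ v)) ⊝𝟎))
    ; +-closed = λ {x} {y} (lift p) (lift r) → lift (≡.trans (≡.cong (_⨯ v) (coords-+ x y))
        (≡.trans (⊕-⨯ (coords x) (coords y) v) (≡.trans (≡.cong₂ _⊕_ p r) (⊕-identityʳ 𝟎))))
    ; *-closed = λ s {x} (lift p) → lift (≡.trans (≡.cong (_⨯ v) (coords-* s x))
        (≡.trans (⊙-⨯ (from s) (coords x) v) (≡.trans (≡.cong (from s ⊙_) p) (⊙-zeroʳ (from s)))))
    }
    where open VectorAlgebra K using (⊝_; ⊝𝟎)

  plane-isSubspace : ∀ w → IsSubspace (plane w)
  plane-isSubspace w = record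
    { 0-closed = lift (≡.trans (∙-comm 𝟎 w) (∙-zeroʳ w))
    ; +-closed = λ {x} {y} (lift p) (lift r) → lift (≡.trans (≡.cong (_∙ w) (coords-+ x y))
        (≡.trans (∙-⊕ (coords x) (coords y) w) (≡.trans (≡.cong₂ _+K_ p r) (IsCommutativeRing.+-identityʳ K-isCommutativeRing (from 0#)))))
    ; *-closed = λ s {x} (lift p) → lift (≡.trans (≡.cong (_∙ w) (coords-* s x))
        (≡.trans (∙-⊙ (from s) (coords x) w) (≡.trans (≡.cong (from s *K_) p) (IsCommutativeRing.zeroʳ K-isCommutativeRing (from s)))))
    }

  line-dimension : ∀ {v} → v ≢ 𝟎 → HasDimension (line v) 1
  line-dimension {v} v≢𝟎 = b , record
    { in-subspace = λ { zero → lift (≡.trans (≡.cong (_⨯ v) (coords-point v)) (⨯-self v)) }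
    ; independent = λ { a eq zero → from-reflects {a zero} {0#} (⊙-integral v≢𝟎 (≡.trans (≡.sym (combination a)) (coords-cong eq))) }
    ; spanning    = λ x (lift x⨯v≡𝟎) → (λ _ → to (u ∙ coords x)) , coords-reflects (≡.trans (parallel u∙v≡1 x⨯v≡𝟎)
        (≡.trans (≡.cong (_⊙ v) (≡.sym (strictlyInverseʳ (u ∙ coords x)))) (≡.sym (combination (λ _ → to (u ∙ coords x))))))
    }
    where
    u = proj₁ (dual v v≢𝟎)
    u∙v≡1 = proj₂ (dual v v≢𝟎)
    b : Fin 1 → Point F 3
    b _ = point v
    combination : ∀ a → coords (linComb F a b) ≡ from (a zero) ⊙ v
    combination a = ≡.trans (coords-linComb₁ a b) (≡.cong (from (a zero) ⊙_) (coords-point v))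

  module PlaneBasis {w : V} (w≢𝟎 : w ≢ 𝟎) (y z : V) (z≢𝟎 : z ≢ 𝟎) (y⨯z≡w : y ⨯ z ≡ w) where

    basis : Fin 2 → Point F 3
    basis = point y VecF.∷ point z VecF.∷ VecF.[]

    in-plane : ∀ i → Subset.member (plane w) (basis i)
    in-plane zero       = lift (≡.trans (≡.cong₂ _∙_ (coords-point y) (≡.sym y⨯z≡w)) (∙-⨯ˡ y z))
    in-plane (suc zero) = lift (≡.trans (≡.cong₂ _∙_ (coords-point z) (≡.sym y⨯z≡w)) (∙-⨯ʳ y z))

    combination : ∀ a → coords (linComb F a basis) ≡ (from (a zero) ⊙ y) ⊕ (from (a (suc zero)) ⊙ z)
    combination a = ≡.trans (coords-linComb₂ a basis)
      (≡.cong₂ (λ p r → (from (a zero) ⊙ p) ⊕ (from (a (suc zero)) ⊙ r)) (coords-point y) (coords-point z))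

    independent : LinearlyIndependent {F = F} basis
    independent a eq = λ { zero → from-reflects {a zero} {0#} (proj₁ vanish) ; (suc zero) → from-reflects {a (suc zero)} {0#} (proj₂ vanish) }
      where
      vanish : from (a zero) ≡ from 0# × from (a (suc zero)) ≡ from 0#
      vanish = plane-independent y z (≡.subst (_≢ 𝟎) (≡.sym y⨯z≡w) w≢𝟎) z≢𝟎 (≡.trans (≡.sym (combination a)) (coords-cong {linComb F a basis} {λ _ → 0#} eq))

    spanning : ∀ x → Subset.member (plane w) x → ∃ λ a → _≋_ F x (linComb F a basis)
    spanning x (lift x∙w≡0) = coefficients , coords-reflects (≡.trans (plane-span u y z (coords x) y⨯z≡w (proj₂ (dual w w≢𝟎)) x∙w≡0)
        (≡.trans (≡.cong₂ (λ α β → (α ⊙ y) ⊕ (β ⊙ z)) (≡.sym (strictlyInverseʳ α)) (≡.sym (strictlyInverseʳ β))) (≡.sym (combination coefficients))))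
      where
      u = proj₁ (dual w w≢𝟎)
      α = (u ⨯ coords x) ∙ z
      β = -K ((u ⨯ coords x) ∙ y)
      coefficients : Fin 2 → Carrier
      coefficients = to α VecF.∷ to β VecF.∷ VecF.[]

    isBasis : IsBasis (plane w) basis
    isBasis = record { in-subspace = in-plane ; independent = independent ; spanning = spanning }

  plane-dimension : ∀ {w} → w ≢ 𝟎 → HasDimension (plane w) 2
  plane-dimension {w} w≢𝟎 = let y , z , z≢𝟎 , y⨯z≡w = plane-frame w in
    PlaneBasis.basis w≢𝟎 y z z≢𝟎 y⨯z≡w , PlaneBasis.isBasis w≢𝟎 y z z≢𝟎 y⨯z≡w

  -- The listed points and the images of triples agree coordinate by coordinate but not as
  -- functions, hence the appeal to `resp`.
  +card : ∀ {h} (S : Subset F 3 h) → + card S ≡ ∑ vectors (λ v → ι (Subset.member? S (point v)))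
  +card S = ≡.trans (+length-filter-map _ (allFin (q ℕ.^ 3)) member?)
    (≡.trans (∑-cong (allFin (q ℕ.^ 3)) (λ i → ι-cong (member? _) (member? (point (decode q i))) (resp (agree i)) (resp (λ k → sym (agree i k)))))
      (≡.sym (∑-mapped (decode q) (allFin (q ℕ.^ 3)) (λ v → ι (member? (point v))))))
    where
    open Subset S
    agree : ∀ i → _≋_ F (λ k → to (finToFun {q} {3} i k)) (point (decode q i))
    agree i zero             = refl
    agree i (suc zero)       = refl
    agree i (suc (suc zero)) = refl

  -- The triple product is the Laplace expansion along the first row; the minus sign of the middle
  -- term is hidden in the reversed order of the second coordinate of the cross product.
  vol-point : ∀ x y z → to (x ∙ (y ⨯ z)) ≈ vol F (point x) (point y) (point z)
  vol-point ⟨ a , b , c ⟩ ⟨ x , y , z ⟩ ⟨ p , r , s ⟩ = trans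
    (to-sum _ _ (to-sum _ _ (to-product a _ (to-minor y z r s)) (to-product b _ (to-minor z x s p))) (to-product c _ (to-minor x y p r)))
    (laplace (to a) (to b) (to c) (to x) (to y) (to z) (to p) (to r) (to s))
    where
    to-sum : ∀ i j {α β} → to i ≈ α → to j ≈ β → to (i +K j) ≈ α +F β
    to-sum i j eq eq′ = trans (strictlyInverseˡ _) (+-cong eq eq′)
    to-product : ∀ i j {β} → to j ≈ β → to (i *K j) ≈ to i *F β
    to-product i j eq = trans (strictlyInverseˡ _) (*-cong refl eq)
    to-minor : ∀ a b c d → to ((a *K d) +K (-K (b *K c))) ≈ (to a *F to d) +F (-F (to b *F to c))
    to-minor a b c d = to-sum _ _ (strictlyInverseˡ _) (trans (strictlyInverseˡ _) (-‿cong (strictlyInverseˡ _)))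
    laplace : ∀ a b c x y z p r s →
      ((a *F ((y *F s) +F (-F (z *F r)))) +F (b *F ((z *F p) +F (-F (x *F s))))) +F (c *F ((x *F r) +F (-F (y *F p)))) ≈
      det F (((a VecF.∷ b VecF.∷ c VecF.∷ VecF.[]) VecF.∷ (x VecF.∷ y VecF.∷ z VecF.∷ VecF.[]) VecF.∷ (p VecF.∷ r VecF.∷ s VecF.∷ VecF.[]) VecF.∷ VecF.[]))
    laplace a b c x y z p r s = sym (trans
      (+-cong (positive (*-cong refl (minor y z r s))) (+-cong (negative (*-cong refl (minor x z p s))) (trans (+-identityʳ _) (double (*-cong refl (minor x y p r))))))
      (solve 9 (λ a b c x y z p r s →
        a :* (y :* s :+ :- (z :* r)) :+ (:- (b :* (x :* s :+ :- (z :* p))) :+ c :* (x :* r :+ :- (y :* p))) :=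
        a :* (y :* s :+ :- (z :* r)) :+ b :* (z :* p :+ :- (x :* s)) :+ c :* (x :* r :+ :- (y :* p))) refl a b c x y z p r s))
      where
      open DifferenceSolver commutativeRing using (solve; _:=_; _:+_; _:*_; :-_)
      open RingProperties ring using (-1*x≈-x; -‿involutive)
      positive : ∀ {x y} → x ≈ y → 1# *F x ≈ y
      positive eq = trans (*-identityˡ _) eq
      negative : ∀ {x y} → x ≈ y → ((-F 1#) *F 1#) *F x ≈ -F y
      negative eq = trans (*-cong (*-identityʳ _) eq) (-1*x≈-x _)
      double : ∀ {x y} → x ≈ y → ((-F 1#) *F ((-F 1#) *F 1#)) *F x ≈ y
      double eq = trans (*-cong (trans (-1*x≈-x _) (trans (-‿cong (*-identityʳ _)) (-‿involutive 1#))) eq) (*-identityˡ _)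
      entry : ∀ x → (1# *F (x *F 1#)) +F 0# ≈ x
      entry x = trans (+-identityʳ _) (trans (*-identityˡ _) (*-identityʳ x))
      minor : ∀ a b c d → (1# *F (a *F ((1# *F (d *F 1#)) +F 0#))) +F ((((-F 1#) *F 1#) *F (b *F ((1# *F (c *F 1#)) +F 0#))) +F 0#) ≈ (a *F d) +F (-F (b *F c))
      minor a b c d = +-cong (positive (*-cong refl (entry d))) (trans (+-identityʳ _) (negative (*-cong refl (entry c))))

-- Nonnegativity makes every quantity the image of a natural number. `_⊗_` and `_⊞_` then rebuild
-- each side of an inequality as the image of a natural expression, and `cast` removes the
-- embedding.
integral-contradiction : ∀ {c k m q : ℕ} {N F G W : ℤ} → 1 ℕ.≤ k → 2 ℕ.≤ q → 1 ℕ.≤ m → 16 ℕ.* k ≡ c →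
  c ℕ.^ 8 ℕ.* q ℕ.^ 5 ℕ.≤ m ℕ.^ 8 → + (m ℕ.^ 3) ℤ.≤ + 16 ℤ.* N →
  0ℤ ℤ.≤ N → 0ℤ ℤ.≤ F → 0ℤ ℤ.≤ G → 0ℤ ℤ.≤ W →
  N ℤ.* F ℤ.* (N ℤ.* F) ℤ.≤ G ℤ.* (+ q ℤ.* + q ℤ.* (+ q ℤ.* + q) ℤ.* N) →
  + q ℤ.* + q ℤ.* G ℤ.≤ (+ 2 ℤ.* (+ (k ℕ.* m ℕ.^ 2) ℤ.* + (k ℕ.* m ℕ.^ 2)) ℤ.+ + 4 ℤ.* (+ (k ℕ.* m) ℤ.* (+ q ℤ.* + q))) ℤ.* W →
  W ℤ.≤ N ℤ.* (N ℤ.* + q ℤ.+ + q ℤ.* + q ℤ.* + (k ℕ.* m)) →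
  N ℤ.* N ℤ.≤ F ℤ.+ N ℤ.* + (k ℕ.* m) → ⊥
integral-contradiction {c} {k} {m} {q} {+ N} {+ F} {+ G} {+ W} 1≤k 2≤q 1≤m 16k≡c c⁸q⁵≤m⁸ m³≤16N _ _ _ _ correlation G-bound W-bound F-bound =
  numeric-contradiction 1≤k (ℕ.≤-trans (s≤s z≤n) 2≤q) 1≤m 16k≡c
    (cast (leaf (m ℕ.^ 3)) (leaf 16 ⊗ leaf N) m³≤16N) c⁸q⁵≤m⁸ 2≤q
    (cast ((leaf N ⊗ leaf F) ⊗ (leaf N ⊗ leaf F)) (leaf G ⊗ ((q² ⊗ q²) ⊗ leaf N)) correlation)
    (cast (q² ⊗ leaf G) (((leaf 2 ⊗ (leaf B ⊗ leaf B)) ⊞ (leaf 4 ⊗ (leaf L ⊗ q²))) ⊗ leaf W) G-bound)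
    (cast (leaf W) (leaf N ⊗ ((leaf N ⊗ leaf q) ⊞ (q² ⊗ leaf L))) W-bound)
    (cast (leaf N ⊗ leaf N) (leaf F ⊞ (leaf N ⊗ leaf L)) F-bound)
  where
  B = k ℕ.* m ℕ.^ 2
  L = k ℕ.* m
  leaf : ∀ n → + n ≡ + n
  leaf n = ≡.refl
  _⊗_ : ∀ {a b m n} → a ≡ + m → b ≡ + n → a ℤ.* b ≡ + (m ℕ.* n)
  _⊗_ {m = m} {n} ≡.refl ≡.refl = ≡.sym (ℤ.pos-* m n)
  _⊞_ : ∀ {a b m n} → a ≡ + m → b ≡ + n → a ℤ.+ b ≡ + (m ℕ.+ n)
  _⊞_ ≡.refl ≡.refl = ≡.refl
  cast : ∀ {a b m n} → a ≡ + m → b ≡ + n → a ℤ.≤ b → m ℕ.≤ n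
  cast ≡.refl ≡.refl a≤b = ℤ.drop‿+≤+ a≤b
  q² = leaf q ⊗ leaf q

-- The estimates applied to E without the origin

module _ {c ℓ e : Level} (F : FiniteField c ℓ) (E : Subset F 3 e) where
  open FiniteField F using (q; enumeration; 0#)
  private module F = FiniteField F
  open Inverse enumeration using (to; from)
  open Discrete F
  open DiscreteFiniteField K using (finite³)
  open VectorAlgebra K using (V; 𝟎; _∙_; _⨯_; ⨯-anticomm; ⊝𝟎; ⊝_; vectors; _≟A_; _≟V_)
  open SolutionCounts K using (2≤q)
  open Subset E using (member; member?)

  E₀ : Pred V e
  E₀ v = point v ∈ member × v ≢ 𝟎

  E₀? : Decidable E₀
  E₀? v = member? (point v) ×-dec ¬? (v ≟V 𝟎)

  open PlaneMoments K E₀? using (P; f; missing-volume; G-bound; W-bound; N²≤F+NL)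
  open WeightedSums vectors E₀? using () renaming (#E to N; 0≤#E to 0≤N; e to ε)

  slice-bound : ∀ {p} {P : Pred V 0ℓ} (P? : Decidable P) {R : Pred V p} (R? : Decidable R) →
    (∀ {v} → R v → E₀ v × P v) → ∑ vectors (λ v → ι (R? v)) ℤ.≤ + card (E ∩ preimage P?)
  slice-bound {P = P} P? R? R⇒ = ℤ.≤-trans
    (∑-mono vectors (λ v → ι-mono (R? v) (Subset.member? (E ∩ preimage P?) (point v))
      (λ Rv → proj₁ (proj₁ (R⇒ Rv)) , lift (≡.subst P (≡.sym (coords-point v)) (proj₂ (R⇒ Rv))))))
    (ℤ.≤-reflexive (≡.sym (+card (E ∩ preimage P?))))

  card≤N+1 : + card E ℤ.≤ N ℤ.+ 1ℤ
  card≤N+1 = begin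
    + card E                                         ≡⟨ +card E ⟩
    ∑ vectors (λ v → ι (member? (point v)))          ≤⟨ ∑-mono vectors split ⟩
    ∑ vectors (λ v → ε v ℤ.+ ι (v ≟V 𝟎))             ≡⟨ ∑-+ vectors ε (λ v → ι (v ≟V 𝟎)) ⟩
    N ℤ.+ ∑ vectors (λ v → ι (v ≟V 𝟎))               ≡⟨ ≡.cong (ℤ._+_ N) (Finite.once finite³ 𝟎) ⟩
    N ℤ.+ 1ℤ                                         ∎
    where
    open ℤ.≤-Reasoning
    split : ∀ v → ι (member? (point v)) ℤ.≤ ι (E₀? v) ℤ.+ ι (v ≟V 𝟎)
    split v = cases (member? (point v)) (v ≟V 𝟎)
      where
      cases : ∀ {p r} {P : Set p} {R : Set r} (P? : Dec P) (R? : Dec R) → ι P? ℤ.≤ ι (P? ×-dec ¬? R?) ℤ.+ ι R?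
      cases (yes _) (yes _) = +≤+ (s≤s z≤n)
      cases (yes _) (no  _) = +≤+ (s≤s z≤n)
      cases (no  _) (yes _) = +≤+ z≤n
      cases (no  _) (no  _) = +≤+ z≤n

  -- The argument by contradiction is constructive, since a search through all triples of vectors
  -- decides whether the volume occurs.
  volume-exists : ∀ {t} → t ∈ F* F → ¬ (∀ x y z → E₀ x → E₀ y → E₀ z → x ∙ (y ⨯ z) ≢ from t) → t ∈ volSet E
  volume-exists {t} t≉0 ¬missing = decide (Finite.any? finite³ (λ x → Finite.any? finite³ (λ y → Finite.any? finite³ (λ z →
    E₀? x ×-dec E₀? y ×-dec E₀? z ×-dec ((x ∙ (y ⨯ z)) ≟A from t)))))
    where
    decide : Dec (∃ λ x → ∃ λ y → ∃ λ z → E₀ x × E₀ y × E₀ z × x ∙ (y ⨯ z) ≡ from t) → t ∈ volSet E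
    decide (yes (x , y , z , (Ex , _) , (Ey , _) , (Ez , _) , eq)) = point x , point y , point z , Ex , Ey , Ez ,
      F.trans (F.sym (Inverse.strictlyInverseˡ enumeration t)) (F.trans (Inverse.to-cong enumeration (≡.sym eq)) (vol-point x y z))
    decide (no none) = ⊥-elim (¬missing (λ x y z Ex Ey Ez eq → none (x , y , z , Ex , Ey , Ez , eq)))

  module _ {k : ℕ} (1≤k : 1 ℕ.≤ k)
    (line-card  : ∀ {v} → v ≢ 𝟎 → card (E ∩ line v) ℕ.^ 3 ℕ.≤ k ℕ.^ 3 ℕ.* card E ℕ.^ 1)
    (plane-card : ∀ {w} → w ≢ 𝟎 → card (E ∩ plane w) ℕ.^ 3 ℕ.≤ k ℕ.^ 3 ℕ.* card E ℕ.^ 2)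
    (large      : ((16 ℕ.* k) ℕ.^ 3) ℕ.^ 8 ℕ.* q ℕ.^ 15 ℕ.≤ card E ℕ.^ 8)
    where

    private
      r : ℕ
      r = 16 ℕ.* k

      1≤q : 1 ℕ.≤ q
      1≤q = ℤ.drop‿+≤+ (ℤ.≤-trans (+≤+ (s≤s z≤n)) 2≤q)

      16≤r : 16 ℕ.≤ r
      16≤r = ℕ.*-monoʳ-≤ 16 1≤k

      -- A constant to the eighth power below |E|⁸ is itself below |E|. Having more than one point
      -- makes the loss of the origin cost at most a factor 2.
      16≤card : 16 ℕ.≤ card E
      16≤card = ℕ.≤-trans 16≤r (ℕ.≤-trans r≤r³ (^-cancelʳ-≤ 8 (ℕ.≤-trans (ℕ.m≤m*n _ (q ℕ.^ 15) {{>-nonZero (1≤^ 15 1≤q)}}) large)))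
        where
        r≤r³ : r ℕ.≤ r ℕ.^ 3
        r≤r³ = ℕ.m≤m*n r (r ℕ.^ 2) {{>-nonZero (1≤^ 2 (ℕ.≤-trans (s≤s z≤n) 16≤r))}}

    module _ {m : ℕ} (1≤m : 1 ℕ.≤ m) (card≤m³ : card E ℕ.≤ m ℕ.^ 3) (m³≤8card : m ℕ.^ 3 ℕ.≤ 8 ℕ.* card E) where

      private
        -- Because (m³)ⁿ = (mⁿ)³, enclosing |E| in a cube gives the bound in dimension n the exact
        -- cube root k mⁿ.
        root : ∀ {a} n → a ℕ.^ 3 ℕ.≤ k ℕ.^ 3 ℕ.* card E ℕ.^ n → a ℕ.≤ k ℕ.* m ℕ.^ n
        root {a} n a³≤ = ^-cancelʳ-≤ 3 (begin
          a ℕ.^ 3                             ≤⟨ a³≤ ⟩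
          k ℕ.^ 3 ℕ.* card E ℕ.^ n            ≤⟨ ℕ.*-monoʳ-≤ (k ℕ.^ 3) (ℕ.^-monoˡ-≤ n card≤m³) ⟩
          k ℕ.^ 3 ℕ.* (m ℕ.^ 3) ℕ.^ n         ≡⟨ ≡.cong (k ℕ.^ 3 ℕ.*_) (≡.trans (ℕ.^-*-assoc m 3 n) (≡.trans (≡.cong (m ℕ.^_) (ℕ.*-comm 3 n)) (≡.sym (ℕ.^-*-assoc m n 3)))) ⟩
          k ℕ.^ 3 ℕ.* (m ℕ.^ n) ℕ.^ 3         ≡⟨ ^-distribʳ-* 3 k (m ℕ.^ n) ⟨
          (k ℕ.* m ℕ.^ n) ℕ.^ 3               ∎)
          where open ℕ.≤-Reasoning

        L-bound : ∀ y → y ≢ 𝟎 → ∑ vectors (λ z → ε z ℤ.* ι (y ⨯ z ≟V 𝟎)) ℤ.≤ + (k ℕ.* m)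
        L-bound y y≢𝟎 = ℤ.≤-trans (ℤ.≤-reflexive (∑-cong vectors (λ z → ≡.sym (ι-× (E₀? z) (y ⨯ z ≟V 𝟎)))))
          (ℤ.≤-trans (slice-bound (λ x → x ⨯ y ≟V 𝟎) (λ z → E₀? z ×-dec (y ⨯ z ≟V 𝟎))
              (λ {z} (Ez , y⨯z≡𝟎) → Ez , ≡.trans (⨯-anticomm z y) (≡.trans (≡.cong ⊝_ y⨯z≡𝟎) ⊝𝟎)))
            (+≤+ (≡.subst (λ n → card (E ∩ line y) ℕ.≤ k ℕ.* n) (ℕ.*-identityʳ m) (root 1 (line-card y≢𝟎)))))

        B-bound : ∀ w → w ≢ 𝟎 → P w ℤ.≤ + (k ℕ.* m ℕ.^ 2)
        B-bound w w≢𝟎 = ℤ.≤-trans (slice-bound (λ x → (x ∙ w) ≟A from 0#) (λ y → E₀? y ×-dec ((y ∙ w) ≟A from 0#)) (λ Ry → Ry))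
          (+≤+ (root 2 (plane-card w≢𝟎)))

        -- The constant is chosen as the cube r³, and 15 = 3 · 5, so the size hypothesis also has an
        -- exact cube root once |E| is replaced by m³.
        r⁸q⁵≤m⁸ : r ℕ.^ 8 ℕ.* q ℕ.^ 5 ℕ.≤ m ℕ.^ 8
        r⁸q⁵≤m⁸ = ^-cancelʳ-≤ 3 (begin
          (r ℕ.^ 8 ℕ.* q ℕ.^ 5) ℕ.^ 3              ≡⟨ ^-distribʳ-* 3 (r ℕ.^ 8) (q ℕ.^ 5) ⟩
          (r ℕ.^ 8) ℕ.^ 3 ℕ.* (q ℕ.^ 5) ℕ.^ 3      ≡⟨ ≡.cong₂ ℕ._*_ (≡.trans (ℕ.^-*-assoc r 8 3) (≡.sym (ℕ.^-*-assoc r 3 8))) (ℕ.^-*-assoc q 5 3) ⟩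
          (r ℕ.^ 3) ℕ.^ 8 ℕ.* q ℕ.^ 15             ≤⟨ large ⟩
          card E ℕ.^ 8                             ≤⟨ ℕ.^-monoˡ-≤ 8 card≤m³ ⟩
          (m ℕ.^ 3) ℕ.^ 8                          ≡⟨ ≡.trans (ℕ.^-*-assoc m 3 8) (≡.sym (ℕ.^-*-assoc m 8 3)) ⟩
          (m ℕ.^ 8) ℕ.^ 3                          ∎)
          where open ℕ.≤-Reasoning

        m³≤16N : + (m ℕ.^ 3) ℤ.≤ + 16 ℤ.* N
        m³≤16N = bound N card≤N+1
          where
          open ℕ.≤-Reasoning
          bound : ∀ N → + card E ℤ.≤ N ℤ.+ 1ℤ → + (m ℕ.^ 3) ℤ.≤ + 16 ℤ.* N
          bound (+ n) (+≤+ card≤n+1) = ≡.subst (+ (m ℕ.^ 3) ℤ.≤_) (ℤ.pos-* 16 n) (+≤+ (begin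
            m ℕ.^ 3              ≤⟨ m³≤8card ⟩
            -- From 8 to 16: |E| ≤ N + 1 ≤ 2 N.
            8 ℕ.* card E         ≤⟨ ℕ.*-monoʳ-≤ 8 (ℕ.≤-trans card≤n+1 (ℕ.+-monoʳ-≤ n 1≤n)) ⟩
            8 ℕ.* (n ℕ.+ n)      ≡⟨ ≡.cong (λ x → 8 ℕ.* (n ℕ.+ x)) (ℕ.+-identityʳ n) ⟨
            8 ℕ.* (2 ℕ.* n)      ≡⟨ ℕ.*-assoc 8 2 n ⟨
            16 ℕ.* n             ∎))
            where
            1≤n : 1 ℕ.≤ n
            1≤n = ℕ.+-cancelʳ-≤ 1 1 n (ℕ.≤-trans (s≤s (s≤s z≤n)) (ℕ.≤-trans 16≤card card≤n+1))
          -- This case is N = -1, where |E| ≤ N + 1 would leave E empty.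
          bound ℤ.-[1+ 0 ]     (+≤+ card≤0) = contradiction (ℕ.≤-trans 16≤card card≤0) (λ ())
          bound ℤ.-[1+ suc n ] ()

      no-missing-volume : ∀ {t} → t ∈ F* F → ¬ (∀ x y z → E₀ x → E₀ y → E₀ z → x ∙ (y ⨯ z) ≢ from t)
      no-missing-volume t≉0 missing = integral-contradiction 1≤k (ℤ.drop‿+≤+ 2≤q) 1≤m ≡.refl r⁸q⁵≤m⁸ m³≤16N 0≤N
        (∑-nonneg vectors (λ w → 0≤a*b (ι-nonneg (¬? (w ≟V 𝟎))) (∑-nonneg vectors (λ y → 0≤a*b (ι-nonneg (E₀? y)) (∑-nonneg vectors (λ z →
          0≤a*b (ι-nonneg (E₀? z)) (ι-nonneg (y ⨯ z ≟V w))))))))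
        (∑-nonneg vectors (λ w → 0≤a*b (ι-nonneg (¬? (w ≟V 𝟎))) (0≤a² (f w))))
        (∑-nonneg vectors (λ w → 0≤a*b (ι-nonneg (¬? (w ≟V 𝟎))) (0≤a² (P w))))
        (missing-volume 0∉E₀ (λ eq → t≉0 (from-reflects eq)) missing)
        (G-bound 0∉E₀ (+≤+ z≤n) L-bound (+≤+ z≤n) B-bound)
        (W-bound 0∉E₀ (+≤+ z≤n) L-bound)
        (N²≤F+NL 0∉E₀ (+≤+ z≤n) L-bound)
        where
        0∉E₀ : ¬ E₀ 𝟎
        0∉E₀ (_ , 𝟎≢𝟎) = 𝟎≢𝟎 ≡.refl

    all-volumes : F* F ⊆ volSet E
    all-volumes t≉0 = let m , 1≤m , card≤m³ , m³≤8card = cube-approximation (card E) (ℕ.≤-trans (s≤s z≤n) 16≤card) in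
      volume-exists t≉0 (no-missing-volume 1≤m card≤m³ m³≤8card t≉0)

theorem2p6 : {c ℓ e : Level} →
    (K : ℚ) → 0ℚ < K →
    Σ ℚ λ C → 0ℚ < C ×
    ((F : FiniteField c ℓ) (E : Subset F 3 e) →
    ProductLike K E →
    C ^ 8 * fromℕ (FiniteField.q F) ^ 15 ≤ fromℕ (card E) ^ 8 →
    F* F ⊆ volSet E)
theorem2p6 K 0<K = fromℕ (r ℕ.^ 3) , 0<fromℕ (1≤^ 3 (ℕ.≤-trans 1≤k (ℕ.m≤n*m k 16))) , λ F E product-like large →
    all-volumes F E 1≤k
      (λ {v} v≢𝟎 → cube-bound {K} {k} (ℚ.<⇒≤ 0<K) K≤k (card (E ∩ Discrete.line F v)) (card E) 1
        (product-like 1 (Discrete.line F v) (Discrete.line-isSubspace F v) (Discrete.line-dimension F v≢𝟎)))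
      (λ {w} w≢𝟎 → cube-bound {K} {k} (ℚ.<⇒≤ 0<K) K≤k (card (E ∩ Discrete.plane F w)) (card E) 2
        (product-like 2 (Discrete.plane F w) (Discrete.plane-isSubspace F w) (Discrete.plane-dimension F w≢𝟎)))
      (fromℕ-cancel-≤ (≡.subst₂ _≤_
        (≡.trans (≡.cong₂ _*_ (fromℕ-^ (r ℕ.^ 3) 8) (fromℕ-^ (FiniteField.q F) 15)) (fromℕ-* ((r ℕ.^ 3) ℕ.^ 8) (FiniteField.q F ℕ.^ 15)))
        (fromℕ-^ (card E) 8) large))
  where
  k = proj₁ (≤-fromℕ K 0<K)
  1≤k = proj₁ (proj₂ (≤-fromℕ K 0<K))
  K≤k = proj₂ (proj₂ (≤-fromℕ K 0<K))
  -- The factor 16 is what pays for every numerical constant in `numeric-contradiction`; k is a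
  -- natural number above K.
  r = 16 ℕ.* k
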